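{- Let $k$ be a positive integer. The map $$\Phi_C:\mathbf{A}_{\overline k}^{k}\to\bigcup_{\ell(\lambda)\le k}\mathrm{KT}_k(\lambda)\times\mathrm{SSOT}_k(\lambda),\qquad w\mapsto (P_C(w),Q_C(w)),$$ where the union is over all partitions $\lambda$ with at most $k$ rows, is a bijection.
   Context: Alphabet and tableaux. $[k]=\{1,\dots,k\}$ and $[\overline{k}]=\{1,\overline1,\dots,k,\overline k\}$ with the total order $1<\overline1<2<\overline2<\cdots<k<\overline k$. Partitions are identified with Young diagrams in English notation; $\ell(\lambda)$ is the number of rows of $\lambda$. A King tableau of shape $\lambda$ is a filling of $\lambda$ by elements of $[\overline k]$ such that entries weakly increase along rows, strictly increase down columns, and all entries in row $i$ are $\ge i$ for every $i$. $\mathrm{KT}_k(\lambda)$ is the set of these. Berele insertion $T\leftarrow x$ ($T$ a King tableau, $x\in[\overline k]$). Start as in Schensted row insertion: insert $x$ into row 1; inserting a letter $a$ into a row replaces (bumps) the leftmost entry that is strictly larger than $a$, and the bumped entry is then inserted into the next row; if no entry of the row is larger than $a$, then $a$ is put at the end of the row and the procedure stops. Exception: if at some moment the letter $i$ is to be inserted into row $i$ and row $i$ contains at least one $\overline i$, then instead: replace the first $\overline i$ of row $i$ by $i$, replace the first $i$ of row $i$ by an empty box, and play jeu de taquin with this empty box: repeatedly, if the empty box has a box with entry $b$ below it and/or a box with entry $r$ to its right, slide $b$ up when only $b$ exists or when both exist and $b\le r$, and slide $r$ left when only $r$ exists or when both exist and $b>r$; once the empty box is at a corner of the shape, delete it and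 stop. The result is again a King tableau, and each insertion changes the shape by adding or deleting exactly one box. Arrays. $\mathbf{A}_{\overline k}^{k}$ is the set of all two-line arrays $w=\begin{pmatrix}u_1&\cdots&u_n\\ v_1&\cdots&v_n\end{pmatrix}$ (of any length $n\ge0$) with $u_j\in[k]$, $v_j\in[\overline k]$, $u_j\le u_{j+1}$, and $u_j=u_{j+1}\Rightarrow v_j\le v_{j+1}$. SSOT. A skew shape is a horizontal strip if it contains at most one box in each column. A $k$-semistandard oscillating tableau ($k$-SSOT, of the second kind) of final shape $\lambda$ is a finite sequence of partitions $S=(S^{1},S'^{2},S^{2},S'^{3},\dots,S'^{k},S^{k})$ such that, with $S'^{1}=\emptyset$: $S^{i}\supseteq S'^{i+1}$ and $S^i\setminus S'^{i+1}$ is a (possibly empty) horizontal strip for $1\le i\le k-1$; $S'^{i}\subseteq S^{i}$ and $S^i\setminus S'^i$ is a (possibly empty) horizontal strip for $1\le i\le k$; and $S^k=\lambda$. $\mathrm{SSOT}_k(\lambda)$ is the set of these. Passing from $S'^{i}$ to $S^{i}$ (adding boxes) and, for $i\ge2$, from $S^{i-1}$ to $S'^{i}$ (deleting boxes) are together called step $i$. An SSOT $S$ is identified with the multiset-valued tableau in which the number $i$ is recorded at a box position once for each time that box is added or deleted in step $i$. The map. For $w=\begin{pmatrix}u_1&\cdots&u_n\\ v_1&\cdots&v_n\end{pmatrix}\in\mathbf{A}_{\overline k}^{k}$, $P_0(w)=\emptyset$, $P_j(w)=P_{j-1}(w)\leftarrow v_j$ (Berele insertion), and $P_C(w)=P_n(w)$.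 $Q_0(w)=\emptyset$ and $Q_j(w)$ is the multiset-valued tableau obtained from $Q_{j-1}(w)$ by placing $u_j$ into the position of the box that was added or deleted in the insertion $P_{j-1}(w)\leftarrow v_j$; $Q_C(w)=Q_n(w)$, which is (the multiset-valued tableau encoding) a $k$-SSOT whose final shape is the shape of $P_C(w)$. Equivalently, with $\lambda_j$ the shape of $P_j(w)$, the SSOT $Q_C(w)$ has $S^i=\lambda_{r}$ where $r$ is the number of $j$ with $u_j\le i$, and $S'^{i}$ is the shape reached from $S^{i-1}$ after the box-deleting insertions among those with $u_j=i$ (these precede the box-adding ones). -}

module Defs where

open import Data.Bool.Base using (_xor_; _∧_; if_then_else_)
open import Data.Fin.Base as Fin using (Fin; toℕ)
import Data.Fin.Properties as Fin
open import Data.List.Base using (List; []; _∷_; _++_; [_]; map; length; lookup; take; drop; break)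
open import Data.List.Membership.Propositional using (_∈_)
open import Data.List.Relation.Binary.Pointwise.Base using (Pointwise)
open import Data.List.Relation.Unary.All using (All)
open import Data.List.Relation.Unary.Any using (any?)
open import Data.List.Relation.Unary.Linked using (Linked)
open import Data.Maybe.Base using (Maybe; just; nothing)
open import Data.Nat.Base using (ℕ; zero; suc; _+_; _*_; _≤_; _<_; _≥_; _<ᵇ_; _≡ᵇ_)
open import Data.Nat.Properties using (_≟_; _<?_; _≤?_)
open import Data.Product.Base using (∃-syntax; _×_; _,_; proj₁; proj₂)
open import Level using (0ℓ)
open import Relation.Binary.Bundles using (Setoid)
open import Relation.Binary.Definitions using (DecidableEquality)
import Relation.Binary.Construct.On as On
open import Relation.Binary.PropositionalEquality using (_≡_; refl; cong; setoid)
open import Relation.Nullary.Decidable using (Dec; yes; no; map′)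
open import Relation.Nullary.Negation.Core using (¬_)

-- Letters, rows, columns and steps are all numbered from 0: the element i of
-- Fin k stands for the number i + 1 of [k], and row r is the (r + 1)-st row.

------------------------------------------------------------------------
-- Alphabet

data Letter (k : ℕ) : Set where
  unbarred barred : Fin k → Letter k

-- The order 1 < 1̄ < 2 < 2̄ < ⋯ is pulled back from ℕ along rank.
rank : ∀ {k} → Letter k → ℕ
rank (unbarred i) = 2 * toℕ i
rank (barred   i) = suc (2 * toℕ i)

infix 4 _≤ₗ_ _<ₗ_

_≤ₗ_ _<ₗ_ : ∀ {k} → Letter k → Letter k → Set
a ≤ₗ b = rank a ≤ rank b
a <ₗ b = rank a < rank b

_≟ₗ_ : ∀ {k} → DecidableEquality (Letter k)
unbarred i ≟ₗ unbarred j = map′ (cong unbarred) (λ { refl → refl }) (i Fin.≟ j)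
unbarred i ≟ₗ barred   j = no λ ()
barred   i ≟ₗ unbarred j = no λ ()
barred   i ≟ₗ barred   j = map′ (cong barred) (λ { refl → refl }) (i Fin.≟ j)

------------------------------------------------------------------------
-- Partitions and horizontal strips

Shape : Set
Shape = List ℕ

IsPartition : Shape → Set
IsPartition μ = Linked _≥_ μ × All (0 <_) μ

rowLength : Shape → ℕ → ℕ
rowLength []      _       = 0
rowLength (m ∷ _) zero    = m
rowLength (_ ∷ μ) (suc r) = rowLength μ r

_∋[_,_] : Shape → ℕ → ℕ → Set
μ ∋[ r , c ] = c < rowLength μ r

infix 4 _⊆ₛ_

_⊆ₛ_ : Shape → Shape → Set
μ ⊆ₛ ν = ∀ r c → μ ∋[ r , c ] → ν ∋[ r , c ]

-- μ ⊆ ν and ν ∖ μ has at most one box in each column.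
HorizontalStrip : (ν μ : Shape) → Set
HorizontalStrip ν μ = μ ⊆ₛ ν ×
  (∀ c r r′ → ν ∋[ r , c ] → ¬ μ ∋[ r , c ] → ν ∋[ r′ , c ] → ¬ μ ∋[ r′ , c ] → r ≡ r′)

------------------------------------------------------------------------
-- King tableaux

Row : ℕ → Set
Row k = List (Letter k)

Filling : ℕ → Set
Filling k = List (Row k)

shapeOf : ∀ {k} → Filling k → Shape
shapeOf = map length

-- Each entry of the lower row exceeds the entry directly above it (and the
-- lower row is not longer than the upper one).
Below : ∀ {k} → Row k → Row k → Set
Below upper lower = Pointwise _<ₗ_ (take (length lower) upper) lower

record KingTableau (k : ℕ) (μ : Shape) : Set where
  field
    filling : Filling k
    shape   : shapeOf filling ≡ μ
    rows    : All (Linked _≤ₗ_) filling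
    columns : Linked Below filling
    -- 2 * r is the rank of the unbarred letter of index r.
    bounded : ∀ r → All (λ x → 2 * toℕ r ≤ rank x) (lookup filling r)

------------------------------------------------------------------------
-- Berele insertion

-- The new row, and the letter bumped out of it, if any.
bump : ∀ {k} → Letter k → Row k → Row k × Maybe (Letter k)
bump a []       = [ a ] , nothing
bump a (x ∷ xs) with rank a <? rank x
... | yes _ = a ∷ xs , just x
... | no  _ = let (xs′ , b) = bump a xs in x ∷ xs′ , b

infixr 5 _∷⁺_

_∷⁺_ : ∀ {k} → Row k → Filling k → Filling k
[]          ∷⁺ rows = rows
row@(_ ∷ _) ∷⁺ rows = row ∷ rows

-- Jeu de taquin, while the empty box stays in one row: this row is `left`, the
-- empty box, `right`, and `below` is the next row. The result is the final row
-- and, if the empty box moves down, the parts of `below` on its two sides.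
-- At column c = length left, `drop c` exposes the entry below the empty box.
slideRow : ∀ {k} → (left right below : Row k) → Row k × Maybe (Row k × Row k)
slideRow left [] below with drop (length left) below
... | []     = left , nothing
... | b ∷ bs = left ++ [ b ] , just (take (length left) below , bs)
slideRow left (x ∷ right) below with drop (length left) below
... | []     = slideRow (left ++ [ x ]) right below
... | b ∷ bs with rank b ≤? rank x
...   | yes _ = left ++ b ∷ x ∷ right , just (take (length left) below , bs)
...   | no  _ = slideRow (left ++ [ x ]) right below

slide : ∀ {k} → (left right : Row k) → Filling k → Filling k
slide left right []           = proj₁ (slideRow left right []) ∷⁺ []
slide left right (row ∷ rows) with slideRow left right row
... | row′ , nothing               = row′ ∷⁺ row ∷ rows
... | row′ , just (left′ , right′) = row′ ∷ slide left′ right′ rows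

-- The exceptional case: the letter a is i, to be inserted into row i, which
-- contains an ī.
Cancels : ∀ {k} → ℕ → Letter k → Row k → Set
Cancels r a row = ∃[ i ] a ≡ unbarred i × toℕ i ≡ r × barred i ∈ row

cancels? : ∀ {k} r (a : Letter k) row → Dec (Cancels r a row)
cancels? r (barred   i) row = no λ ()
cancels? r (unbarred i) row with toℕ i ≟ r | any? (barred i ≟ₗ_) row
... | yes p | yes q = yes (i , refl , p , q)
... | yes _ | no ¬q = no λ { (_ , refl , _ , q) → ¬q q }
... | no ¬p | _     = no λ { (_ , refl , p , _) → ¬p p }

-- `break` cuts a row just before the first occurrence of a letter, and `drop 1`
-- removes that occurrence.
replaceFirst : ∀ {k} → Letter k → Letter k → Row k → Row k
replaceFirst old new row =
  let (before , rest) = break (_≟ₗ old) row in before ++ new ∷ drop 1 rest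

cancel : ∀ {k} → Fin k → Row k → Filling k → Filling k
cancel i row rows =
  let (left , rest) = break (_≟ₗ unbarred i) (replaceFirst (barred i) (unbarred i) row)
  in slide left (drop 1 rest) rows

-- `insertAt r a rows` inserts a into the first of `rows`, which is row r of the
-- whole tableau.
insertAt : ∀ {k} → ℕ → Letter k → Filling k → Filling k
insertAt r a []           = [ [ a ] ]
insertAt r a (row ∷ rows) with cancels? r a row
... | yes (i , _) = cancel i row rows
... | no  _       with bump a row
...   | row′ , nothing = row′ ∷ rows
...   | row′ , just b  = row′ ∷ insertAt (suc r) b rows

infixl 5 _⟵_

_⟵_ : ∀ {k} → Filling k → Letter k → Filling k
T ⟵ x = insertAt 0 x T

------------------------------------------------------------------------
-- Arrays

infix 4 _≼_

_≼_ : ∀ {k} → Fin k × Letter k → Fin k × Letter k → Set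
(u , v) ≼ (u′ , v′) = u Fin.≤ u′ × (u ≡ u′ → v ≤ₗ v′)

record TwoLineArray (k : ℕ) : Set where
  field
    columns : List (Fin k × Letter k)
    sorted  : Linked _≼_ columns

Arrays : ℕ → Setoid 0ℓ 0ℓ
Arrays k = On.setoid (setoid (List (Fin k × Letter k))) TwoLineArray.columns

------------------------------------------------------------------------
-- Multiset-valued tableaux

-- M r c i is the multiplicity of the number i at the box in row r and column c.
MultisetTableau : Set
MultisetTableau = (r c i : ℕ) → ℕ

infix 4 _≋_

_≋_ : MultisetTableau → MultisetTableau → Set
M ≋ N = ∀ r c i → M r c i ≡ N r c i

∅ₘ : MultisetTableau
∅ₘ _ _ _ = 0

-- Put one more u at each box lying in exactly one of μ and ν.
record-change : ℕ → (μ ν : Shape) → MultisetTableau → MultisetTableau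
record-change u μ ν M r c i =
  if (u ≡ᵇ i) ∧ ((c <ᵇ rowLength μ r) xor (c <ᵇ rowLength ν r))
  then suc (M r c i)
  else M r c i

------------------------------------------------------------------------
-- Semistandard oscillating tableaux

-- `step {i} S μ′ ν …` appends to S, ending with the shape μ, the deletion of
-- boxes from μ to μ′ and the addition of boxes from μ′ to ν. The first step
-- starts from the empty partition, so that its deletion is necessarily trivial.
data SSOT : (k : ℕ) → Shape → Set where
  start : SSOT 0 []
  step  : ∀ {i μ} → SSOT i μ →
          (μ′ : Shape) → IsPartition μ′ → HorizontalStrip μ μ′ →
          (ν  : Shape) → IsPartition ν  → HorizontalStrip ν μ′ →
          SSOT (suc i) ν

-- The underlying sequence of shapes, latest first.
sequence : ∀ {k μ} → SSOT k μ → List Shape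
sequence start                 = []
sequence (step S μ′ _ _ ν _ _) = ν ∷ μ′ ∷ sequence S

-- A box that is both deleted and added in step i receives i twice. The sequence
-- can be read off from the tableau: a box of μ is in μ′ iff i does not occur there.
encode : ∀ {k μ} → SSOT k μ → MultisetTableau
encode start                          = ∅ₘ
encode (step {i} {μ} S μ′ _ _ ν _ _) =
  record-change i μ′ ν (record-change i μ μ′ (encode S))

------------------------------------------------------------------------
-- The correspondence

insertAll : ∀ {k} → Filling k → MultisetTableau → List (Fin k × Letter k) →
            Filling k × MultisetTableau
insertAll P Q []            = P , Q
insertAll P Q ((u , v) ∷ w) =
  insertAll (P ⟵ v) (record-change (toℕ u) (shapeOf P) (shapeOf (P ⟵ v)) Q) w

P-C : ∀ {k} → TwoLineArray k → Filling k
P-C w = proj₁ (insertAll [] ∅ₘ (TwoLineArray.columns w))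

Q-C : ∀ {k} → TwoLineArray k → MultisetTableau
Q-C w = proj₂ (insertAll [] ∅ₘ (TwoLineArray.columns w))

record TableauPair (k : ℕ) : Set where
  field
    shape     : Shape
    partition : IsPartition shape
    rows≤k    : length shape ≤ k
    king      : KingTableau k shape
    ssot      : SSOT k shape

  filling : Filling k
  filling = KingTableau.filling king

TableauPairs : ℕ → Setoid 0ℓ 0ℓ
TableauPairs k = On.setoid (setoid (Shape × Filling k × List Shape))
  λ p → let open TableauPair p in shape , filling , sequence ssot

{-# OPTIONS --safe #-}
module Submission where

-- Encode a King tableau by its pattern: P m r is the number of letters of rank
-- less than m in row r. Compare the patterns of T and T ⟵ x level by level: at
-- each level they differ by at most one box, added to or deleted from one row,
-- and the difference at level 1 + m is obtained from the one at level m by a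
-- local rule in which Schensted bumping, cancellation and jeu de taquin are the
-- cases. These rules can be run backwards, which makes (T , x) ↦ (T ⟵ x , shape
-- of T) a bijection. They also preserve a total order on the possible
-- differences, in which those of two successive insertions compare like the
-- inserted letters at level 0, and like the moves
--   delete from row 0 < delete from row 1 < ⋯ < add to row 1 < add to row 0
-- at the last level. Hence weakly increasing letters are exactly those that
-- first delete a horizontal strip and then add one, in this order.

open import Data.Bool.Base as Bool using (Bool; true; false; _∧_; _∨_; _xor_; if_then_else_)
open import Data.Bool.Properties using (T-∧; T-∨)
open import Data.Empty using (⊥; ⊥-elim)
open import Data.Fin.Base as Fin using (Fin; toℕ)
import Data.Fin.Properties as Fin
open import Data.List.Base as List using (List; []; _∷_; _++_; [_]; map; length; take; drop; lookup; replicate)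
open import Data.List.Properties using (∷-injective; ++-assoc; ++-identityʳ; length-++; take++drop≡id)
open import Data.List.Membership.Propositional using (_∈_)
open import Data.List.Relation.Binary.Pointwise.Base using ([]; _∷_)
open import Data.List.Relation.Unary.All as All using (All; []; _∷_)
import Data.List.Relation.Unary.All.Properties as All
open import Data.List.Relation.Unary.AllPairs as AllPairs using (AllPairs; []; _∷_)
import Data.List.Relation.Unary.AllPairs.Properties as AllPairs
open import Data.List.Relation.Unary.Any using (here; there)
open import Data.List.Relation.Unary.Linked as Linked using (Linked; []; [-]; _∷_)
open import Data.List.Relation.Unary.Linked.Properties using (Linked⇒AllPairs; AllPairs⇒Linked)
open import Data.Maybe.Base using (Maybe; just; nothing)
open import Data.Nat.Base
open import Data.Nat.Properties
open import Data.Nat.Solver using (module +-*-Solver)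
open import Data.Product.Base using (Σ-syntax; ∃-syntax; _×_; _,_; proj₁; proj₂)
open import Data.Sum.Base using (_⊎_; inj₁; inj₂)
open import Data.Unit.Base using (tt)
open import Data.Vec.Base as Vec using (Vec; []; _∷_)
open import Function.Bundles using (Bijection; Equivalence)
open import Relation.Binary.PropositionalEquality hiding ([_])
open import Relation.Nullary.Decidable.Core using (Dec; yes; no; _×-dec_; _→-dec_; recompute)
open import Relation.Nullary.Negation.Core using (¬_; contradiction)
open import Defs

-- A cancellation in row `r` amounts to losing one barred letter, of rank `1 + 2 * r`, since the
-- inserted unbarred letter makes up for the one that is emptied. Level `1 + 2 * r` therefore shows
-- no difference although the letter has arrived; the state `pend r` remembers it. The obstacle to
-- reversal is that a hole which does not fall into row `r` on reaching level `2 + 2 * r` may stem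
-- from a cancellation there or may already have been in row `r` one level below. The new pattern
-- `Q` tells these apart. Row `r` is empty at level `2 * r`, so an older hole has just fallen from
-- row `r - 1`, and `Q (2 * r) (r - 1) ≤ Q (1 + 2 * r) r`. Before a cancellation row `r - 1` has
-- gained a box at level `2 * r`, and this inequality fails; for `r = 0` only a cancellation is
-- possible. The last level `2 * k` is even, so nothing is pending there and the state is a genuine
-- move. A prescribed move can thus be run backwards without knowing the inserted letter, which is
-- read off at level 0.

-- Linear inequalities over the natural numbers

module LinearArithmetic where

  infixr 8 _⊛_
  infixl 7 _⊕_
  infix  6 _≦_ _≐_
  infix  3 _⊢_

  data Expr (n : ℕ) : Set where
    var : Fin n → Expr n
    con : ℕ → Expr n
    _⊕_ : Expr n → Expr n → Expr n
    _⊛_ : ℕ → Expr n → Expr n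

  data Constraint (n : ℕ) : Set where
    _≦_ _≐_ : Expr n → Expr n → Constraint n
    absurd  : Constraint n

  data Sequent (n : ℕ) : Set where
    _⊢_ : List (Constraint n) → Constraint n → Sequent n

  ⟦_⟧ : ∀ {n} → Expr n → Vec ℕ n → ℕ
  ⟦ var i ⟧ ρ = Vec.lookup ρ i
  ⟦ con c ⟧ ρ = c
  ⟦ e ⊕ f ⟧ ρ = ⟦ e ⟧ ρ + ⟦ f ⟧ ρ
  ⟦ c ⊛ e ⟧ ρ = c * ⟦ e ⟧ ρ

  Holds : ∀ {n} → Constraint n → Vec ℕ n → Set
  Holds (e ≦ f) ρ = ⟦ e ⟧ ρ ≤ ⟦ f ⟧ ρ
  Holds (e ≐ f) ρ = ⟦ e ⟧ ρ ≡ ⟦ f ⟧ ρ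
  Holds absurd  ρ = ⊥

  Entails : ∀ {n} → List (Constraint n) → Constraint n → Vec ℕ n → Set
  Entails []       g ρ = Holds g ρ
  Entails (h ∷ hs) g ρ = Holds h ρ → Entails hs g ρ

  -- c , (a₁ ∷ a₂ ∷ ⋯) stands for c + a₁ x₁ + a₂ x₂ + ⋯ , and a pair of linear
  -- forms for the inequality between them.
  Linear : ℕ → Set
  Linear n = ℕ × Vec ℕ n

  value : ∀ {n} → Linear n → Vec ℕ n → ℕ
  value (c , [])     []      = c
  value (c , a ∷ as) (x ∷ ρ) = a * x + value (c , as) ρ

  Inequality : ℕ → Set
  Inequality n = Linear n × Linear n

  True : ∀ {n} → Vec ℕ n → Inequality n → Set
  True ρ (l , r) = value l ρ ≤ value r ρ

  infixl 6 _⊞_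
  infixr 7 _⊡_

  _⊞_ : ∀ {n} → Linear n → Linear n → Linear n
  (c , as) ⊞ (d , bs) = c + d , Vec.zipWith _+_ as bs

  _⊡_ : ∀ {n} → ℕ → Linear n → Linear n
  k ⊡ (c , as) = k * c , Vec.map (k *_) as

  constant : ∀ {n} → ℕ → Linear n
  constant c = c , Vec.replicate _ 0

  variable′ : ∀ {n} → Fin n → Linear n
  variable′ i = 0 , Vec.tabulate (λ j → indicator i j)
    where
    indicator : ∀ {n} → Fin n → Fin n → ℕ
    indicator Fin.zero    Fin.zero    = 1
    indicator Fin.zero    (Fin.suc j) = 0
    indicator (Fin.suc i) Fin.zero    = 0
    indicator (Fin.suc i) (Fin.suc j) = indicator i j

  linear : ∀ {n} → Expr n → Linear n
  linear (var i) = variable′ i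
  linear (con c) = constant c
  linear (e ⊕ f) = linear e ⊞ linear f
  linear (k ⊛ e) = k ⊡ linear e

  value-⊞ : ∀ {n} (l m : Linear n) ρ → value (l ⊞ m) ρ ≡ value l ρ + value m ρ
  value-⊞ (c , [])     (d , [])     []      = refl
  value-⊞ (c , a ∷ as) (d , b ∷ bs) (x ∷ ρ) rewrite value-⊞ (c , as) (d , bs) ρ =
    solve 5 (λ a b x u v → (a :+ b) :* x :+ (u :+ v) := a :* x :+ u :+ (b :* x :+ v)) refl a b x _ _
    where open +-*-Solver

  value-⊡ : ∀ {n} k (l : Linear n) ρ → value (k ⊡ l) ρ ≡ k * value l ρ
  value-⊡ k (c , [])     []      = refl
  value-⊡ k (c , a ∷ as) (x ∷ ρ) rewrite value-⊡ k (c , as) ρ =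
    solve 4 (λ k a x u → k :* a :* x :+ k :* u := k :* (a :* x :+ u)) refl k a x _
    where open +-*-Solver

  value-constant : ∀ {n} c (ρ : Vec ℕ n) → value (constant c) ρ ≡ c
  value-constant c []      = refl
  value-constant c (x ∷ ρ) = value-constant c ρ

  value-variable : ∀ {n} i (ρ : Vec ℕ n) → value (variable′ i) ρ ≡ Vec.lookup ρ i
  value-variable Fin.zero (x ∷ ρ) = trans (cong₂ _+_ (*-identityˡ x) (value-0 ρ)) (+-identityʳ x)
    where
    value-0 : ∀ {n} (ρ : Vec ℕ n) → value (0 , Vec.tabulate (λ j → 0)) ρ ≡ 0
    value-0 []      = refl
    value-0 (x ∷ ρ) = value-0 ρ
  value-variable (Fin.suc i) (x ∷ ρ) = value-variable i ρ

  value-linear : ∀ {n} (e : Expr n) ρ → value (linear e) ρ ≡ ⟦ e ⟧ ρ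
  value-linear (var i) ρ = value-variable i ρ
  value-linear (con c) ρ = value-constant c ρ
  value-linear (e ⊕ f) ρ =
    trans (value-⊞ (linear e) (linear f) ρ) (cong₂ _+_ (value-linear e ρ) (value-linear f ρ))
  value-linear (k ⊛ e) ρ = trans (value-⊡ k (linear e) ρ) (cong (k *_) (value-linear e ρ))

  -- An inequality in x ∷ ρ, as an upper bound a x + l ≤ r, a lower bound
  -- l ≤ a x + r, or an inequality in ρ only.
  data Bound (n : ℕ) : Set where
    upper lower : ℕ → Inequality n → Bound n
    free        : Inequality n → Bound n

  IsBound : ∀ {n} → ℕ → Vec ℕ n → Bound n → Set
  IsBound x ρ (upper a (l , r)) = a * x + value l ρ ≤ value r ρ
  IsBound x ρ (lower a (l , r)) = value l ρ ≤ a * x + value r ρ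
  IsBound x ρ (free i)          = True ρ i

  bound : ∀ {n} → Inequality (suc n) → Bound n
  bound ((c , a ∷ as) , (d , b ∷ bs)) with compare a b
  ... | less    _ k = lower (suc k) ((c , as) , (d , bs))
  ... | equal   _   = free ((c , as) , (d , bs))
  ... | greater _ k = upper (suc k) ((c , as) , (d , bs))

  bound-sound : ∀ {n} x (ρ : Vec ℕ n) i → True (x ∷ ρ) i → IsBound x ρ (bound i)
  bound-sound x ρ ((c , a ∷ as) , (d , b ∷ bs)) h with compare a b
  ... | less    _ k = +-cancelˡ-≤ (a * x) _ _ (≤-trans h (≤-reflexive
          (solve 4 (λ a k x u → (con 1 :+ (a :+ k)) :* x :+ u := a :* x :+ ((con 1 :+ k) :* x :+ u)) refl a k x _)))
    where open +-*-Solver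
  ... | equal   _   = +-cancelˡ-≤ (a * x) _ _ h
  ... | greater _ k = +-cancelˡ-≤ (b * x) _ _ (≤-trans (≤-reflexive
          (solve 4 (λ b k x u → b :* x :+ ((con 1 :+ k) :* x :+ u) := (con 1 :+ (b :+ k)) :* x :+ u) refl b k x _)) h)
    where open +-*-Solver

  resolve : ∀ {n} → Bound n → Bound n → List (Inequality n)
  resolve (upper a (l , r)) (lower b (l′ , r′)) = (b ⊡ l ⊞ a ⊡ l′ , b ⊡ r ⊞ a ⊡ r′) ∷ []
  resolve _                 _                   = []

  -- An upper bound is resolved with the implicit lower bound `0 ≤ x`, valid because the variables
  -- range over ℕ. A lower bound has no such partner and is dropped.
  project : ∀ {n} → Bound n → List (Inequality n)
  project (upper a i) = i ∷ []
  project (lower a i) = []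
  project (free i)    = i ∷ []

  eliminate : ∀ {n} → List (Inequality (suc n)) → List (Inequality n)
  eliminate is = List.concatMap project bs ++ List.concatMap (λ b → List.concatMap (resolve b) bs) bs
    where bs = List.map bound is

  resolve-sound : ∀ {n} x (ρ : Vec ℕ n) b b′ → IsBound x ρ b → IsBound x ρ b′ → All (True ρ) (resolve b b′)
  resolve-sound x ρ (upper a (l , r)) (lower b (l′ , r′)) h h′ = goal ∷ []
    where
    open +-*-Solver
    goal : value (b ⊡ l ⊞ a ⊡ l′) ρ ≤ value (b ⊡ r ⊞ a ⊡ r′) ρ
    goal rewrite value-⊞ (b ⊡ l) (a ⊡ l′) ρ | value-⊞ (b ⊡ r) (a ⊡ r′) ρ
               | value-⊡ b l ρ | value-⊡ a l′ ρ | value-⊡ b r ρ | value-⊡ a r′ ρ =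
      +-cancelˡ-≤ (b * (a * x)) _ _ (≤-trans (≤-reflexive
        (solve 5 (λ a b x u v → b :* (a :* x) :+ (b :* u :+ a :* v) := b :* (a :* x :+ u) :+ a :* v) refl a b x _ _))
        (≤-trans (+-mono-≤ (*-monoʳ-≤ b h) (*-monoʳ-≤ a h′)) (≤-reflexive
        (solve 5 (λ a b x u v → b :* u :+ a :* (b :* x :+ v) := b :* (a :* x) :+ (b :* u :+ a :* v)) refl a b x _ _))))
  resolve-sound x ρ (upper _ _) (upper _ _) _ _ = []
  resolve-sound x ρ (upper _ _) (free _)    _ _ = []
  resolve-sound x ρ (lower _ _) _           _ _ = []
  resolve-sound x ρ (free _)    _           _ _ = []

  project-sound : ∀ {n} x (ρ : Vec ℕ n) b → IsBound x ρ b → All (True ρ) (project b)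
  project-sound x ρ (upper a i) h = ≤-trans (m≤n+m _ _) h ∷ []
  project-sound x ρ (lower a i) h = []
  project-sound x ρ (free i)    h = h ∷ []

  All-concatMap : ∀ {A B : Set} {P : A → Set} {Q : B → Set} {f : A → List B} →
    (∀ a → P a → All Q (f a)) → ∀ {as} → All P as → All Q (List.concatMap f as)
  All-concatMap f []                  = []
  All-concatMap f (_∷_ {x = a} p ps) = All.++⁺ (f a p) (All-concatMap f ps)

  eliminate-sound : ∀ {n} x (ρ : Vec ℕ n) is → All (True (x ∷ ρ)) is → All (True ρ) (eliminate is)
  eliminate-sound x ρ is h =
    All.++⁺ (All-concatMap (project-sound x ρ) bs)
            (All-concatMap (λ b p → All-concatMap (λ b′ → resolve-sound x ρ b b′ p) bs) bs)
    where bs = All.map⁺ (All.map (λ {i} → bound-sound x ρ i) h)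

  violated : List (Inequality 0) → Bool
  violated []                           = false
  violated (((c , []) , (d , [])) ∷ is) = (d <ᵇ c) ∨ violated is

  violated-sound : ∀ is → All (True []) is → ¬ Bool.T (violated is)
  violated-sound (((c , []) , (d , [])) ∷ is) (h ∷ hs) t with Equivalence.to (T-∨ {d <ᵇ c}) t
  ... | inj₁ p = <⇒≱ (<ᵇ⇒< d c p) h
  ... | inj₂ p = violated-sound is hs p

  refutable : ∀ n → List (Inequality n) → Bool
  refutable zero    is = violated is
  refutable (suc n) is = refutable n (eliminate is)

  refutable-sound : ∀ {n} (ρ : Vec ℕ n) is → All (True ρ) is → ¬ Bool.T (refutable n is)
  refutable-sound []      is h t = violated-sound is h t
  refutable-sound (x ∷ ρ) is h t = refutable-sound ρ _ (eliminate-sound x ρ is h) t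

  inequalities : ∀ {n} → List (Constraint n) → List (Inequality n)
  inequalities []             = []
  inequalities (e ≦ f ∷ hs)   = (linear e , linear f) ∷ inequalities hs
  inequalities (e ≐ f ∷ hs)   = (linear e , linear f) ∷ (linear f , linear e) ∷ inequalities hs
  inequalities (absurd ∷ hs)  = (constant 1 , constant 0) ∷ inequalities hs

  valid : ∀ {n} → List (Constraint n) → Constraint n → Bool
  -- Over ℕ the negation of `e ≤ f` is `1 + f ≤ e`, which keeps all inequalities non-strict.
  valid {n} hs (e ≦ f) = refutable n ((constant 1 ⊞ linear f , linear e) ∷ inequalities hs)
  valid     hs (e ≐ f) = valid hs (e ≦ f) ∧ valid hs (f ≦ e)
  valid {n} hs absurd  = refutable n (inequalities hs)

  ≦-sound : ∀ {n} (e f : Expr n) ρ → ⟦ e ⟧ ρ ≤ ⟦ f ⟧ ρ → True ρ (linear e , linear f)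
  ≦-sound e f ρ = subst₂ _≤_ (sym (value-linear e ρ)) (sym (value-linear f ρ))

  data AllHold {n : ℕ} (ρ : Vec ℕ n) : List (Constraint n) → Set where
    []  : AllHold ρ []
    _∷_ : ∀ {h hs} → Holds h ρ → AllHold ρ hs → AllHold ρ (h ∷ hs)

  inequalities-sound : ∀ {n} (ρ : Vec ℕ n) {hs} → AllHold ρ hs → All (True ρ) (inequalities hs)
  inequalities-sound ρ []                       = []
  inequalities-sound ρ (_∷_ {h = e ≦ f} h hs)   = ≦-sound e f ρ h ∷ inequalities-sound ρ hs
  inequalities-sound ρ (_∷_ {h = e ≐ f} h hs)   =
    ≦-sound e f ρ (≤-reflexive h) ∷ ≦-sound f e ρ (≤-reflexive (sym h)) ∷ inequalities-sound ρ hs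
  inequalities-sound ρ (_∷_ {h = absurd} () hs)

  valid-sound : ∀ {n} (ρ : Vec ℕ n) hs g → Bool.T (valid hs g) → AllHold ρ hs → Holds g ρ
  valid-sound ρ hs (e ≦ f) t as with ⟦ e ⟧ ρ ≤? ⟦ f ⟧ ρ
  ... | yes p = p
  ... | no ¬p = ⊥-elim (refutable-sound ρ _ (negated ∷ inequalities-sound ρ as) t)
    where
    negated : value (constant 1 ⊞ linear f) ρ ≤ value (linear e) ρ
    negated rewrite value-⊞ (constant 1) (linear f) ρ | value-constant 1 ρ
                  | value-linear e ρ | value-linear f ρ = ≰⇒> ¬p
  valid-sound ρ hs (e ≐ f) t as =
    let (t₁ , t₂) = Equivalence.to (T-∧ {valid hs (e ≦ f)}) t in
    ≤-antisym (valid-sound ρ hs (e ≦ f) t₁ as) (valid-sound ρ hs (f ≦ e) t₂ as)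
  valid-sound ρ hs absurd t as = refutable-sound ρ _ (inequalities-sound ρ as) t

  curryHypotheses : ∀ {n} (ρ : Vec ℕ n) hs g → (AllHold ρ hs → Holds g ρ) → Entails hs g ρ
  curryHypotheses ρ []       g f = f []
  curryHypotheses ρ (h ∷ hs) g f p = curryHypotheses ρ hs g (λ as → f (p ∷ as))

  Curried : (A B : Set) → ℕ → Set
  Curried A B zero    = B
  Curried A B (suc n) = A → Curried A B n

  uncurried : ∀ {A B n} → Curried A B n → Vec A n → B
  uncurried b []       = b
  uncurried f (a ∷ as) = uncurried (f a) as

  ForAll : ∀ n → (Vec ℕ n → Set) → Set
  ForAll zero    P = P []
  ForAll (suc n) P = ∀ x → ForAll n (λ ρ → P (x ∷ ρ))

  forAll : ∀ n {P : Vec ℕ n → Set} → (∀ ρ → P ρ) → ForAll n P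
  forAll zero    p = p []
  forAll (suc n) p = λ x → forAll n (λ ρ → p (x ∷ ρ))

  IsValid : ∀ {n} → Sequent n → Set
  IsValid (hs ⊢ g) = Bool.T (valid hs g)

  Statement : ∀ {n} → Sequent n → Vec ℕ n → Set
  Statement (hs ⊢ g) = Entails hs g

  -- Fourier–Motzkin refutation of the hypotheses and the negated conclusion; it may
  -- fail for sequents that hold over ℕ but not over the nonnegative rationals.
  lia : ∀ n (s : Curried (Expr n) (Sequent n) n) → let s′ = uncurried s (Vec.map var (Vec.allFin n)) in
        {_ : IsValid s′} → ForAll n (Statement s′)
  lia n s {t} with uncurried s (Vec.map var (Vec.allFin n))
  ... | hs ⊢ g = forAll n (λ ρ → curryHypotheses ρ hs g (valid-sound ρ hs g t))

open LinearArithmetic using (con; _⊕_; _⊛_; _≦_; _≐_; absurd; _⊢_; lia)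

δ : ℕ → ℕ → ℕ
δ zero    zero    = 1
δ zero    (suc j) = 0
δ (suc i) zero    = 0
δ (suc i) (suc j) = δ i j

δ-refl : ∀ i → δ i i ≡ 1
δ-refl zero    = refl
δ-refl (suc i) = δ-refl i

δ-≢ : ∀ {i j} → i ≢ j → δ i j ≡ 0
δ-≢ {zero}  {zero}  i≢j = contradiction refl i≢j
δ-≢ {zero}  {suc j} i≢j = refl
δ-≢ {suc i} {zero}  i≢j = refl
δ-≢ {suc i} {suc j} i≢j = δ-≢ (λ i≡j → i≢j (cong suc i≡j))

-- Strictness in the one row that a change touches leaves room for its `δ`, so that the inequalities
-- of a changed pattern can be proved for all rows at once.
strict-at : ∀ {f g : ℕ → ℕ} r → (∀ j → f j ≤ g j) → f r < g r → ∀ j → f j + δ r j ≤ g j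
strict-at {f} {g} r f≤g fr<gr j with r ≟ j
... | yes refl = lia 3 (λ a b d → con 1 ⊕ a ≦ b ∷ d ≐ con 1 ∷ [] ⊢ a ⊕ d ≦ b) (f r) (g r) (δ r r) fr<gr (δ-refl r)
... | no r≢j   = lia 3 (λ a b d → a ≦ b ∷ d ≐ con 0 ∷ [] ⊢ a ⊕ d ≦ b) (f j) (g j) (δ r j) (f≤g j) (δ-≢ r≢j)

-- Growth rules

Pattern : Set
Pattern = ℕ → ℕ → ℕ

-- The pattern form of the King conditions for rows numbered from `o`: `inter` is strictness down
-- columns, and `king` keeps letters of rank below `2 * (o + r)` out of row `r`.
record Valid (o : ℕ) (P : Pattern) : Set where
  field
    mono  : ∀ m r → P m r ≤ P (1 + m) r
    inter : ∀ m r → P (1 + m) (1 + r) ≤ P m r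
    king  : ∀ m r → m ≤ 2 * (o + r) → P m r ≡ 0

-- The difference between the patterns of T and T ⟵ a at a level: none before the
-- letter of rank x is inserted; one more letter in row r (plus r); one less
-- (minus r); none, although an i has been inserted into row i = r, because it will
-- cancel an ī at the next level (pend r).
data State : Set where
  none             : (x : ℕ) → State
  plus pend minus : (r : ℕ) → State

inc dec : State → ℕ → ℕ
inc (plus r) j = δ r j
inc _        j = 0
dec (minus r) j = δ r j
dec _         j = 0

-- The letter of rank m enters row r; a cancellation is announced by the next level.
-- The rows of P are those of a tableau from its row o on.
data Enter (o : ℕ) (P : Pattern) (m r : ℕ) : State → Set where
  to-plus : 2 * (o + r) ≤ m → (m ≡ 2 * (o + r) → P (2 + m) r ≤ P (1 + m) r) → Enter o P m r (plus r)
  to-pend : m ≡ 2 * (o + r) → P (1 + m) r < P (2 + m) r → Enter o P m r (pend r)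

-- Level `1 + m` brings in the letters of rank `m`, so `P m r < P (1 + m) r` says that row `r`
-- contains one, and the first of them is bumped. A hole in row `r` sits in column `P m r - 1` with
-- only letters of rank at least `m` to its right. Hence the entry below it moves up, ties included,
-- exactly when its rank is `m`, that is, when `P m r ≤ P (1 + m) (1 + r)`.
data Step (o : ℕ) (P : Pattern) (m : ℕ) : State → State → Set where
  wait   : ∀ {x} → m < x → Step o P m (none x) (none x)
  enter  : ∀ {s} → Enter o P m 0 s → Step o P m (none m) s
  stay⁺  : ∀ {r} → P (1 + m) r ≤ P m r → Step o P m (plus r) (plus r)
  bump⁺   : ∀ {r s} → P m r < P (1 + m) r → Enter o P m (1 + r) s → Step o P m (plus r) s
  cancel⁻ : ∀ {r} → m ≡ 1 + 2 * (o + r) → P m r < P (1 + m) r → Step o P m (pend r) (minus r)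
  stay⁻  : ∀ {r} → P (1 + m) (1 + r) < P m r → Step o P m (minus r) (minus r)
  fall⁻   : ∀ {r} → P m r ≤ P (1 + m) (1 + r) → Step o P m (minus r) (minus (1 + r))

Change : State → (p q : ℕ → ℕ) → Set
Change s p q = ∀ j → q j + dec s j ≡ p j + inc s j

module _ {p q : ℕ → ℕ} where

  at-plus : ∀ {r} → Change (plus r) p q → q r ≡ 1 + p r
  at-plus {r} h = lia 3 (λ p q d → q ⊕ con 0 ≐ p ⊕ d ∷ d ≐ con 1 ∷ [] ⊢ q ≐ con 1 ⊕ p) (p r) (q r) (δ r r) (h r) (δ-refl r)

  at-minus : ∀ {r} → Change (minus r) p q → p r ≡ 1 + q r
  at-minus {r} h = lia 3 (λ p q d → q ⊕ d ≐ p ⊕ con 0 ∷ d ≐ con 1 ∷ [] ⊢ p ≐ con 1 ⊕ q) (p r) (q r) (δ r r) (h r) (δ-refl r)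

  off-plus : ∀ {r j} → Change (plus r) p q → r ≢ j → q j ≡ p j
  off-plus {r} {j} h r≢j = lia 3 (λ p q d → q ⊕ con 0 ≐ p ⊕ d ∷ d ≐ con 0 ∷ [] ⊢ q ≐ p) (p j) (q j) (δ r j) (h j) (δ-≢ r≢j)

  off-minus : ∀ {r j} → Change (minus r) p q → r ≢ j → q j ≡ p j
  off-minus {r} {j} h r≢j = lia 3 (λ p q d → q ⊕ d ≐ p ⊕ con 0 ∷ d ≐ con 0 ∷ [] ⊢ q ≐ p) (p j) (q j) (δ r j) (h j) (δ-≢ r≢j)

  at-none : ∀ {x} → Change (none x) p q → ∀ j → q j ≡ p j
  at-none h j = trans (sym (+-identityʳ _)) (trans (h j) (+-identityʳ _))

  at-pend : ∀ {x} → Change (pend x) p q → ∀ j → q j ≡ p j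
  at-pend h j = trans (sym (+-identityʳ _)) (trans (h j) (+-identityʳ _))

-- Reduces an inequality of the new pattern to one of the old pattern, with the gains and losses
-- moved across so that no subtraction occurs.
transfer : ∀ s t (p₀ q₀ p₁ q₁ : ℕ → ℕ) i j → Change s p₀ q₀ → Change t p₁ q₁ →
  p₀ i + inc s i + dec t j ≤ p₁ j + inc t j + dec s i → q₀ i ≤ q₁ j
transfer s t p₀ q₀ p₁ q₁ i j c d = lia 8
  (λ p₀ i₀ d₀ q₀ p₁ i₁ d₁ q₁ → q₀ ⊕ d₀ ≐ p₀ ⊕ i₀ ∷ q₁ ⊕ d₁ ≐ p₁ ⊕ i₁ ∷
     p₀ ⊕ i₀ ⊕ d₁ ≦ p₁ ⊕ i₁ ⊕ d₀ ∷ [] ⊢ q₀ ≦ q₁)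
  (p₀ i) (inc s i) (dec s i) (q₀ i) (p₁ j) (inc t j) (dec t j) (q₁ j) (c i) (d j)

record Run (o : ℕ) (P Q : Pattern) (σ : ℕ → State) : Set where
  field
    steps  : ∀ m → Step o P m (σ m) (σ (1 + m))
    change : ∀ m → Change (σ m) (P m) (Q m)

-- The state at level m, in terms of the state at level 1 + m and the new pattern.
data Back (Q : Pattern) (m : ℕ) : State → State → Set where
  none   : ∀ {x} → Back Q m (none x) (none x)
  stay⁺  : ∀ {r} → Q (1 + m) r ≤ Q m r → Back Q m (plus r) (plus r)
  bump⁺   : ∀ {r} → Q m (1 + r) < Q (1 + m) (1 + r) → Back Q m (plus (1 + r)) (plus r)
  enter  : Q m 0 < Q (1 + m) 0 → Back Q m (plus 0) (none m)
  bumpᵖ  : ∀ {r} → Back Q m (pend (1 + r)) (plus r)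
  enterᵖ : Back Q m (pend 0) (none m)
  fall⁻   : ∀ {r} → Q m r ≤ Q (1 + m) (1 + r) → Back Q m (minus (1 + r)) (minus r)
  stay⁻  : ∀ {r} → (∀ r′ → r ≡ suc r′ → Q (1 + m) r < Q m r′) →
           (m ≡ 1 + 2 * r → ∃[ r′ ] r ≡ suc r′ × Q (2 * r) r′ ≤ Q m r) →
           Back Q m (minus r) (minus r)
  cancel⁻ : ∀ {r} → (∀ r′ → r ≡ suc r′ → Q (1 + m) r < Q m r′) → m ≡ 1 + 2 * r →
           (∀ r′ → r ≡ suc r′ → Q m r < Q (2 * r) r′) →
           Back Q m (minus r) (pend r)

-- Determinism of the rules and invariants of a forward run

Back-functional : ∀ {Q m s s₁ s₂} → Back Q m s s₁ → Back Q m s s₂ → s₁ ≡ s₂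
Back-functional none none = refl
Back-functional (stay⁺ p) (stay⁺ q) = refl
Back-functional (stay⁺ p) (bump⁺ q) = contradiction q (≤⇒≯ p)
Back-functional (stay⁺ p) (enter q) = contradiction q (≤⇒≯ p)
Back-functional (bump⁺ p) (stay⁺ q) = contradiction p (≤⇒≯ q)
Back-functional (bump⁺ p) (bump⁺ q) = refl
Back-functional (enter p) (stay⁺ q) = contradiction p (≤⇒≯ q)
Back-functional (enter p) (enter q) = refl
Back-functional bumpᵖ bumpᵖ = refl
Back-functional enterᵖ enterᵖ = refl
Back-functional (fall⁻ p) (fall⁻ q) = refl
Back-functional (fall⁻ p) (stay⁻ q _) = contradiction p (<⇒≱ (q _ refl))
Back-functional (fall⁻ p) (cancel⁻ q _ _) = contradiction p (<⇒≱ (q _ refl))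
Back-functional (stay⁻ q _) (fall⁻ p) = contradiction p (<⇒≱ (q _ refl))
Back-functional (stay⁻ _ _) (stay⁻ _ _) = refl
-- An older hole in row `r` and a cancellation in row `r` are told apart by comparing row `r` with
-- the row above it one level further down.
Back-functional (stay⁻ _ p) (cancel⁻ _ e q) with p e
... | r′ , e′ , h = contradiction h (<⇒≱ (q r′ e′))
Back-functional (cancel⁻ q _ _) (fall⁻ p) = contradiction p (<⇒≱ (q _ refl))
Back-functional (cancel⁻ _ e q) (stay⁻ _ p) with p e
... | r′ , e′ , h = contradiction h (<⇒≱ (q r′ e′))
Back-functional (cancel⁻ _ _ _) (cancel⁻ _ _ _) = refl

Enter-functional : ∀ {P m r s₁ s₂} → Enter 0 P m r s₁ → Enter 0 P m r s₂ → s₁ ≡ s₂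
Enter-functional (to-plus _ _) (to-plus _ _) = refl
Enter-functional (to-plus _ p) (to-pend e q) = contradiction q (≤⇒≯ (p e))
Enter-functional (to-pend e q) (to-plus _ p) = contradiction q (≤⇒≯ (p e))
Enter-functional (to-pend _ _) (to-pend _ _) = refl

Step-functional : ∀ {P m s s₁ s₂} → Step 0 P m s s₁ → Step 0 P m s s₂ → s₁ ≡ s₂
Step-functional (wait _) (wait _) = refl
Step-functional (wait p) (enter _) = contradiction refl (<⇒≢ p)
Step-functional (enter _) (wait p) = contradiction refl (<⇒≢ p)
Step-functional (enter p) (enter q) = Enter-functional p q
Step-functional (stay⁺ _) (stay⁺ _) = refl
Step-functional (stay⁺ p) (bump⁺ q _) = contradiction q (≤⇒≯ p)
Step-functional (bump⁺ q _) (stay⁺ p) = contradiction q (≤⇒≯ p)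
Step-functional (bump⁺ _ p) (bump⁺ _ q) = Enter-functional p q
Step-functional (cancel⁻ _ _) (cancel⁻ _ _) = refl
Step-functional (stay⁻ _) (stay⁻ _) = refl
Step-functional (stay⁻ p) (fall⁻ q) = contradiction p (≤⇒≯ q)
Step-functional (fall⁻ q) (stay⁻ p) = contradiction p (≤⇒≯ q)
Step-functional (fall⁻ _) (fall⁻ _) = refl

-- The inequality for `plus` says that the added box fits under the row above. At level `1 + 2 * r`
-- a hole in row `r` can only have fallen from the row above, which the last field of `minus`
-- records in both patterns: the inequality for `Q` selects the rule in `Back`, the one for `P`
-- enters the comparison of two successive insertions.
data Inv (P Q : Pattern) (m : ℕ) : State → Set where
  none  : ∀ {x} → m ≤ x → Inv P Q m (none x)
  plus  : ∀ {r} → 2 * r < m → (∀ r′ → r ≡ suc r′ → P m r < P m r′) → Inv P Q m (plus r)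
  pend  : ∀ {r} → m ≡ 1 + 2 * r → (∀ r′ → r ≡ suc r′ → Q m r < Q (2 * r) r′) → Inv P Q m (pend r)
  minus : ∀ {r} → 2 * r < m → P m (1 + r) < P m r →
          (m ≡ 1 + 2 * r → ∃[ r′ ] r ≡ suc r′ × Q (2 * r) r′ ≤ Q m r × P (2 * r) r′ ≤ P m r) →
          Inv P Q m (minus r)

king-< : ∀ {P m r n} → Valid 0 P → n < P m r → 2 * r < m
king-< {P} {m} {r} v p with 2 * r <? m
... | yes q = q
... | no ¬q = contradiction (subst (_ <_) (Valid.king v m r (≮⇒≥ ¬q)) p) n≮0

module Forward {P Q : Pattern} (v : Valid 0 P) {m : ℕ} where
  open Valid v

  -- The last two components are the hypotheses of `transfer` that yield `mono` and `inter` for the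
  -- new pattern.
  Result : State → State → Set
  Result s t = Inv P Q (1 + m) t × Back Q m t s ×
    (∀ j → P m j + inc s j + dec t j ≤ P (1 + m) j + inc t j + dec s j) ×
    (∀ j → P (1 + m) (1 + j) + inc t (1 + j) + dec s j ≤ P m j + inc s j + dec t (1 + j))

  private
    pad : ∀ {a b} c → a ≤ b → a + 0 + 0 ≤ b + c + 0
    pad {a} {b} c = lia 3 (λ a b c → a ≦ b ∷ [] ⊢ a ⊕ con 0 ⊕ con 0 ≦ b ⊕ c ⊕ con 0) a b c

  forward : ∀ {s t} → Change s (P m) (Q m) → Change t (P (1 + m)) (Q (1 + m)) →
         Step 0 P m s t → Inv P Q m s → Result s t
  forward c₀ c₁ (wait m<x) _ = none m<x , none , (λ j → pad 0 (mono m j)) , (λ j → pad 0 (inter m j))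
  forward c₀ c₁ (enter (to-plus h _)) _ =
    plus (s≤s h) (λ _ ()) ,
    enter (≤-trans (s≤s (≤-trans (≤-reflexive (at-none {x = m} c₀ 0)) (mono m 0))) (≤-reflexive (sym (at-plus c₁)))) ,
    (λ j → pad (δ 0 j) (mono m j)) , (λ j → pad 0 (inter m j))
  forward c₀ c₁ (enter (to-pend h _)) _ =
    pend (cong suc h) (λ _ ()) , enterᵖ , (λ j → pad 0 (mono m j)) , (λ j → pad 0 (inter m j))
  forward c₀ c₁ (stay⁺ {r} h) (plus 2r<m p) =
    plus (m<n⇒m<1+n 2r<m) (λ { r′ refl → ≤-trans (s≤s h) (≤-trans (p r′ refl) (mono m r′)) }) ,
    stay⁺ (subst₂ _≤_ (sym (at-plus c₁)) (sym (at-plus c₀)) (s≤s h)) ,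
    (λ j → lia 3 (λ a b d → a ≦ b ∷ [] ⊢ (a ⊕ d) ⊕ con 0 ≦ (b ⊕ d) ⊕ con 0) _ _ (δ r j) (mono m j)) ,
    lower r p h
    where
    lower : ∀ r → (∀ r′ → r ≡ suc r′ → P m r < P m r′) → P (1 + m) r ≤ P m r →
            ∀ j → P (1 + m) (1 + j) + δ r (1 + j) + 0 ≤ P m j + δ r j + 0
    lower zero    p h j = lia 3 (λ a b d → a ≦ b ∷ [] ⊢ (a ⊕ con 0) ⊕ con 0 ≦ (b ⊕ d) ⊕ con 0) _ _ (δ 0 j) (inter m j)
    lower (suc r) p h j = lia 4 (λ a b d e → a ⊕ d ≦ b ∷ [] ⊢ (a ⊕ d) ⊕ con 0 ≦ (b ⊕ e) ⊕ con 0) _ _ (δ r j) (δ (suc r) j)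
      (strict-at r (inter m) (≤-trans (s≤s h) (p r refl)) j)
  forward c₀ c₁ (bump⁺ {r} h (to-plus g _)) _ =
    plus (s≤s g) (λ { r′ refl → ≤-trans (s≤s (inter m r)) h }) ,
    bump⁺ (≤-trans (s≤s (≤-trans (≤-reflexive (off-plus c₀ (<⇒≢ (n<1+n r)))) (mono m (1 + r)))) (≤-reflexive (sym (at-plus c₁)))) ,
    (λ j → lia 4 (λ a b d e → a ⊕ d ≦ b ∷ [] ⊢ (a ⊕ d) ⊕ con 0 ≦ (b ⊕ e) ⊕ con 0) _ _ (δ r j) (δ (suc r) j)
      (strict-at r (mono m) h j)) ,
    (λ j → lia 3 (λ a b d → a ≦ b ∷ [] ⊢ (a ⊕ d) ⊕ con 0 ≦ (b ⊕ d) ⊕ con 0) _ _ (δ r j) (inter m j))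
  forward c₀ c₁ (bump⁺ {r} h (to-pend g _)) _ =
    -- The row above has gained a box at level `m` while the entered row is unchanged at level
    -- `1 + m`; this strict inequality later identifies the cancellation.
    pend (cong suc g) (λ { r′ refl → subst (λ l → Q (1 + m) (1 + r) < Q l r) g
      (lia 5 (λ q p p′ p″ q″ → q ≐ p ∷ p ≦ p′ ∷ q″ ≐ con 1 ⊕ p′ ∷ [] ⊢ con 1 ⊕ q ≦ q″)
        (Q (1 + m) (1 + r)) (P (1 + m) (1 + r)) (P m r) 0 (Q m r) (at-pend {x = 1 + r} c₁ (1 + r)) (inter m r) (at-plus c₀)) }) ,
    bumpᵖ ,
    (λ j → lia 3 (λ a b d → a ⊕ d ≦ b ∷ [] ⊢ (a ⊕ d) ⊕ con 0 ≦ (b ⊕ con 0) ⊕ con 0) _ _ (δ r j)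
      (strict-at r (mono m) h j)) ,
    (λ j → lia 3 (λ a b d → a ≦ b ∷ [] ⊢ (a ⊕ con 0) ⊕ con 0 ≦ (b ⊕ d) ⊕ con 0) _ _ (δ r j) (inter m j))
  forward c₀ c₁ (cancel⁻ {r} e h) (pend _ p) =
    minus (subst (λ n → 2 * r < suc n) (sym e) (m<n⇒m<1+n (n<1+n _))) (≤-trans (s≤s (inter m r)) h)
      (λ e′ → contradiction (trans (sym e) (suc-injective e′)) 1+n≢n) ,
    cancel⁻
      (λ { r′ refl → lia 4 (λ q p p′ q′ → p ≐ con 1 ⊕ q ∷ p ≦ p′ ∷ q′ ≐ p′ ∷ [] ⊢ con 1 ⊕ q ≦ q′)
        (Q (1 + m) r) (P (1 + m) r) (P m r′) (Q m r′) (at-minus c₁) (inter m r′) (at-pend {x = r} c₀ r′) })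
      e p ,
    (λ j → lia 3 (λ a b d → a ⊕ d ≦ b ∷ [] ⊢ (a ⊕ con 0) ⊕ d ≦ (b ⊕ con 0) ⊕ con 0) _ _ (δ r j)
      (strict-at r (mono m) h j)) ,
    (λ j → lia 3 (λ a b d → a ≦ b ∷ [] ⊢ (a ⊕ con 0) ⊕ con 0 ≦ (b ⊕ con 0) ⊕ d) _ _ (δ r (1 + j)) (inter m j))
  forward c₀ c₁ (stay⁻ {r} h) (minus 2r<m p q) =
    minus (m<n⇒m<1+n 2r<m) (≤-trans h (mono m r))
      (λ e → contradiction 2r<m (<-irrefl (sym (suc-injective e)))) ,
    stay⁻ (λ { r′ refl → lia 4 (λ q p p′ q′ → p ≐ con 1 ⊕ q ∷ p ≦ p′ ∷ q′ ≐ p′ ∷ [] ⊢ con 1 ⊕ q ≦ q′)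
            (Q (1 + m) r) (P (1 + m) r) (P m r′) (Q m r′) (at-minus c₁) (inter m r′) (off-minus c₀ 1+n≢n) })
          (λ e → let r′ , e′ , a , b = q e in r′ , e′ , a) ,
    (λ j → lia 3 (λ a b d → a ≦ b ∷ [] ⊢ (a ⊕ con 0) ⊕ d ≦ (b ⊕ con 0) ⊕ d) _ _ (δ r j) (mono m j)) ,
    (λ j → lia 4 (λ a b d e → a ⊕ d ≦ b ∷ [] ⊢ (a ⊕ con 0) ⊕ d ≦ (b ⊕ con 0) ⊕ e) _ _ (δ r j) (δ r (1 + j))
      (strict-at r (inter m) h j))
  forward c₀ c₁ (fall⁻ {r} h) (minus 2r<m p q) =
    minus (king-< v below)
      below
      -- Both rows lose one box, so the inequality that makes the hole fall holds in the old and the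
      -- new pattern alike.
      (λ e → r , refl , subst (λ l → Q l r ≤ Q (1 + m) (1 + r)) (suc-injective e) back
                      , subst (λ l → P l r ≤ P (1 + m) (1 + r)) (suc-injective e) h) ,
    fall⁻ back ,
    (λ j → lia 4 (λ a b d e → a ⊕ d ≦ b ∷ [] ⊢ (a ⊕ con 0) ⊕ d ≦ (b ⊕ con 0) ⊕ e) _ _ (δ (1 + r) j) (δ r j)
      (strict-at (1 + r) (mono m) (≤-trans p h) j)) ,
    (λ j → lia 3 (λ a b d → a ≦ b ∷ [] ⊢ (a ⊕ con 0) ⊕ d ≦ (b ⊕ con 0) ⊕ d) _ _ (δ r j) (inter m j))
    where
    back : Q m r ≤ Q (1 + m) (1 + r)
    back = s≤s⁻¹ (subst₂ _≤_ (at-minus c₀) (at-minus c₁) h)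
    below : P (1 + m) (2 + r) < P (1 + m) (1 + r)
    below = ≤-trans (s≤s (inter m (1 + r))) (≤-trans p h)

module _ {P Q : Pattern} {σ : ℕ → State} (v : Valid 0 P) (run : Run 0 P Q σ)
         {x : ℕ} (σ₀ : σ 0 ≡ none x) where
  open Run run

  run-inv : ∀ m → Inv P Q m (σ m)
  private
    result : ∀ m → Forward.Result {P} {Q} v {m} (σ m) (σ (1 + m))
    result m = Forward.forward v (change m) (change (1 + m)) (steps m) (run-inv m)
  run-inv zero    = subst (Inv P Q 0) (sym σ₀) (none z≤n)
  run-inv (suc m) = proj₁ (result m)

  run-back : ∀ m → Back Q m (σ (1 + m)) (σ m)
  run-back m = proj₁ (proj₂ (result m))

  run-valid : Valid 0 Q
  run-valid = record
    { mono  = λ m r → transfer (σ m) (σ (1 + m)) (P m) (Q m) (P (1 + m)) (Q (1 + m)) r r (change m) (change (1 + m)) (proj₁ (proj₂ (proj₂ (result m))) r)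
    ; inter = λ m r → transfer (σ (1 + m)) (σ m) (P (1 + m)) (Q (1 + m)) (P m) (Q m) (1 + r) r (change (1 + m)) (change m) (proj₂ (proj₂ (proj₂ (result m))) r)
    ; king  = λ m r h → n≤0⇒n≡0 (king′ m r h (run-inv m) (change m))
    }
    where
    king′ : ∀ m r {s} → m ≤ 2 * r → Inv P Q m s → Change s (P m) (Q m) → Q m r ≤ 0
    king′ m r {none x} h (none _) c = ≤-reflexive (trans (at-none {x = x} c r) (Valid.king v m r h))
    king′ m r h (plus {r₀} p _) c =
      ≤-reflexive (trans (off-plus {P m} {Q m} {r₀} c λ { refl → <⇒≱ p h }) (Valid.king v m r h))
    king′ m r {pend x} h (pend _ _) c = ≤-reflexive (trans (at-pend {x = x} c r) (Valid.king v m r h))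
    king′ m r h (minus _ _ _) c = ≤-trans (m≤m+n _ _) (≤-reflexive (trans (c r) (trans (+-identityʳ _) (Valid.king v m r h))))

-- Reversing the growth rules

-- The counterpart of `Inv` for the downward direction, stated in terms of `Q` alone because the old
-- pattern is still to be constructed. The inequality for `plus` says that the added box can be
-- removed again.
data Inv⁻ (K : ℕ) (Q : Pattern) (m : ℕ) : State → Set where
  none  : ∀ {x} → m ≤ x → x < K → Inv⁻ K Q m (none x)
  plus  : ∀ {r} → Q m (1 + r) < Q m r → Inv⁻ K Q m (plus r)
  pend  : ∀ {r} → m ≡ 1 + 2 * r → (∀ r′ → r ≡ suc r′ → Q m r < Q (2 * r) r′) → Inv⁻ K Q m (pend r)
  minus : ∀ {r} → 2 * r < m → (∀ r′ → r ≡ suc r′ → Q m r < Q m r′) →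
          (m ≡ 1 + 2 * r → ∃[ r′ ] r ≡ suc r′ × Q (2 * r) r′ ≤ Q m r) → Inv⁻ K Q m (minus r)

-- What the choice between plus and pend at level m says about level 1 + m.
data Ahead (P : Pattern) (m : ℕ) : State → Set where
  none  : ∀ {x} → Ahead P m (none x)
  plus  : ∀ {r} → (m ≡ 1 + 2 * r → P (1 + m) r ≤ P m r) → Ahead P m (plus r)
  pend  : ∀ {r} → P m r < P (1 + m) r → Ahead P m (pend r)
  minus : ∀ {r} → Ahead P m (minus r)

-- A letter of rank `m` that enters a row was bumped out of the row above; if it enters row 0, it is
-- the inserted letter itself.
before : ℕ → ℕ → State
before m zero    = none m
before m (suc r) = plus r

back : Pattern → ℕ → State → State
back Q m (none x) = none x
back Q m (plus r) with Q (1 + m) r ≤? Q m r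
... | yes _ = plus r
... | no  _ = before m r
back Q m (pend r) = before m r
back Q m (minus zero) with m ≟ 1
... | yes _ = pend zero
... | no  _ = minus zero
back Q m (minus (suc r)) with Q m r ≤? Q (1 + m) (suc r) | m ≟ 1 + 2 * suc r | Q (2 * suc r) r ≤? Q m (suc r)
... | yes _ | _     | _     = minus r
... | no  _ | yes _ | no  _ = pend (suc r)
... | no  _ | yes _ | yes _ = minus (suc r)
... | no  _ | no  _ | _     = minus (suc r)

module _ {K : ℕ} {Q : Pattern} (v : Valid 0 Q) {m : ℕ} (m<K : m < K) where
  open Valid v

  back-inv : ∀ {t} → Inv⁻ K Q (1 + m) t → Back Q m t (back Q m t) × Inv⁻ K Q m (back Q m t)
  back-inv (none m<x x<K) = none , none (<⇒≤ m<x) x<K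
  back-inv (plus {r} h) with Q (1 + m) r ≤? Q m r
  ... | yes p = stay⁺ p , plus (≤-trans (s≤s (mono m (1 + r))) (≤-trans h p))
  back-inv (plus {zero}  h) | no ¬p = enter (≰⇒> ¬p) , none ≤-refl m<K
  back-inv (plus {suc r} h) | no ¬p = bump⁺ (≰⇒> ¬p) , plus (≤-trans (≰⇒> ¬p) (inter m r))
  back-inv (pend {zero}  e h) = enterᵖ , none ≤-refl m<K
  back-inv (pend {suc r} e h) =
    bumpᵖ , plus (subst (λ l → Q m (1 + r) < Q l r) (sym (suc-injective e))
      (≤-trans (s≤s (mono m (suc r))) (h r refl)))
  back-inv (minus {zero} h p q) with m ≟ 1
  ... | yes m≡1 = cancel⁻ (λ _ ()) m≡1 (λ _ ()) , pend m≡1 (λ _ ())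
  ... | no  m≢1 = stay⁻ (λ _ ()) (λ m≡1 → contradiction m≡1 m≢1) ,
                  minus positive (λ _ ()) (λ m≡1 → contradiction m≡1 m≢1)
    where
    positive : 0 < m
    -- At level 1 a hole in row 0 would have to have fallen from a row above.
    positive = n≢0⇒n>0 λ m≡0 → contradiction (proj₁ (proj₂ (q (cong suc m≡0)))) λ ()
  back-inv (minus {suc r} h p q)
    with Q m r ≤? Q (1 + m) (suc r) | m ≟ 1 + 2 * suc r | Q (2 * suc r) r ≤? Q m (suc r)
  ... | yes a | _ | _ = fall⁻ a , minus
          (lia 2 (λ r m → con 1 ⊕ 2 ⊛ (con 1 ⊕ r) ≦ con 1 ⊕ m ∷ [] ⊢ con 1 ⊕ 2 ⊛ r ≦ m) r m h)
          (λ { r′ refl → ≤-trans (s≤s a) (≤-trans (p r refl) (inter m r′)) })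
          (λ e → ⊥-elim (lia 2 (λ r m → con 1 ⊕ 2 ⊛ (con 1 ⊕ r) ≦ con 1 ⊕ m ∷ m ≐ con 1 ⊕ 2 ⊛ r ∷ [] ⊢ absurd) r m h e))
  ... | no a | yes e | no b =
          cancel⁻ (λ { r′ refl → ≰⇒> a }) e (λ { r′ refl → ≰⇒> b }) , pend e (λ { r′ refl → ≰⇒> b })
  ... | no a | yes e | yes b =
          stay⁻ (λ { r′ refl → ≰⇒> a }) (λ _ → r , refl , b) ,
          minus (≤-reflexive (sym e)) (λ { r′ refl → ≤-trans (s≤s (mono m (suc r))) (≰⇒> a) }) (λ _ → r , refl , b)
  ... | no a | no e | _ =
          stay⁻ (λ { r′ refl → ≰⇒> a }) (λ e′ → contradiction e′ e) ,
          minus (≤∧≢⇒< (s≤s⁻¹ h) distinct) (λ { r′ refl → ≤-trans (s≤s (mono m (suc r))) (≰⇒> a) }) (λ e′ → contradiction e′ e)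
    where
    distinct : 2 * suc r ≢ m
    distinct refl with q refl
    -- At level `1 + 2 * suc r` the hole must have just fallen from row `r`, but in this branch it
    -- has not.
    ... | r′ , refl , b = a b

  module _ {P : Pattern} where

    -- The entering rules at level `m` depend on the old pattern at level `2 + m`. Since the levels
    -- are passed downwards, that level is already known, and `Ahead` hands on what is needed of it.
    step⁻ : ∀ {s t} → Change s (P m) (Q m) → Change t (P (1 + m)) (Q (1 + m)) →
            Inv⁻ K Q (1 + m) t → Ahead P (1 + m) t → Back Q m t s → Inv⁻ K Q m s →
            Step 0 P m s t × Ahead P m s ×
            (∀ j → Q m j + dec s j + inc t j ≤ Q (1 + m) j + dec t j + inc s j) ×
            (∀ j → Q (1 + m) (1 + j) + dec t (1 + j) + inc s j ≤ Q m j + dec s j + inc t (1 + j))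
    step⁻ c₀ c₁ (none m<x _) _ none _ =
      wait m<x , none ,
      (λ j → lia 2 (λ a b → a ≦ b ∷ [] ⊢ a ⊕ con 0 ⊕ con 0 ≦ b ⊕ con 0 ⊕ con 0) _ _ (mono m j)) ,
      (λ j → lia 2 (λ a b → a ≦ b ∷ [] ⊢ a ⊕ con 0 ⊕ con 0 ≦ b ⊕ con 0 ⊕ con 0) _ _ (inter m j))
    step⁻ c₀ c₁ (plus {r} h) _ (stay⁺ p) _ =
      stay⁺ p′ , plus (λ _ → p′) ,
      (λ j → lia 3 (λ a b d → a ≦ b ∷ [] ⊢ a ⊕ con 0 ⊕ d ≦ b ⊕ con 0 ⊕ d) _ _ (δ r j) (mono m j)) ,
      (λ j → lia 4 (λ a b d e → a ⊕ d ≦ b ∷ [] ⊢ a ⊕ con 0 ⊕ d ≦ b ⊕ con 0 ⊕ e) _ _ (δ r j) (δ r (1 + j))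
        (strict-at r (inter m) (≤-trans h p) j))
      where
      p′ : P (1 + m) r ≤ P m r
      p′ = s≤s⁻¹ (subst₂ _≤_ (at-plus c₁) (at-plus c₀) p)
    step⁻ c₀ c₁ (plus h) (plus a) (bump⁺ {r} p) _ =
      bump⁺ (≤-trans (≤-reflexive (sym (at-plus c₀))) (≤-trans (mono m r) (≤-reflexive (off-plus c₁ 1+n≢n))))
           (to-plus (s≤s⁻¹ (king-< v (≤-trans (s≤s z≤n) p)))
             (λ e → a (cong suc e))) ,
      plus (λ e → ⊥-elim (lia 2 (λ m r → con 1 ⊕ 2 ⊛ (con 1 ⊕ r) ≦ con 1 ⊕ m ∷ m ≐ con 1 ⊕ 2 ⊛ r ∷ [] ⊢ absurd) m r
        (king-< v (≤-trans (s≤s z≤n) p)) e)) ,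
      (λ j → lia 4 (λ a b d e → a ⊕ d ≦ b ∷ [] ⊢ a ⊕ con 0 ⊕ d ≦ b ⊕ con 0 ⊕ e) _ _ (δ (1 + r) j) (δ r j)
        (strict-at (1 + r) (mono m) p j)) ,
      (λ j → lia 3 (λ a b d → a ≦ b ∷ [] ⊢ a ⊕ con 0 ⊕ d ≦ b ⊕ con 0 ⊕ d) _ _ (δ r j) (inter m j))
    step⁻ c₀ c₁ (plus h) (plus a) (enter p) _ =
      enter (to-plus z≤n (λ e → a (cong suc e))) , none ,
      (λ j → lia 3 (λ a b d → a ⊕ d ≦ b ∷ [] ⊢ a ⊕ con 0 ⊕ d ≦ b ⊕ con 0 ⊕ con 0) _ _ (δ 0 j)
        (strict-at 0 (mono m) p j)) ,
      (λ j → lia 2 (λ a b → a ≦ b ∷ [] ⊢ a ⊕ con 0 ⊕ con 0 ≦ b ⊕ con 0 ⊕ con 0) _ _ (inter m j))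
    step⁻ c₀ c₁ (pend e h) (pend a) (bumpᵖ {r}) (plus g) =
      bump⁺ (≤-trans (≤-reflexive (sym (at-plus c₀))) (≤-trans (mono m r) (≤-reflexive (at-pend {x = suc r} c₁ r))))
           (to-pend (suc-injective e) a) ,
      plus (λ e′ → contradiction (trans (sym (suc-injective e)) e′) (even≢odd (suc r) r)) ,
      (λ j → lia 3 (λ a b d → a ≦ b ∷ [] ⊢ a ⊕ con 0 ⊕ con 0 ≦ b ⊕ con 0 ⊕ d) _ _ (δ r j) (mono m j)) ,
      (λ j → lia 3 (λ a b d → a ⊕ d ≦ b ∷ [] ⊢ a ⊕ con 0 ⊕ d ≦ b ⊕ con 0 ⊕ con 0) _ _ (δ r j)
        (strict-at r (inter m) (subst (λ l → Q (1 + m) (1 + r) < Q l r) (sym (suc-injective e)) (h r refl)) j))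
    step⁻ c₀ c₁ (pend e h) (pend a) enterᵖ _ =
      enter (to-pend (suc-injective e) a) , none ,
      (λ j → lia 2 (λ a b → a ≦ b ∷ [] ⊢ a ⊕ con 0 ⊕ con 0 ≦ b ⊕ con 0 ⊕ con 0) _ _ (mono m j)) ,
      (λ j → lia 2 (λ a b → a ≦ b ∷ [] ⊢ a ⊕ con 0 ⊕ con 0 ≦ b ⊕ con 0 ⊕ con 0) _ _ (inter m j))
    step⁻ c₀ c₁ (minus h g _) _ (fall⁻ {r} p) _ =
      fall⁻ (subst₂ _≤_ (sym (at-minus c₀)) (sym (at-minus c₁)) (s≤s p)) , minus ,
      (λ j → lia 4 (λ a b d e → a ⊕ d ≦ b ∷ [] ⊢ a ⊕ d ⊕ con 0 ≦ b ⊕ e ⊕ con 0) _ _ (δ r j) (δ (suc r) j)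
        (strict-at r (mono m) (≤-trans (s≤s p) (g r refl)) j)) ,
      (λ j → lia 3 (λ a b d → a ≦ b ∷ [] ⊢ a ⊕ d ⊕ con 0 ≦ b ⊕ d ⊕ con 0) _ _ (δ r j) (inter m j))
    step⁻ c₀ c₁ (minus {r} h g _) _ (stay⁻ p q) _ =
      stay⁻ (≤-trans (s≤s (≤-trans (≤-reflexive (sym (off-minus c₁ (λ e → 1+n≢n (sym e))))) (inter m r)))
                     (≤-reflexive (sym (at-minus c₀)))) , minus ,
      (λ j → lia 3 (λ a b d → a ≦ b ∷ [] ⊢ a ⊕ d ⊕ con 0 ≦ b ⊕ d ⊕ con 0) _ _ (δ r j) (mono m j)) ,
      narrow r p
      where
      narrow : ∀ r → (∀ r′ → r ≡ suc r′ → Q (1 + m) r < Q m r′) →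
               ∀ j → Q (1 + m) (1 + j) + δ r (1 + j) + 0 ≤ Q m j + δ r j + 0
      narrow zero    p j = lia 3 (λ a b d → a ≦ b ∷ [] ⊢ a ⊕ con 0 ⊕ con 0 ≦ b ⊕ d ⊕ con 0) _ _ (δ 0 j) (inter m j)
      narrow (suc r) p j = lia 4 (λ a b d e → a ⊕ d ≦ b ∷ [] ⊢ a ⊕ d ⊕ con 0 ≦ b ⊕ e ⊕ con 0) _ _ (δ r j) (δ (suc r) j)
        (strict-at r (inter m) (p r refl) j)
    step⁻ c₀ c₁ (minus {r} h g _) _ (cancel⁻ p e q) _ =
      cancel⁻ e up , pend up ,
      (λ j → lia 3 (λ a b d → a ≦ b ∷ [] ⊢ a ⊕ con 0 ⊕ con 0 ≦ b ⊕ d ⊕ con 0) _ _ (δ r j) (mono m j)) ,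
      narrow r p
      where
      up : P m r < P (1 + m) r
      up = ≤-trans (s≤s (≤-trans (≤-reflexive (sym (at-pend {x = r} c₀ r))) (mono m r))) (≤-reflexive (sym (at-minus c₁)))
      narrow : ∀ r → (∀ r′ → r ≡ suc r′ → Q (1 + m) r < Q m r′) →
               ∀ j → Q (1 + m) (1 + j) + δ r (1 + j) + 0 ≤ Q m j + 0 + 0
      narrow zero    p j = lia 2 (λ a b → a ≦ b ∷ [] ⊢ a ⊕ con 0 ⊕ con 0 ≦ b ⊕ con 0 ⊕ con 0) _ _ (inter m j)
      narrow (suc r) p j = lia 3 (λ a b d → a ⊕ d ≦ b ∷ [] ⊢ a ⊕ d ⊕ con 0 ≦ b ⊕ con 0 ⊕ con 0) _ _ (δ r j)
        (strict-at r (inter m) (p r refl) j)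

data Move : Set where
  del add : ℕ → Move

state : Move → State
state (del r) = minus r
state (add r) = plus r

-- The recursion is on the distance from the level at which `s` is prescribed, because `back` leads
-- downwards.
trail : Pattern → State → ℕ → ℕ → State
trail Q s zero    m = s
trail Q s (suc d) m = back Q m (trail Q s d (suc m))

δ≤ : ∀ {r n j} → (r ≡ j → 0 < n) → δ r j ≤ n
δ≤ {r} {n} {j} h with r ≟ j
... | yes r≡j = ≤-trans (≤-reflexive (trans (cong (λ i → δ i j) r≡j) (δ-refl j))) (h r≡j)
... | no r≢j  = subst (_≤ n) (sym (δ-≢ r≢j)) z≤n

-- Makes the truncated subtraction in the definition of the old pattern exact.
inc≤ : ∀ {K Q m s} → Inv⁻ K Q m s → ∀ j → inc s j ≤ Q m j + dec s j
inc≤ (none _ _)    j = z≤n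
inc≤ (plus {r} h)  j = δ≤ {r} λ { refl → ≤-trans (s≤s z≤n) (≤-trans h (m≤m+n _ _)) }
inc≤ (pend _ _)    j = z≤n
inc≤ (minus _ _ _) j = z≤n

-- Here `α` is the prescribed shape before the insertion and `c` the move from it to the shape at
-- level `2 * k`. They fix the last state, from which all lower ones follow.
module Reverse (k : ℕ) {Q : Pattern} (v : Valid 0 Q) (stable : ∀ m j → 2 * k ≤ m → Q m j ≡ Q (2 * k) j)
               (c : Move) {α : ℕ → ℕ} (antitone : ∀ r → α (1 + r) ≤ α r) (bounded : ∀ r → k ≤ r → α r ≡ 0)
               (moved : Change (state c) α (Q (2 * k))) where
  open Valid v

  K : ℕ
  K = 2 * k

  final-inv : ∀ c → Change (state c) α (Q K) → Inv⁻ K Q K (state c)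
  final-inv (del r) h = minus (*-monoʳ-< 2 r<k)
      (λ { r′ refl → lia 4 (λ a b q q′ → a ≐ con 1 ⊕ q ∷ a ≦ b ∷ q′ ≐ b ∷ [] ⊢ con 1 ⊕ q ≦ q′)
             (α (suc r′)) (α r′) (Q K (suc r′)) (Q K r′) (at-minus h) (antitone r′) (off-minus h 1+n≢n) })
      -- The condition on holes concerns odd levels, and the last level is even.
      (λ e → contradiction e (even≢odd k r))
    where
    r<k : r < k
    r<k with r <? k
    ... | yes p = p
    ... | no ¬p = contradiction (trans (sym (bounded r (≮⇒≥ ¬p))) (at-minus h)) 0≢1+n
  final-inv (add r) h = plus (lia 4 (λ a b q q′ → q ≐ con 1 ⊕ a ∷ q′ ≐ b ∷ b ≦ a ∷ [] ⊢ con 1 ⊕ q′ ≦ q)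
    (α r) (α (1 + r)) (Q K r) (Q K (1 + r)) (at-plus h) (off-plus h (λ e → 1+n≢n (sym e))) (antitone r))

  σ : ℕ → State
  σ m = trail Q (state c) (K ∸ m) m

  P : Pattern
  P m j = Q m j + dec (σ m) j ∸ inc (σ m) j

  σ-back : ∀ {m} → m < K → σ m ≡ back Q m (σ (1 + m))
  σ-back {m} m<K = cong (λ d → trail Q (state c) d m) (+-∸-assoc 1 m<K)

  σ-final : ∀ {m} → K ≤ m → σ m ≡ state c
  σ-final {m} K≤m = cong (λ d → trail Q (state c) d m) (m≤n⇒m∸n≡0 K≤m)

  P-final : ∀ m j → K ≤ m → P m j ≡ α j
  P-final m j K≤m rewrite σ-final K≤m | stable m j K≤m | moved j = m+n∸n≡m (α j) (inc (state c) j)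

  private
    up : ∀ d m → m + suc d ≡ K → m < K × suc m + d ≡ K
    up d m e = ≤-trans (m≤m+n (suc m) d) (≤-reflexive e′) , e′
      where e′ = trans (sym (+-suc m d)) e

    inv′ : ∀ d m → m + d ≡ K → Inv⁻ K Q m (σ m)
    inv′ zero m e = subst₂ (Inv⁻ K Q) K≡m (sym (σ-final (≤-reflexive K≡m))) (final-inv c moved)
      where K≡m = sym (trans (sym (+-identityʳ m)) e)
    inv′ (suc d) m e = subst (Inv⁻ K Q m) (sym (σ-back m<K)) (proj₂ (back-inv v m<K (inv′ d (suc m) e′)))
      where m<K = proj₁ (up d m e); e′ = proj₂ (up d m e)

  inv : ∀ {m} → m ≤ K → Inv⁻ K Q m (σ m)
  inv {m} m≤K = inv′ (K ∸ m) m (m+[n∸m]≡n m≤K)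

  change : ∀ {m} → m ≤ K → Change (σ m) (P m) (Q m)
  change m≤K j = sym (m∸n+n≡m (inc≤ (inv m≤K) j))

  backward : ∀ {m} → m < K → Back Q m (σ (1 + m)) (σ m)
  backward {m} m<K = subst (Back Q m (σ (1 + m))) (sym (σ-back m<K)) (proj₁ (back-inv v m<K (inv m<K)))

  private
    final-ahead : ∀ {m} → m ≡ K → ∀ c → Ahead P m (state c)
    final-ahead e (del r) = minus
    final-ahead e (add r) = plus (λ e′ → contradiction (trans (sym e) e′) (even≢odd k r))

    ahead′ : ∀ d m → m + d ≡ K → Ahead P m (σ m)
    ahead′ zero m e = subst (Ahead P m) (sym (σ-final (≤-reflexive (sym m≡K)))) (final-ahead m≡K c)
      where m≡K = trans (sym (+-identityʳ m)) e
    ahead′ (suc d) m e =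
      let m<K , e′ = up d m e in
      proj₁ (proj₂ (step⁻ v m<K {P} (change (<⇒≤ m<K)) (change m<K) (inv m<K) (ahead′ d (suc m) e′)
        (backward m<K) (inv (<⇒≤ m<K))))

    result : ∀ {m} (m<K : m < K) → _
    result {m} m<K = step⁻ v m<K {P} (change (<⇒≤ m<K)) (change m<K) (inv m<K)
      (ahead′ (K ∸ suc m) (suc m) (m+[n∸m]≡n m<K)) (backward m<K) (inv (<⇒≤ m<K))

  steps : ∀ {m} → m < K → Step 0 P m (σ m) (σ (1 + m))
  steps m<K = proj₁ (result m<K)

  transfer⁻ : ∀ s t (p₀ q₀ p₁ q₁ : ℕ → ℕ) i j → Change s p₀ q₀ → Change t p₁ q₁ →
    q₀ i + dec s i + inc t j ≤ q₁ j + dec t j + inc s i → p₀ i ≤ p₁ j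
  transfer⁻ s t p₀ q₀ p₁ q₁ i j c d = lia 8
    (λ p₀ i₀ d₀ q₀ p₁ i₁ d₁ q₁ → q₀ ⊕ d₀ ≐ p₀ ⊕ i₀ ∷ q₁ ⊕ d₁ ≐ p₁ ⊕ i₁ ∷
       q₀ ⊕ d₀ ⊕ i₁ ≦ q₁ ⊕ d₁ ⊕ i₀ ∷ [] ⊢ p₀ ≦ p₁)
    (p₀ i) (inc s i) (dec s i) (q₀ i) (p₁ j) (inc t j) (dec t j) (q₁ j) (c i) (d j)

  P-valid : Valid 0 P
  P-valid = record { mono = mono′ ; inter = inter′ ; king = king′ }
    where
    mono′ : ∀ m r → P m r ≤ P (1 + m) r
    mono′ m r with m <? K
    ... | yes m<K = transfer⁻ (σ m) (σ (1 + m)) (P m) (Q m) (P (1 + m)) (Q (1 + m)) r r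
                      (change (<⇒≤ m<K)) (change m<K) (proj₁ (proj₂ (proj₂ (result m<K))) r)
    ... | no m≮K  = ≤-reflexive (trans (P-final m r (≮⇒≥ m≮K)) (sym (P-final (1 + m) r (m≤n⇒m≤1+n (≮⇒≥ m≮K)))))
    inter′ : ∀ m r → P (1 + m) (1 + r) ≤ P m r
    inter′ m r with m <? K
    ... | yes m<K = transfer⁻ (σ (1 + m)) (σ m) (P (1 + m)) (Q (1 + m)) (P m) (Q m) (1 + r) r
                      (change m<K) (change (<⇒≤ m<K)) (proj₂ (proj₂ (proj₂ (result m<K))) r)
    ... | no m≮K  = subst₂ _≤_ (sym (P-final (1 + m) (1 + r) (m≤n⇒m≤1+n (≮⇒≥ m≮K)))) (sym (P-final m r (≮⇒≥ m≮K))) (antitone r)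
    king″ : ∀ {m r s} → m ≤ 2 * r → Inv⁻ K Q m s → Q m r + dec s r ≡ 0
    king″ {m} {r} h (none _ _) = trans (+-identityʳ _) (king m r h)
    king″ {m} {r} h (plus _)   = trans (+-identityʳ _) (king m r h)
    king″ {m} {r} h (pend _ _) = trans (+-identityʳ _) (king m r h)
    king″ {m} {r} h (minus {r₀} p _ _) = cong₂ _+_ (king m r h) (δ-≢ {r₀} λ { refl → <⇒≱ p h })
    king′ : ∀ m r → m ≤ 2 * r → P m r ≡ 0
    king′ m r h with m ≤? K
    ... | yes m≤K = n≤0⇒n≡0 (≤-trans (m∸n≤m _ (inc (σ m) r)) (≤-reflexive (king″ h (inv m≤K))))
    ... | no m≰K  = trans (P-final m r (≰⇒≥ m≰K)) (bounded r (*-cancelˡ-≤ 2 (≤-trans (≰⇒≥ m≰K) h)))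

  -- Level 0 sees no letters, hence no box to take back, no hole and no pending cancellation. Only
  -- `none x` remains, and `x` is the rank of the letter to be inserted.
  initial : ∃[ x ] σ 0 ≡ none x × x < K
  initial with σ 0 | inv {0} z≤n
  ... | none x | none _ x<K = x , refl , x<K
  ... | plus r | plus h = contradiction (subst (Q 0 (1 + r) <_) (king 0 r z≤n) h) n≮0

-- Comparison of two successive insertions

infix 4 _⊑_ _⊏_

-- minus 0 < minus 1 < ⋯ < pend < ⋯ < plus 1 < plus 0 < none 0 < none 1 < ⋯
data _⊑_ : State → State → Set where
  none-none   : ∀ {x y} → x ≤ y → none x ⊑ none y
  plus-none   : ∀ {r y} → plus r ⊑ none y
  pend-none   : ∀ {r y} → pend r ⊑ none y
  minus-none  : ∀ {r y} → minus r ⊑ none y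
  plus-plus   : ∀ {r r′} → r′ ≤ r → plus r ⊑ plus r′
  pend-plus   : ∀ {r r′} → pend r ⊑ plus r′
  minus-plus  : ∀ {r r′} → minus r ⊑ plus r′
  pend-pend   : ∀ {r r′} → pend r ⊑ pend r′
  minus-pend  : ∀ {r r′} → minus r ⊑ pend r′
  minus-minus : ∀ {r r′} → r ≤ r′ → minus r ⊑ minus r′

-- The strict part of `⊑`. Two pending states are never strictly ordered: at a common level they lie
-- in the same row, as the level determines the row.
data _⊏_ : State → State → Set where
  none-none   : ∀ {x y} → x < y → none x ⊏ none y
  plus-none   : ∀ {r y} → plus r ⊏ none y
  pend-none   : ∀ {r y} → pend r ⊏ none y
  minus-none  : ∀ {r y} → minus r ⊏ none y
  plus-plus   : ∀ {r r′} → r′ < r → plus r ⊏ plus r′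
  pend-plus   : ∀ {r r′} → pend r ⊏ plus r′
  minus-plus  : ∀ {r r′} → minus r ⊏ plus r′
  minus-pend  : ∀ {r r′} → minus r ⊏ pend r′
  minus-minus : ∀ {r r′} → r < r′ → minus r ⊏ minus r′

-- A bump out of row `r` at level `1 + 2 * r` would send a letter into row `1 + r` that is too small
-- for it. So the new row `r` contains no barred letter of index `r`, and a later letter cannot
-- cancel there.
plus-ahead : ∀ {P Q σ} → Run 0 P Q σ → ∀ m r → σ m ≡ plus r → m ≡ 1 + 2 * r → Q (1 + m) r ≤ Q m r
plus-ahead {P} {Q} {σ} run m r e e′ = go (subst (λ s → Step 0 P m s (σ (1 + m))) e (Run.steps run m))
      (subst (λ s → Change s (P m) (Q m)) e (Run.change run m)) (Run.change run (1 + m))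
  where
  go : ∀ {t} → Step 0 P m (plus r) t → Change (plus r) (P m) (Q m) →
       Change t (P (1 + m)) (Q (1 + m)) → Q (1 + m) r ≤ Q m r
  go (stay⁺ p) c d = subst₂ _≤_ (sym (at-plus d)) (sym (at-plus c)) (s≤s p)
  go (bump⁺ _ (to-plus h _)) c d = ⊥-elim (lia 2 (λ m r → 2 ⊛ (con 1 ⊕ r) ≦ m ∷ m ≐ con 1 ⊕ 2 ⊛ r ∷ [] ⊢ absurd) m r h e′)
  go (bump⁺ _ (to-pend h _)) c d = contradiction (trans (sym h) e′) (even≢odd (suc r) r)

module Compare {P Q R : Pattern} (vP : Valid 0 P) {m : ℕ}
               {s t : State} (step₁ : Step 0 P m s t) (inv₁ : Inv P Q m s)
               (c₀ : Change s (P m) (Q m)) (c₁ : Change t (P (1 + m)) (Q (1 + m)))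
               (ahead : ∀ r → t ≡ plus r → 1 + m ≡ 1 + 2 * r → Q (2 + m) r ≤ Q (1 + m) r)
               {s′ t′ : State} (step₂ : Step 0 Q m s′ t′) (inv₂ : Inv Q R m s′)
               (d₀ : Change s′ (Q m) (R m)) (d₁ : Change t′ (Q (1 + m)) (R (1 + m))) where

  private
    module P = Valid vP

    enter-⊑ : ∀ {r t t′} → (∀ r → t ≡ plus r → 1 + m ≡ 1 + 2 * r → Q (2 + m) r ≤ Q (1 + m) r) →
              Enter 0 P m r t → Enter 0 Q m r t′ → t ⊑ t′
    enter-⊑ a (to-plus _ _) (to-plus _ _) = plus-plus ≤-refl
    -- Had the first letter entered without cancelling, the row would hold no barred letter for the
    -- second one to cancel.
    enter-⊑ a (to-plus _ _) (to-pend e p) = contradiction p (≤⇒≯ (a _ refl (cong suc e)))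
    enter-⊑ a (to-pend _ _) (to-plus _ _) = pend-plus
    enter-⊑ a (to-pend _ _) (to-pend _ _) = pend-pend

    same-bump : ∀ {r} → Change (plus r) (P m) (Q m) → Change (plus r) (P (1 + m)) (Q (1 + m)) →
                P (1 + m) r ≤ P m r → ¬ Q m r < Q (1 + m) r
    same-bump {r} c d = lia 4 (λ p q p′ q′ → q ≐ con 1 ⊕ p ∷ q′ ≐ con 1 ⊕ p′ ∷ p′ ≦ p ∷ con 1 ⊕ q ≦ q′ ∷ [] ⊢ absurd)
      (P m r) (Q m r) (P (1 + m) r) (Q (1 + m) r) (at-plus c) (at-plus d)

    half : ∀ {r r′} → 2 * r < 2 * suc r′ → r ≤ r′
    half {r} {r′} h = s≤s⁻¹ (*-cancelˡ-< 2 r (suc r′) h)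

    half-odd : ∀ {r r′} → 2 * r < 1 + 2 * r′ → r ≤ r′
    half-odd {r} {r′} h = *-cancelˡ-≤ 2 (s≤s⁻¹ h)

  -- States can cross only where they meet in one row, and there the first insertion decides the
  -- second: if its added box stays, the row has no letter of rank `m` for the second to bump, and
  -- if its hole falls, the shortened rows make the second hole fall too.
  preserves-⊑ : s ⊑ s′ → t ⊑ t′
  preserves-⊑ = go c₀ c₁ ahead d₀ d₁ step₁ inv₁ step₂ inv₂
    where
    go : ∀ {s t s′ t′} → Change s (P m) (Q m) → Change t (P (1 + m)) (Q (1 + m)) →
         (∀ r → t ≡ plus r → 1 + m ≡ 1 + 2 * r → Q (2 + m) r ≤ Q (1 + m) r) →
         Change s′ (Q m) (R m) → Change t′ (Q (1 + m)) (R (1 + m)) →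
         Step 0 P m s t → Inv P Q m s → Step 0 Q m s′ t′ → Inv Q R m s′ → s ⊑ s′ → t ⊑ t′
    go c₀ c₁ a d₀ d₁ (wait _) i (wait _) j (none-none h) = none-none h
    go c₀ c₁ a d₀ d₁ (wait p) i (enter _) j (none-none h) = contradiction p (≤⇒≯ h)
    go c₀ c₁ a d₀ d₁ (enter (to-plus _ _)) i (wait _) j (none-none h) = plus-none
    go c₀ c₁ a d₀ d₁ (enter (to-pend _ _)) i (wait _) j (none-none h) = pend-none
    go c₀ c₁ a d₀ d₁ (enter e) i (enter f) j (none-none h) = enter-⊑ a e f
    go c₀ c₁ a d₀ d₁ (stay⁺ _) i (wait _) j plus-none = plus-none
    go c₀ c₁ a d₀ d₁ (bump⁺ _ (to-plus _ _)) i (wait _) j plus-none = plus-none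
    go c₀ c₁ a d₀ d₁ (bump⁺ _ (to-pend _ _)) i (wait _) j plus-none = pend-none
    go c₀ c₁ a d₀ d₁ (stay⁺ _) i (enter (to-plus _ _)) j plus-none = plus-plus z≤n
    go c₀ c₁ a d₀ d₁ (bump⁺ _ (to-plus _ _)) i (enter (to-plus _ _)) j plus-none = plus-plus z≤n
    go c₀ c₁ a d₀ d₁ (bump⁺ _ (to-pend _ _)) i (enter (to-plus _ _)) j plus-none = pend-plus
    go c₀ c₁ a d₀ d₁ _ (plus p _) (enter (to-pend refl _)) j plus-none = contradiction p n≮0
    go c₀ c₁ a d₀ d₁ (cancel⁻ _ _) i (wait _) j pend-none = minus-none
    go c₀ c₁ a d₀ d₁ (cancel⁻ _ _) i (enter (to-plus _ _)) j pend-none = minus-plus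
    go c₀ c₁ a d₀ d₁ (cancel⁻ _ _) i (enter (to-pend _ _)) j pend-none = minus-pend
    go c₀ c₁ a d₀ d₁ (stay⁻ _) i (wait _) j minus-none = minus-none
    go c₀ c₁ a d₀ d₁ (stay⁻ _) i (enter (to-plus _ _)) j minus-none = minus-plus
    go c₀ c₁ a d₀ d₁ (stay⁻ _) i (enter (to-pend _ _)) j minus-none = minus-pend
    go c₀ c₁ a d₀ d₁ (fall⁻ _) i (wait _) j minus-none = minus-none
    go c₀ c₁ a d₀ d₁ (fall⁻ _) i (enter (to-plus _ _)) j minus-none = minus-plus
    go c₀ c₁ a d₀ d₁ (fall⁻ _) i (enter (to-pend _ _)) j minus-none = minus-pend
    go c₀ c₁ a d₀ d₁ (stay⁺ p) i (stay⁺ _) j (plus-plus h) = plus-plus h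
    go {plus r} {_} {plus r′} c₀ c₁ a d₀ d₁ (stay⁺ p) i (bump⁺ q e) j (plus-plus h) with r′ ≟ r
    go c₀ c₁ a d₀ d₁ (stay⁺ p) i (bump⁺ q e) j (plus-plus h) | yes refl = contradiction q (same-bump c₀ c₁ p)
    go c₀ c₁ a d₀ d₁ (stay⁺ p) i (bump⁺ q (to-plus _ _)) j (plus-plus h) | no r≢ = plus-plus (≤∧≢⇒< h r≢)
    go c₀ c₁ a d₀ d₁ (stay⁺ p) (plus g _) (bump⁺ q (to-pend e _)) j (plus-plus h) | no r≢ =
      contradiction (half (subst (_ <_) e g)) (<⇒≱ (≤∧≢⇒< h r≢))
    go c₀ c₁ a d₀ d₁ (bump⁺ _ (to-plus _ _)) i (stay⁺ _) j (plus-plus h) = plus-plus (m≤n⇒m≤1+n h)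
    go c₀ c₁ a d₀ d₁ (bump⁺ _ (to-pend _ _)) i (stay⁺ _) j (plus-plus h) = pend-plus
    go c₀ c₁ a d₀ d₁ (bump⁺ _ (to-plus _ _)) i (bump⁺ _ (to-plus _ _)) j (plus-plus h) = plus-plus (s≤s h)
    go c₀ c₁ a d₀ d₁ (bump⁺ _ (to-pend _ _)) i (bump⁺ _ (to-plus _ _)) j (plus-plus h) = pend-plus
    go c₀ c₁ a d₀ d₁ (bump⁺ _ (to-pend _ _)) i (bump⁺ _ (to-pend _ _)) j (plus-plus h) = pend-pend
    -- The level `2 * (1 + r′)` of the second entry bounds the row that the first letter may enter,
    -- so both enter the same row.
    go c₀ c₁ a d₀ d₁ (bump⁺ _ (to-plus g f)) i (bump⁺ _ (to-pend e q)) j (plus-plus h)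
      with ≤-antisym (*-cancelˡ-≤ 2 (≤-trans g (≤-reflexive e))) (s≤s h)
    ... | refl = enter-⊑ a (to-plus g f) (to-pend e q)
    go c₀ c₁ a d₀ d₁ (cancel⁻ _ _) i (stay⁺ _) j pend-plus = minus-plus
    go c₀ c₁ a d₀ d₁ (cancel⁻ _ _) i (bump⁺ _ (to-plus _ _)) j pend-plus = minus-plus
    go c₀ c₁ a d₀ d₁ (cancel⁻ _ _) i (bump⁺ _ (to-pend _ _)) j pend-plus = minus-pend
    go c₀ c₁ a d₀ d₁ (stay⁻ _) i (stay⁺ _) j minus-plus = minus-plus
    go c₀ c₁ a d₀ d₁ (stay⁻ _) i (bump⁺ _ (to-plus _ _)) j minus-plus = minus-plus
    go c₀ c₁ a d₀ d₁ (stay⁻ _) i (bump⁺ _ (to-pend _ _)) j minus-plus = minus-pend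
    go c₀ c₁ a d₀ d₁ (fall⁻ _) i (stay⁺ _) j minus-plus = minus-plus
    go c₀ c₁ a d₀ d₁ (fall⁻ _) i (bump⁺ _ (to-plus _ _)) j minus-plus = minus-plus
    go c₀ c₁ a d₀ d₁ (fall⁻ _) i (bump⁺ _ (to-pend _ _)) j minus-plus = minus-pend
    go c₀ c₁ a d₀ d₁ (cancel⁻ e _) i (cancel⁻ e′ _) j pend-pend =
      minus-minus (*-cancelˡ-≤ 2 (≤-reflexive (suc-injective (trans (sym e) e′))))
    go c₀ c₁ a d₀ d₁ (stay⁻ _) (minus g _ _) (cancel⁻ e _) j minus-pend = minus-minus (half-odd (subst (_ <_) e g))
    go {minus r} {_} {pend r′} c₀ c₁ a d₀ d₁ (fall⁻ p) (minus g f _) (cancel⁻ e _) j minus-pend with r ≟ r′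
    ... | no r≢ = minus-minus (≤∧≢⇒< (half-odd (subst (_ <_) e g)) r≢)
    -- The first hole cannot fall here, because row `1 + r` is still empty at level `2 + 2 * r`.
    ... | yes refl = contradiction (≤-trans f p) (subst (λ n → ¬ P m (1 + r) < n) (sym (P.king (1 + m) (1 + r)
            (lia 2 (λ m r → m ≐ con 1 ⊕ 2 ⊛ r ∷ [] ⊢ con 1 ⊕ m ≦ 2 ⊛ (con 1 ⊕ r)) m r e))) n≮0)
    go c₀ c₁ a d₀ d₁ (stay⁻ _) i (stay⁻ _) j (minus-minus h) = minus-minus h
    go c₀ c₁ a d₀ d₁ (stay⁻ _) i (fall⁻ _) j (minus-minus h) = minus-minus (m≤n⇒m≤1+n h)
    go c₀ c₁ a d₀ d₁ (fall⁻ _) i (fall⁻ _) j (minus-minus h) = minus-minus (s≤s h)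
    go {minus r} {_} {minus r′} c₀ c₁ a d₀ d₁ (fall⁻ p) i (stay⁻ q) j (minus-minus h) with r ≟ r′
    ... | no r≢ = minus-minus (≤∧≢⇒< h r≢)
    ... | yes refl = ⊥-elim (lia 4 (λ p q p′ q′ → p ≐ con 1 ⊕ q ∷ p′ ≐ con 1 ⊕ q′ ∷ p ≦ p′ ∷ con 1 ⊕ q′ ≦ q ∷ [] ⊢ absurd)
        (P m r) (Q m r) (P (1 + m) (1 + r)) (Q (1 + m) (1 + r)) (at-minus c₀) (at-minus c₁) p q)

  -- Here the danger lies in adjacent rows. A letter that the first insertion puts into the row of
  -- the second one is bumped by it at the same level, and a row shortened by the first insertion
  -- offers no entry to a second hole just above it.
  preserves-⊐ : s′ ⊏ s → t′ ⊏ t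
  preserves-⊐ = go c₀ c₁ d₀ d₁ step₁ inv₁ step₂ inv₂
    where
    go : ∀ {s t s′ t′} → Change s (P m) (Q m) → Change t (P (1 + m)) (Q (1 + m)) →
         Change s′ (Q m) (R m) → Change t′ (Q (1 + m)) (R (1 + m)) →
         Step 0 P m s t → Inv P Q m s → Step 0 Q m s′ t′ → Inv Q R m s′ → s′ ⊏ s → t′ ⊏ t
    go c₀ c₁ d₀ d₁ (wait _) i (wait _) j (none-none h) = none-none h
    go c₀ c₁ d₀ d₁ (wait _) i (enter (to-plus _ _)) j (none-none h) = plus-none
    go c₀ c₁ d₀ d₁ (wait _) i (enter (to-pend _ _)) j (none-none h) = pend-none
    go c₀ c₁ d₀ d₁ (enter _) i (wait p) j (none-none h) = contradiction p (<⇒≯ h)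
    go c₀ c₁ d₀ d₁ (enter _) i (enter _) j (none-none h) = contradiction h (<-irrefl refl)
    go c₀ c₁ d₀ d₁ (wait _) i (stay⁺ _) j plus-none = plus-none
    go c₀ c₁ d₀ d₁ (wait _) i (bump⁺ _ (to-plus _ _)) j plus-none = plus-none
    go c₀ c₁ d₀ d₁ (wait _) i (bump⁺ _ (to-pend _ _)) j plus-none = pend-none
    go c₀ c₁ d₀ d₁ (wait _) i (cancel⁻ _ _) j pend-none = minus-none
    go c₀ c₁ d₀ d₁ (wait _) i (stay⁻ _) j minus-none = minus-none
    go c₀ c₁ d₀ d₁ (wait _) i (fall⁻ _) j minus-none = minus-none
    go c₀ c₁ d₀ d₁ (enter (to-plus _ _)) i (stay⁺ {zero} p) j plus-none =
      ⊥-elim (lia 4 (λ p q p′ q′ → q ≐ p ∷ p ≦ p′ ∷ q′ ≐ con 1 ⊕ p′ ∷ q′ ≦ q ∷ [] ⊢ absurd)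
        (P m 0) (Q m 0) (P (1 + m) 0) (Q (1 + m) 0) (at-none {x = m} c₀ 0) (P.mono m 0) (at-plus c₁) p)
    go c₀ c₁ d₀ d₁ (enter (to-plus _ _)) i (stay⁺ {suc r} p) j plus-none = plus-plus (s≤s z≤n)
    go c₀ c₁ d₀ d₁ (enter (to-plus _ _)) i (bump⁺ _ (to-plus _ _)) j plus-none = plus-plus (s≤s z≤n)
    go c₀ c₁ d₀ d₁ (enter (to-plus _ _)) i (bump⁺ _ (to-pend _ _)) j plus-none = pend-plus
    go c₀ c₁ d₀ d₁ (enter (to-plus _ _)) i (cancel⁻ _ _) j pend-none = minus-plus
    go c₀ c₁ d₀ d₁ (enter (to-plus _ _)) i (stay⁻ _) j minus-none = minus-plus
    go c₀ c₁ d₀ d₁ (enter (to-plus _ _)) i (fall⁻ _) j minus-none = minus-plus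
    go c₀ c₁ d₀ d₁ (enter (to-pend refl _)) i _ (plus g _) plus-none = contradiction g n≮0
    go c₀ c₁ d₀ d₁ (enter (to-pend refl _)) i _ (pend () _) pend-none
    go c₀ c₁ d₀ d₁ (enter (to-pend refl _)) i _ (minus g _ _) minus-none = contradiction g n≮0
    go c₀ c₁ d₀ d₁ (stay⁺ _) i (stay⁺ _) j (plus-plus h) = plus-plus h
    go c₀ c₁ d₀ d₁ (stay⁺ _) i (bump⁺ _ (to-plus _ _)) j (plus-plus h) = plus-plus (m<n⇒m<1+n h)
    go c₀ c₁ d₀ d₁ (stay⁺ _) i (bump⁺ _ (to-pend _ _)) j (plus-plus h) = pend-plus
    go {plus r} {_} {plus r′} c₀ c₁ d₀ d₁ (bump⁺ _ (to-plus _ _)) i (stay⁺ p) j (plus-plus h) with r′ ≟ suc r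
    ... | no r≢ = plus-plus (≤∧≢⇒< h (λ e → r≢ (sym e)))
    ... | yes refl = ⊥-elim (lia 4 (λ p q p′ q′ → q ≐ p ∷ p ≦ p′ ∷ q′ ≐ con 1 ⊕ p′ ∷ q′ ≦ q ∷ [] ⊢ absurd)
        (P m (1 + r)) (Q m (1 + r)) (P (1 + m) (1 + r)) (Q (1 + m) (1 + r))
        (off-plus c₀ (λ e → 1+n≢n (sym e))) (P.mono m (1 + r)) (at-plus c₁) p)
    go c₀ c₁ d₀ d₁ (bump⁺ _ (to-plus _ _)) i (bump⁺ _ (to-plus _ _)) j (plus-plus h) = plus-plus (s≤s h)
    go c₀ c₁ d₀ d₁ (bump⁺ _ (to-plus _ _)) i (bump⁺ _ (to-pend _ _)) j (plus-plus h) = pend-plus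
    go c₀ c₁ d₀ d₁ (bump⁺ _ (to-pend e _)) i _ (plus g _) (plus-plus h) =
      contradiction (half (subst (_ <_) e g)) (<⇒≱ h)
    go c₀ c₁ d₀ d₁ (stay⁺ _) i (cancel⁻ _ _) j pend-plus = minus-plus
    go c₀ c₁ d₀ d₁ (bump⁺ _ (to-plus _ _)) i (cancel⁻ _ _) j pend-plus = minus-plus
    go c₀ c₁ d₀ d₁ (bump⁺ _ (to-pend _ _)) i (cancel⁻ _ _) j pend-plus = minus-pend
    go c₀ c₁ d₀ d₁ (stay⁺ _) i (stay⁻ _) j minus-plus = minus-plus
    go c₀ c₁ d₀ d₁ (bump⁺ _ (to-plus _ _)) i (stay⁻ _) j minus-plus = minus-plus
    go c₀ c₁ d₀ d₁ (bump⁺ _ (to-pend _ _)) i (stay⁻ _) j minus-plus = minus-pend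
    go c₀ c₁ d₀ d₁ (stay⁺ _) i (fall⁻ _) j minus-plus = minus-plus
    go c₀ c₁ d₀ d₁ (bump⁺ _ (to-plus _ _)) i (fall⁻ _) j minus-plus = minus-plus
    go c₀ c₁ d₀ d₁ (bump⁺ _ (to-pend _ _)) i (fall⁻ _) j minus-plus = minus-pend
    go {pend r} {_} {minus r′} c₀ c₁ d₀ d₁ (cancel⁻ e _) (pend _ f) step₂ (minus g _ h) minus-pend with r′ ≟ r
    -- The old pattern of the second insertion is the new one of the first. A hole in row `r` and a
    -- pending cancellation in row `r` impose opposite inequalities on it.
    ... | yes refl with h e
    ...   | r₀ , refl , _ , q = contradiction q (<⇒≱ (f r₀ refl))
    go c₀ c₁ d₀ d₁ (cancel⁻ e _) i (stay⁻ _) (minus g _ _) minus-pend | no r≢ =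
      minus-minus (≤∧≢⇒< (half-odd (subst (_ <_) e g)) r≢)
    go {pend r} {_} {minus r′} c₀ c₁ d₀ d₁ (cancel⁻ e _) i (fall⁻ p) (minus g _ _) minus-pend | no r≢ with suc r′ ≟ r
    ... | no r≢′ = minus-minus (≤∧≢⇒< (≤∧≢⇒< (half-odd (subst (_ <_) e g)) r≢) r≢′)
    ... | yes refl = ⊥-elim (lia 4 (λ p q p′ q′ → q ≐ p ∷ p′ ≦ p ∷ p′ ≐ con 1 ⊕ q′ ∷ q ≦ q′ ∷ [] ⊢ absurd)
        (P m r′) (Q m r′) (P (1 + m) r) (Q (1 + m) r) (at-pend {x = r} c₀ r′) (P.inter m r′) (at-minus c₁) p)
    go c₀ c₁ d₀ d₁ (stay⁻ _) i (stay⁻ _) j (minus-minus h) = minus-minus h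
    go c₀ c₁ d₀ d₁ (fall⁻ _) i (stay⁻ _) j (minus-minus h) = minus-minus (m<n⇒m<1+n h)
    go c₀ c₁ d₀ d₁ (fall⁻ _) i (fall⁻ _) j (minus-minus h) = minus-minus (s≤s h)
    go {minus r} {_} {minus r′} c₀ c₁ d₀ d₁ (stay⁻ _) i (fall⁻ p) j (minus-minus h) with suc r′ ≟ r
    ... | no r≢ = minus-minus (≤∧≢⇒< h r≢)
    ... | yes refl = ⊥-elim (lia 4 (λ p q p′ q′ → q ≐ p ∷ p′ ≦ p ∷ p′ ≐ con 1 ⊕ q′ ∷ q ≦ q′ ∷ [] ⊢ absurd)
        (P m r′) (Q m r′) (P (1 + m) r) (Q (1 + m) r) (off-minus c₀ 1+n≢n) (P.inter m r′) (at-minus c₁) p)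

module _ {P Q R σ τ} (vP : Valid 0 P) (run₁ : Run 0 P Q σ) (run₂ : Run 0 Q R τ)
         {x y} (σ₀ : σ 0 ≡ none x) (τ₀ : τ 0 ≡ none y) where

  private
    vQ = run-valid vP run₁ σ₀
    module C (m : ℕ) = Compare {P} {Q} {R} vP {m} (Run.steps run₁ m) (run-inv vP run₁ σ₀ m)
      (Run.change run₁ m) (Run.change run₁ (1 + m)) (plus-ahead run₁ (1 + m))
      (Run.steps run₂ m) (run-inv vQ run₂ τ₀ m) (Run.change run₂ m) (Run.change run₂ (1 + m))

  runs-⊑ : x ≤ y → ∀ m → σ m ⊑ τ m
  runs-⊑ x≤y zero    = subst₂ _⊑_ (sym σ₀) (sym τ₀) (none-none x≤y)
  runs-⊑ x≤y (suc m) = C.preserves-⊑ m (runs-⊑ x≤y m)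

  runs-⊐ : y < x → ∀ m → τ m ⊏ σ m
  runs-⊐ y<x zero    = subst₂ _⊏_ (sym τ₀) (sym σ₀) (none-none y<x)
  runs-⊐ y<x (suc m) = C.preserves-⊐ m (runs-⊐ y<x m)

-- Counting letters

ind : ℕ → ℕ → ℕ
ind a       zero    = 0
ind zero    (suc m) = 1
ind (suc a) (suc m) = ind a m

ind-< : ∀ {a m} → a < m → ind a m ≡ 1
ind-< {zero}  (s≤s _) = refl
ind-< {suc a} (s≤s h) = ind-< h

ind-≥ : ∀ {a m} → m ≤ a → ind a m ≡ 0
ind-≥ z≤n     = refl
ind-≥ (s≤s h) = ind-≥ h

ind-mono : ∀ a {m n} → m ≤ n → ind a m ≤ ind a n
ind-mono a       z≤n     = z≤n
ind-mono zero    (s≤s h) = ≤-refl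
ind-mono (suc a) (s≤s h) = ind-mono a h

ind-shift : ∀ {a b} m → a < b → ind b (1 + m) ≤ ind a m
ind-shift {a} {b} m a<b with b <? 1 + m
... | yes b≤m = ≤-reflexive (trans (ind-< b≤m) (sym (ind-< (≤-trans a<b (s≤s⁻¹ b≤m)))))
... | no  b≰m = ≤-trans (≤-reflexive (ind-≥ (≮⇒≥ b≰m))) z≤n

data NonEmpty {A : Set} : List A → Set where
  nonEmpty : ∀ {x xs} → NonEmpty (x ∷ xs)

at : ∀ {A : Set} → List (List A) → ℕ → List A
at []         j       = []
at (row ∷ T) zero    = row
at (row ∷ T) (suc j) = at T j

module _ {k : ℕ} where

  rank-injective : ∀ {a b : Letter k} → rank a ≡ rank b → a ≡ b
  rank-injective {unbarred i} {unbarred j} e = cong unbarred (Fin.toℕ-injective (*-cancelˡ-≡ _ _ 2 e))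
  rank-injective {unbarred i} {barred j}   e = contradiction e (even≢odd (toℕ i) (toℕ j))
  rank-injective {barred i}   {unbarred j} e = contradiction (sym e) (even≢odd (toℕ j) (toℕ i))
  rank-injective {barred i}   {barred j}   e = cong barred (Fin.toℕ-injective (*-cancelˡ-≡ _ _ 2 (suc-injective e)))

  rank< : ∀ (a : Letter k) → rank a < 2 * k
  rank< (unbarred i) = *-monoʳ-< 2 (Fin.toℕ<n i)
  rank< (barred i)   = lia 2 (λ i k → con 1 ⊕ i ≦ k ∷ [] ⊢ con 1 ⊕ (con 1 ⊕ 2 ⊛ i) ≦ 2 ⊛ k) (toℕ i) k (Fin.toℕ<n i)

  count : ℕ → Row k → ℕ
  count m []       = 0
  count m (x ∷ xs) = ind (rank x) m + count m xs

  Sorted : Row k → Set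
  Sorted = AllPairs _≤ₗ_

  count-++ : ∀ m xs ys → count m (xs ++ ys) ≡ count m xs + count m ys
  count-++ m []       ys = refl
  count-++ m (x ∷ xs) ys = trans (cong (ind (rank x) m +_) (count-++ m xs ys)) (sym (+-assoc (ind (rank x) m) _ _))

  count-none : ∀ {m xs} → All (λ x → m ≤ rank x) xs → count m xs ≡ 0
  count-none []       = refl
  count-none (h ∷ hs) = cong₂ _+_ (ind-≥ h) (count-none hs)

  count-all : ∀ {m xs} → All (λ x → rank x < m) xs → count m xs ≡ length xs
  count-all []       = refl
  count-all (h ∷ hs) = cong₂ _+_ (ind-< h) (count-all hs)

  count-top : ∀ xs → count (2 * k) xs ≡ length xs
  count-top xs = count-all (All.universal rank< xs)

  count-above : ∀ {m} → 2 * k ≤ m → ∀ xs → count m xs ≡ count (2 * k) xs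
  count-above h xs = trans (count-all (All.universal (λ a → ≤-trans (rank< a) h) xs)) (sym (count-top xs))

  count≤length : ∀ m xs → count m xs ≤ length xs
  count≤length m []       = z≤n
  count≤length m (x ∷ xs) with rank x <? m
  ... | yes h rewrite ind-< h       = s≤s (count≤length m xs)
  ... | no ¬h rewrite ind-≥ (≮⇒≥ ¬h) = m≤n⇒m≤1+n (count≤length m xs)

  count-mono : ∀ {m n} → m ≤ n → ∀ xs → count m xs ≤ count n xs
  count-mono h []       = z≤n
  count-mono h (x ∷ xs) = +-mono-≤ (ind-mono (rank x) h) (count-mono h xs)

  count≡0 : ∀ {m} xs → count m xs ≡ 0 → All (λ x → m ≤ rank x) xs
  count≡0         []       e = []
  count≡0 {m} (x ∷ xs) e with rank x <? m
  ... | yes h = contradiction (trans (cong (_+ count m xs) (sym (ind-< h))) e) λ ()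
  ... | no ¬h = ≮⇒≥ ¬h ∷ count≡0 xs (trans (cong (_+ count m xs) (sym (ind-≥ (≮⇒≥ ¬h)))) e)

  count-∈ : ∀ {b xs} → b ∈ xs → count (rank b) xs < count (1 + rank b) xs
  count-∈ {b} {x ∷ xs} (here refl) rewrite ind-≥ {rank b} ≤-refl | ind-< (n<1+n (rank b)) = s≤s (count-mono (n≤1+n _) xs)
  count-∈ {b} {x ∷ xs} (there h)   = +-mono-≤-< (ind-mono (rank x) (n≤1+n _)) (count-∈ h)

  count-∉ : ∀ {n} xs → All (λ x → rank x ≢ n) xs → count (1 + n) xs ≤ count n xs
  count-∉ [] [] = z≤n
  count-∉ {n} (x ∷ xs) (h ∷ hs) with rank x <? n
  ... | yes p rewrite ind-< p | ind-< (m<n⇒m<1+n p) = s≤s (count-∉ xs hs)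
  ... | no ¬p rewrite ind-≥ (≮⇒≥ ¬p) | ind-≥ (≤∧≢⇒< (≮⇒≥ ¬p) (≢-sym h)) = count-∉ xs hs

  Sorted-++⁺ : ∀ {xs ys : Row k} → Sorted xs → Sorted ys → All (λ x → All (x ≤ₗ_) ys) xs → Sorted (xs ++ ys)
  Sorted-++⁺ []       q []       = q
  Sorted-++⁺ (p ∷ ps) q (r ∷ rs) = All.++⁺ p r ∷ Sorted-++⁺ ps q rs

  Sorted-++⁻ : ∀ (xs : Row k) {ys} → Sorted (xs ++ ys) → Sorted xs × Sorted ys × All (λ x → All (x ≤ₗ_) ys) xs
  Sorted-++⁻ []       q       = [] , q , []
  Sorted-++⁻ (x ∷ xs) (p ∷ q) =
    let s , t , r = Sorted-++⁻ xs q in All.++⁻ˡ xs p ∷ s , t , All.++⁻ʳ xs p ∷ r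

  -- The head of a sorted row is visible as the first rank at which the count becomes positive;
  -- equal heads then cancel from all counts.
  count-lemma : ∀ {xs ys : Row k} → Sorted xs → Sorted ys → (∀ m → count m xs ≡ count m ys) → xs ≡ ys
  count-lemma {[]} {[]} _ _ e = refl
  count-lemma {[]} {y ∷ ys} _ _ e = contradiction (trans (e (1 + rank y)) (cong (_+ count (1 + rank y) ys) (ind-< (n<1+n (rank y))))) λ ()
  count-lemma {x ∷ xs} {[]} _ _ e = contradiction (trans (sym (e (1 + rank x))) (cong (_+ count (1 + rank x) xs) (ind-< (n<1+n (rank x))))) λ ()
  count-lemma {x ∷ xs} {y ∷ ys} (p ∷ ps) (q ∷ qs) e
    with rank-injective {x} {y} (≤-antisym (head≤ {x} {y} {xs} {ys} p q e) (head≤ {y} {x} {ys} {xs} q p (λ m → sym (e m))))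
    where
    head≤ : ∀ {x y xs ys} → All (x ≤ₗ_) xs → All (y ≤ₗ_) ys →
            (∀ m → count m (x ∷ xs) ≡ count m (y ∷ ys)) → x ≤ₗ y
    head≤ {x} {y} {xs} {ys} p q e with rank y <? rank x
    ... | no ¬h = ≮⇒≥ ¬h
    ... | yes h = contradiction
      (trans (sym (count-none {1 + rank y} {x ∷ xs} (h ∷ All.map (≤-trans h) p)))
        (trans (e (1 + rank y)) (cong (_+ count (1 + rank y) ys) (ind-< (n<1+n (rank y)))))) λ ()
  ... | refl = cong (x ∷_) (count-lemma ps qs (λ m → +-cancelˡ-≡ (ind (rank x) m) _ _ (e m)))

  counts : Filling k → ℕ → ℕ → ℕ
  counts T m j = count m (at T j)

  counts-injective : ∀ {T U : Filling k} → All Sorted T → All NonEmpty T → All Sorted U → All NonEmpty U →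
                     (∀ m j → counts T m j ≡ counts U m j) → T ≡ U
  counts-injective {[]} {[]} _ _ _ _ e = refl
  counts-injective {[]} {(x ∷ xs) ∷ U} _ _ _ (nonEmpty ∷ _) e =
    contradiction (trans (e (1 + rank x) 0) (cong (_+ count (1 + rank x) xs) (ind-< (n<1+n (rank x))))) λ ()
  counts-injective {(x ∷ xs) ∷ T} {[]} _ (nonEmpty ∷ _) _ _ e =
    contradiction (trans (sym (e (1 + rank x) 0)) (cong (_+ count (1 + rank x) xs) (ind-< (n<1+n (rank x))))) λ ()
  counts-injective {row ∷ T} {row′ ∷ U} (s ∷ ss) (n ∷ ns) (s′ ∷ ss′) (n′ ∷ ns′) e =
    cong₂ _∷_ (count-lemma s s′ (λ m → e m 0)) (counts-injective ss ns ss′ ns′ (λ m j → e m (suc j)))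

-- Bumping

  -- Phrased for the growth rules: the last condition excludes letters of the row strictly between
  -- the inserted and the bumped one, so the state stays `plus` at these levels.
  data Bumped (a : Letter k) (row : Row k) : Row k × Maybe (Letter k) → Set where
    stops : ∀ {row′} → Sorted row′ → (∀ m → count m row′ ≡ ind (rank a) m + count m row) →
            (∀ m → rank a < m → count (1 + m) row ≤ count m row) → Bumped a row (row′ , nothing)
    bumps : ∀ {row′ b} → a <ₗ b → b ∈ row → Sorted row′ →
            (∀ m → ind (rank b) m + count m row′ ≡ ind (rank a) m + count m row) →
            (∀ m → rank a < m → m < rank b → count (1 + m) row ≤ count m row) → Bumped a row (row′ , just b)

  bump-All : ∀ {A : Letter k → Set} {a} row → A a → All A row → All A (proj₁ (bump a row))
  bump-All []             p []       = p ∷ []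
  bump-All {a = a} (x ∷ xs) p (q ∷ qs) with rank a <? rank x
  ... | yes _ = p ∷ qs
  ... | no  _ = q ∷ bump-All xs p qs

  bump-nonEmpty : ∀ (a : Letter k) row → NonEmpty (proj₁ (bump a row))
  bump-nonEmpty a []       = nonEmpty
  bump-nonEmpty a (x ∷ xs) with rank a <? rank x
  ... | yes _ = nonEmpty
  ... | no  _ = nonEmpty

  bumped : ∀ a row → Sorted row → Bumped a row (bump a row)
  bumped a [] _ = stops ([] ∷ []) (λ m → refl) (λ m _ → z≤n)
  bumped a (x ∷ xs) (p ∷ ps) with rank a <? rank x
  ... | yes a<x = bumps a<x (here refl) (All.map (≤-trans (<⇒≤ a<x)) p ∷ ps)
      (λ m → lia 3 (λ a b c → [] ⊢ b ⊕ (a ⊕ c) ≐ a ⊕ (b ⊕ c)) (ind (rank a) m) (ind (rank x) m) (count m xs))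
      (λ m _ m<x → ≤-trans (≤-reflexive (count-none {xs = x ∷ xs} (m<x ∷ All.map (≤-trans m<x) p))) z≤n)
  ... | no a≮x with bump a xs | bumped a xs ps | bump-All {A = x ≤ₗ_} {a} xs (≮⇒≥ a≮x) p
  ...   | _ | stops s c n | q = stops (q ∷ s)
      (λ m → trans (cong (ind (rank x) m +_) (c m))
        (lia 3 (λ a b c → [] ⊢ b ⊕ (a ⊕ c) ≐ a ⊕ (b ⊕ c)) (ind (rank a) m) (ind (rank x) m) (count m xs)))
      (λ m a<m → +-mono-≤ (≤-reflexive (trans (ind-< (s≤s (<⇒≤ (≤-<-trans (≮⇒≥ a≮x) a<m)))) (sym (ind-< (≤-<-trans (≮⇒≥ a≮x) a<m)))))
                          (n m a<m))
  ...   | _ | bumps {row′} {b} a<b b∈ s c n | q = bumps a<b (there b∈) (q ∷ s)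
      (λ m → lia 5 (λ a b x u v → b ⊕ u ≐ a ⊕ v ∷ [] ⊢ b ⊕ (x ⊕ u) ≐ a ⊕ (x ⊕ v))
        (ind (rank a) m) (ind (rank b) m) (ind (rank x) m) (count m row′) (count m xs) (c m))
      (λ m a<m m<b → +-mono-≤ (≤-reflexive (trans (ind-< (s≤s (<⇒≤ (≤-<-trans (≮⇒≥ a≮x) a<m)))) (sym (ind-< (≤-<-trans (≮⇒≥ a≮x) a<m)))))
                          (n m a<m m<b))

-- Jeu de taquin in one row

  -- Unlike in Below, the lower row may be longer than the upper one.
  data Over : Row k → Row k → Set where
    left-end  : ∀ {ys} → Over [] ys
    right-end : ∀ {xs} → Over xs []
    _∷_       : ∀ {x y xs ys} → x <ₗ y → Over xs ys → Over (x ∷ xs) (y ∷ ys)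

  over-snoc : ∀ {xs ys x} → Over xs ys → All (x <ₗ_) (drop (length xs) ys) → Over (xs ++ [ x ]) ys
  over-snoc {ys = []}     left-end _       = right-end
  over-snoc {ys = y ∷ ys} left-end (h ∷ _) = h ∷ left-end
  over-snoc right-end _ = right-end
  over-snoc (p ∷ o)   h = p ∷ over-snoc o h

  over-prefix : ∀ {xs} zs {ys} → Over (xs ++ zs) ys → Over xs ys
  over-prefix {[]}     zs o         = left-end
  over-prefix {x ∷ xs} zs right-end = right-end
  over-prefix {x ∷ xs} zs (p ∷ o)   = p ∷ over-prefix zs o

  over-count : ∀ {xs ys} → Over xs ys → ∀ m → count (1 + m) (take (length xs) ys) ≤ count m xs
  over-count left-end          m = z≤n
  over-count (right-end {[]})  m = z≤n
  over-count (right-end {_ ∷ _}) m = z≤n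
  over-count (p ∷ o)           m = +-mono-≤ (ind-shift m p) (over-count o m)

  over-drop : ∀ {xs ys} → Over xs ys → Sorted ys → All (λ x → All (x <ₗ_) (drop (length xs) ys)) xs
  over-drop left-end  s = []
  over-drop (right-end {[]}) s = []
  over-drop (right-end {x ∷ xs}) s = [] ∷ All.universal (λ _ → []) xs
  over-drop {x ∷ xs} {y ∷ ys} (p ∷ o) (s ∷ ss) = All.map (<-≤-trans p) (All.drop⁺ (length xs) s) ∷ over-drop o ss

  -- `row` omits the hole, and `h` is the rank of the letter lost from it. The inequalities place
  -- the fall at level `rank b`: the hole stays at all lower levels and must leave at this one.
  data Slid (row below : Row k) (h : ℕ) : Row k × Maybe (Row k × Row k) → Set where
    stops : (∀ m → count (1 + m) below ≤ count m row) → Slid row below h (row , nothing)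
    falls : ∀ {row′ l r b} → below ≡ l ++ b ∷ r → Sorted row′ → NonEmpty row′ →
            (∀ m → count m row′ ≡ ind (rank b) m + count m row) → h < rank b →
            (∀ m → m < rank b → count (1 + m) below ≤ count m row) →
            1 + count (rank b) row ≤ count (1 + rank b) below →
            Slid row below h (row′ , just (l , r))

  drop-shift : ∀ n (ys : Row k) {z zs} → drop n ys ≡ z ∷ zs → drop (suc n) ys ≡ zs
  drop-shift zero    (y ∷ ys) refl = refl
  drop-shift (suc n) (y ∷ ys) e    = drop-shift n ys e

  drop-shift-[] : ∀ n (ys : Row k) → drop n ys ≡ [] → drop (suc n) ys ≡ []
  drop-shift-[] zero    []       refl = refl
  drop-shift-[] (suc n) []       e    = refl
  drop-shift-[] (suc n) (y ∷ ys) e    = drop-shift-[] n ys e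

  length-snoc : ∀ (xs : Row k) x → length (xs ++ [ x ]) ≡ suc (length xs)
  length-snoc xs x = trans (length-++ xs) (+-comm (length xs) 1)

  slid-stop : ∀ {left} right {below} → Over left below → drop (length left) below ≡ [] →
              ∀ m → count (1 + m) below ≤ count m (left ++ right)
  slid-stop {left} right {below} o e m = begin
    count (1 + m) below                                           ≡⟨ cong (count (1 + m)) (take++drop≡id (length left) below) ⟨
    count (1 + m) (take (length left) below ++ drop (length left) below) ≡⟨ cong (λ z → count (1 + m) (take (length left) below ++ z)) e ⟩
    count (1 + m) (take (length left) below ++ [])                ≡⟨ cong (count (1 + m)) (++-identityʳ (take (length left) below)) ⟩
    count (1 + m) (take (length left) below)                      ≤⟨ over-count o m ⟩
    count m left                                                  ≤⟨ m≤m+n _ _ ⟩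
    count m left + count m right                                  ≡⟨ count-++ m left right ⟨
    count m (left ++ right)                                       ∎
    where open ≤-Reasoning

  -- At level `1 + rank b` the lower row counts `b` and the `length left` entries in front of it,
  -- while at level `rank b` the upper row counts nothing of `right`. Hence the hole falls precisely
  -- at level `rank b`.
  slid-fall : ∀ left right {below h b bs} → Sorted (left ++ right) → Sorted below → Over left below →
              All (λ y → h < rank y) (drop (length left) below) → drop (length left) below ≡ b ∷ bs →
              All (b ≤ₗ_) right → Slid (left ++ right) below h (left ++ b ∷ right , just (take (length left) below , bs))
  slid-fall left right {below} {h} {b} {bs} s s′ o hs e b≤ =
    falls split (Sorted-++⁺ sl (b≤ ∷ sr) (All.zipWith (λ (p , q) → <⇒≤ p ∷ q) (left<b , slr)))
      (nonEmpty-++ left)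
      (λ m → trans (count-++ m left (b ∷ right)) (trans
         (lia 3 (λ a b c → [] ⊢ a ⊕ (b ⊕ c) ≐ b ⊕ (a ⊕ c)) (count m left) (ind (rank b) m) (count m right))
         (cong (ind (rank b) m +_) (sym (count-++ m left right)))))
      (All.head (subst (All (λ y → h < rank y)) e hs))
      (λ m m<b → begin
        count (1 + m) below                        ≡⟨ cong (count (1 + m)) split ⟩
        count (1 + m) (l ++ b ∷ bs)                ≡⟨ count-++ (1 + m) l (b ∷ bs) ⟩
        count (1 + m) l + count (1 + m) (b ∷ bs)   ≡⟨ cong (count (1 + m) l +_) (count-none {xs = b ∷ bs} (m<b ∷ All.map (≤-trans m<b) b≤bs)) ⟩
        count (1 + m) l + 0                        ≡⟨ +-identityʳ _ ⟩
        count (1 + m) l                            ≤⟨ over-count o m ⟩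
        count m left                               ≤⟨ m≤m+n _ _ ⟩
        count m left + count m right               ≡⟨ count-++ m left right ⟨
        count m (left ++ right)                    ∎)
      (begin
        1 + count (rank b) (left ++ right)                   ≡⟨ cong suc (count-++ (rank b) left right) ⟩
        1 + (count (rank b) left + count (rank b) right)     ≡⟨ cong (λ n → 1 + (count (rank b) left + n)) (count-none b≤) ⟩
        1 + (count (rank b) left + 0)                        ≡⟨ cong suc (+-identityʳ _) ⟩
        1 + count (rank b) left                              ≤⟨ s≤s (count≤length (rank b) left) ⟩
        1 + length left                                      ≡⟨ cong suc length-l ⟨
        1 + length l                                         ≡⟨ cong suc (count-all (All.map (λ p → s≤s (All.head p)) l≤)) ⟨
        1 + count (1 + rank b) l                             ≡⟨ +-comm 1 _ ⟩
        count (1 + rank b) l + 1                             ≡⟨ cong (count (1 + rank b) l +_) (ind-< (n<1+n (rank b))) ⟨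
        count (1 + rank b) l + ind (rank b) (1 + rank b)     ≤⟨ +-monoʳ-≤ (count (1 + rank b) l) (m≤m+n _ _) ⟩
        count (1 + rank b) l + count (1 + rank b) (b ∷ bs)   ≡⟨ count-++ (1 + rank b) l (b ∷ bs) ⟨
        count (1 + rank b) (l ++ b ∷ bs)                     ≡⟨ cong (count (1 + rank b)) split ⟨
        count (1 + rank b) below                             ∎)
    where
    open ≤-Reasoning
    l = take (length left) below
    split : below ≡ l ++ b ∷ bs
    split = trans (sym (take++drop≡id (length left) below)) (cong (l ++_) e)
    sl = proj₁ (Sorted-++⁻ left s)
    sr = proj₁ (proj₂ (Sorted-++⁻ left s))
    slr = proj₂ (proj₂ (Sorted-++⁻ left s))
    parts = Sorted-++⁻ l (subst Sorted split s′)
    l≤ = proj₂ (proj₂ parts)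
    b≤bs : All (b ≤ₗ_) bs
    b≤bs with proj₁ (proj₂ parts)
    ... | p ∷ _ = p
    left<b : All (_<ₗ b) left
    left<b = All.map (λ {x} p → All.head (subst (All (x <ₗ_)) e p)) (over-drop o s′)
    length-take : ∀ xs {ys : Row k} → drop (length xs) ys ≡ b ∷ bs → length (take (length xs) ys) ≡ length {A = Letter k} xs
    length-take []       e = refl
    length-take (x ∷ xs) {y ∷ ys} e = cong suc (length-take xs e)
    length-l : length l ≡ length left
    length-l = length-take left e
    nonEmpty-++ : ∀ (xs : Row k) {y ys} → NonEmpty (xs ++ y ∷ ys)
    nonEmpty-++ []      = nonEmpty
    nonEmpty-++ (_ ∷ _) = nonEmpty

  slid : ∀ left right {below h} → Sorted (left ++ right) → Sorted below → Over left below →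
         All (λ y → h < rank y) (drop (length left) below) → Slid (left ++ right) below h (slideRow left right below)
  slid left [] {below} {h} s s′ o hs with drop (length left) below in e
  ... | []     = subst (λ z → Slid (left ++ []) below h (z , nothing)) (++-identityʳ left) (stops (slid-stop [] o e))
  ... | b ∷ bs = slid-fall left [] s s′ o (subst (All _) (sym e) hs) e []
  slid left (x ∷ right) {below} {h} s s′ o hs with drop (length left) below in e
  ... | [] = subst (λ z → Slid z below h (slideRow (left ++ [ x ]) right below)) (++-assoc left [ x ] right)
      (slid (left ++ [ x ]) right (subst Sorted (sym (++-assoc left [ x ] right)) s) s′
        (over-snoc o (subst (All _) (sym e) []))
        (subst (All _) (sym (trans (cong (λ n → drop n below) (length-snoc left x)) (drop-shift-[] (length left) below e))) []))
  ... | b ∷ bs with rank b ≤? rank x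
  ...   | yes b≤x = slid-fall left (x ∷ right) s s′ o (subst (All _) (sym e) hs) e (b≤x ∷ All.map (≤-trans b≤x) x≤)
    where
    x≤ : All (x ≤ₗ_) right
    x≤ with proj₁ (proj₂ (Sorted-++⁻ left s))
    ... | p ∷ _ = p
  ...   | no b≰x = subst (λ z → Slid z below h (slideRow (left ++ [ x ]) right below)) (++-assoc left [ x ] right)
      (slid (left ++ [ x ]) right (subst Sorted (sym (++-assoc left [ x ] right)) s) s′
        (over-snoc o (subst (All _) (sym e) (≰⇒> b≰x ∷ All.map (<-≤-trans (≰⇒> b≰x)) b≤bs)))
        (subst (All _) (sym (trans (cong (λ n → drop n below) (length-snoc left x)) (drop-shift (length left) below e))) (All.tail hs)))
    where
    b≤bs : All (b ≤ₗ_) bs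
    b≤bs with proj₁ (proj₂ (Sorted-++⁻ (take (length left) below)
                (subst Sorted (trans (sym (take++drop≡id (length left) below)) (cong (take (length left) below ++_) e)) s′)))
    ... | p ∷ _ = p

-- Gluing runs across levels and rows

splice : ℕ → State → (ℕ → State) → ℕ → State
splice n s ρ m with m ≤? n
... | yes _ = s
... | no  _ = ρ m

splice-elim : ∀ (A : ℕ → State → Set) {n s ρ} → (∀ m → m ≤ n → A m s) → (∀ m → n < m → A m (ρ m)) →
              ∀ m → A m (splice n s ρ m)
splice-elim A {n} f g m with m ≤? n
... | yes p = f m p
... | no ¬p = g m (≰⇒> ¬p)

splice-≤ : ∀ {n s ρ m} → m ≤ n → splice n s ρ m ≡ s
splice-≤ {n} {m = m} h with m ≤? n
... | yes _ = refl
... | no ¬h = contradiction h ¬h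

splice-> : ∀ {n s ρ m} → n < m → splice n s ρ m ≡ ρ m
splice-> {n} {m = m} h with m ≤? n
... | yes p = contradiction h (≤⇒≯ p)
... | no _  = refl

-- The bound `lo` permits nested splices, where the inner one provides steps only above the level at
-- which it takes over.
splice-steps : ∀ {o P} lo {n s ρ} → (∀ m → lo ≤ m → m < n → Step o P m s s) → Step o P n s (ρ (1 + n)) →
               (∀ m → n < m → Step o P m (ρ m) (ρ (1 + m))) →
               ∀ m → lo ≤ m → Step o P m (splice n s ρ m) (splice n s ρ (1 + m))
splice-steps lo {n} f g h m lo≤m with m ≤? n | suc m ≤? n
... | yes p | yes q = f m lo≤m q
... | no ¬p | yes q = contradiction (<⇒≤ q) ¬p
... | no ¬p | no  _ = h m (≰⇒> ¬p)
... | yes p | no ¬q with ≤-antisym p (s≤s⁻¹ (≰⇒> ¬q))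
...   | refl = g

shift : State → State
shift (none x)  = none x
shift (plus r)  = plus (suc r)
shift (pend r)  = pend (suc r)
shift (minus r) = minus (suc r)

-- In the run of the lower rows `none` means that nothing has arrived from above yet, while in the
-- whole tableau the change may already be in the first row. So only active states may be shifted.
Active : State → Set
Active s = ∀ x → s ≢ none x

shift-active : ∀ {s} → Active s → Active (shift s)
shift-active {none x} h _ _ = h x refl

shift-enter : ∀ {o P m r s} → Enter (suc o) (λ m j → P m (suc j)) m r s → Enter o P m (suc r) (shift s)
shift-enter {o} {m = m} {r} (to-plus h f) =
  to-plus (subst (λ n → 2 * n ≤ m) (sym (+-suc o r)) h) (λ e → f (trans e (cong (2 *_) (+-suc o r))))
shift-enter {o} {r = r} (to-pend e h) = to-pend (trans e (cong (2 *_) (sym (+-suc o r)))) h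

shift-step : ∀ {o P m s t} → Active s → Step (suc o) (λ m j → P m (suc j)) m s t → Step o P m (shift s) (shift t)
shift-step a (wait _)   = contradiction refl (a _)
shift-step a (enter _)  = contradiction refl (a _)
shift-step a (stay⁺ h)  = stay⁺ h
shift-step a (bump⁺ h e) = bump⁺ h (shift-enter e)
shift-step {o} a (cancel⁻ {r} e h) = cancel⁻ (trans e (cong (λ n → 1 + 2 * n) (sym (+-suc o r)))) h
shift-step a (stay⁻ h)  = stay⁻ h
shift-step a (fall⁻ h)  = fall⁻ h

shift-change : ∀ s {p q : ℕ → ℕ} → q 0 ≡ p 0 → Change s (λ j → p (suc j)) (λ j → q (suc j)) → Change (shift s) p q
shift-change (none x)  e c zero    = cong (_+ 0) e
shift-change (plus r)  e c zero    = cong (_+ 0) e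
shift-change (pend r)  e c zero    = cong (_+ 0) e
shift-change (minus r) e c zero    = cong (_+ 0) e
shift-change (none x)  e c (suc j) = c j
shift-change (plus r)  e c (suc j) = c j
shift-change (pend r)  e c (suc j) = c j
shift-change (minus r) e c (suc j) = c j

Change-resp : ∀ {s} {p p′ q : ℕ → ℕ} → (∀ j → p j ≡ p′ j) → Change s p q → Change s p′ q
Change-resp {s} e c j = trans (c j) (cong (_+ inc s j) (e j))

-- Jeu de taquin as a run

module _ {k : ℕ} where

  counts⇒Below : ∀ {upper lower : Row k} → Sorted upper → Sorted lower →
                 (∀ m → count (1 + m) lower ≤ count m upper) → Below upper lower
  counts⇒Below {lower = []} _ _ _ = []
  counts⇒Below {[]} {y ∷ ys} _ _ h =
    contradiction (≤-trans (≤-reflexive (cong (_+ count (1 + rank y) ys) (sym (ind-< (n<1+n (rank y)))))) (h (rank y))) n≮0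
  counts⇒Below {x ∷ xs} {y ∷ ys} (p ∷ ps) (q ∷ qs) h = x<y ∷ counts⇒Below ps qs rest
    where
    x<y : x <ₗ y
    x<y with rank x <? rank y
    ... | yes x<y = x<y
    ... | no x≮y = contradiction (≤-trans (≤-reflexive (cong (_+ count (1 + rank y) ys) (sym (ind-< (n<1+n (rank y))))))
        (≤-trans (h (rank y)) (≤-reflexive (count-none {xs = x ∷ xs} (≮⇒≥ x≮y ∷ All.map (≤-trans (≮⇒≥ x≮y)) p))))) n≮0
    rest : ∀ m → count (1 + m) ys ≤ count m xs
    rest m with m <? rank y
    ... | yes m<y = ≤-trans (≤-reflexive (count-none (All.map (≤-trans m<y) q))) z≤n
    ... | no m≮y = s≤s⁻¹ (subst₂ _≤_ (cong (_+ count (1 + m) ys) (ind-< (s≤s (≮⇒≥ m≮y))))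
                                     (cong (_+ count m xs) (ind-< (≤-trans x<y (≮⇒≥ m≮y)))) (h m))

  Below⇒counts : ∀ {upper lower : Row k} → Below upper lower → ∀ m → count (1 + m) lower ≤ count m upper
  Below⇒counts {lower = []} b m = z≤n
  Below⇒counts {x ∷ xs} {y ∷ ys} (p ∷ b) m = +-mono-≤ (ind-shift m p) (Below⇒counts b m)

  Below⇒Over : ∀ {upper lower : Row k} → Below upper lower → Over upper lower
  Below⇒Over {lower = []} b = right-end
  Below⇒Over {x ∷ xs} {y ∷ ys} (p ∷ b) = p ∷ Below⇒Over b

  over-at : ∀ l {b r} {ys : Row k} → Over (l ++ b ∷ r) ys → Sorted ys → All (b <ₗ_) (drop (length l) ys)
  over-at []      right-end s       = []
  over-at []      (p ∷ o)   (q ∷ _) = p ∷ All.map (<-≤-trans p) q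
  over-at (x ∷ l) right-end s       = []
  over-at (x ∷ l) (_ ∷ o)   (_ ∷ s) = over-at l o s

  Sorted-at : ∀ {T : Filling k} → All Sorted T → ∀ j → Sorted (at T j)
  Sorted-at []       j       = []
  Sorted-at (s ∷ ss) zero    = s
  Sorted-at (s ∷ ss) (suc j) = Sorted-at ss j

  Interlacing : Filling k → Set
  Interlacing T = ∀ m j → counts T (1 + m) (1 + j) ≤ counts T m j

  -- The growth of a tableau whose first row has lost a letter of rank h.
  record Slides (o h : ℕ) (P : Pattern) (T′ : Filling k) : Set where
    field
      σ        : ℕ → State
      below    : ∀ m → m ≤ h → σ m ≡ none h
      first    : σ (1 + h) ≡ minus 0
      active   : ∀ m → h < m → Active (σ m)
      -- The step from level `h` to `1 + h` is left to the surrounding run, where it is a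
      -- cancellation or a hole falling from the row above.
      steps    : ∀ m → h < m → Step o P m (σ m) (σ (1 + m))
      change   : ∀ m → Change (σ m) (P m) (counts T′ m)
      sorted   : All Sorted T′
      non-empty : All NonEmpty T′

  -- Dropping an emptied row shifts nothing, since by interlacing an empty row has no row beneath
  -- it.
  at-∷⁺ : ∀ row (T : Filling k) → All NonEmpty T → (∀ m → count (1 + m) (at T 0) ≤ count m row) →
          ∀ j → at (row ∷⁺ T) j ≡ at (row ∷ T) j
  at-∷⁺ (x ∷ row) T            _              h j       = refl
  at-∷⁺ []        []           _              h zero    = refl
  at-∷⁺ []        []           _              h (suc j) = refl
  at-∷⁺ []        ((y ∷ ys) ∷ T) (nonEmpty ∷ _) h j =
    contradiction (≤-trans (≤-reflexive (cong (_+ count (1 + rank y) ys) (sym (ind-< (n<1+n (rank y)))))) (h (rank y))) n≮0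

  All-∷⁺ : ∀ {A : Row k → Set} row {T} → A row → All A T → All A (row ∷⁺ T)
  All-∷⁺ []      p ps = ps
  All-∷⁺ (_ ∷ _) p ps = p ∷ ps

  All-NonEmpty-∷⁺ : ∀ row {T : Filling k} → All NonEmpty T → All NonEmpty (row ∷⁺ T)
  All-NonEmpty-∷⁺ []      ps = ps
  All-NonEmpty-∷⁺ (_ ∷ _) ps = nonEmpty ∷ ps

  slide-stops : ∀ {o h P} row {T : Filling k} → (∀ m → P m 0 ≡ ind h m + count m row) →
                (∀ m j → P m (1 + j) ≡ counts T m j) → Sorted row → All Sorted T → All NonEmpty T →
                (∀ m → count (1 + m) (at T 0) ≤ count m row) → Slides o h P (row ∷⁺ T)
  slide-stops {o} {h} {P} row {T} p₀ p₁ s ss ns c = record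
    { σ = splice h (none h) (λ _ → minus 0)
    ; below = λ m → splice-≤
    ; first = splice-> (n<1+n h)
    ; active = λ m h<m x e → contradiction (trans (sym (splice-> h<m)) e) (λ ())
    ; steps = λ m h<m → subst₂ (Step o P m) (sym (splice-> h<m)) (sym (splice-> (m<n⇒m<1+n h<m)))
        (stay⁻ (subst₂ _<_ (sym (p₁ (1 + m) 0)) (sym (trans (p₀ m) (cong (_+ count m row) (ind-< h<m)))) (s≤s (c m))))
    ; change = λ m j → splice-elim (λ m s → counts (row ∷⁺ T) m j + dec s j ≡ P m j + inc s j)
        (λ m m≤h → cong (_+ 0) (trans (cong (count m) (at-∷⁺ row T ns c j)) (unchanged m m≤h j)))
        (λ m h<m → trans (cong (λ z → count m z + δ 0 j) (at-∷⁺ row T ns c j)) (changed m h<m j))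
        m
    ; sorted = All-∷⁺ row s ss
    ; non-empty = All-NonEmpty-∷⁺ row ns
    }
    where
    unchanged : ∀ m → m ≤ h → ∀ j → counts (row ∷ T) m j ≡ P m j
    unchanged m m≤h zero    = sym (trans (p₀ m) (cong (_+ count m row) (ind-≥ m≤h)))
    unchanged m m≤h (suc j) = sym (p₁ m j)
    changed : ∀ m → h < m → ∀ j → counts (row ∷ T) m j + δ 0 j ≡ P m j + 0
    changed m h<m zero    = trans (+-comm _ 1) (sym (trans (+-identityʳ _) (trans (p₀ m) (cong (_+ count m row) (ind-< h<m)))))
    changed m h<m (suc j) = cong (_+ 0) (sym (p₁ m j))

  -- When `b` moves up it replaces the lost letter, so from level `1 + rank b` on the first row
  -- counts as before. The next row has lost `b`, which is the same situation one row down with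
  -- `rank b` for `h`.
  slides : ∀ o h P left right (T : Filling k) → (∀ m → P m 0 ≡ ind h m + count m (left ++ right)) →
           (∀ m j → P m (1 + j) ≡ counts T m j) → Sorted (left ++ right) → Over left (at T 0) →
           All (λ y → h < rank y) (drop (length left) (at T 0)) →
           All Sorted T → All NonEmpty T → Interlacing T → Slides o h P (slide left right T)
  slides o h P left right [] p₀ p₁ s ov hs ss ns il
    with slideRow left right [] | slid left right s [] ov hs
  ... | _ | stops c = slide-stops (left ++ right) p₀ p₁ s ss ns c
  ... | _ | falls {l = []} () _ _ _ _ _ _
  ... | _ | falls {l = _ ∷ _} () _ _ _ _ _ _
  slides o h P left right (row ∷ T) p₀ p₁ s ov hs (s′ ∷ ss) (n′ ∷ ns) il
    with slideRow left right row | slid left right s s′ ov hs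
  ... | _ | stops c = slide-stops (left ++ right) p₀ p₁ s (s′ ∷ ss) (n′ ∷ ns) c
  ... | row′ , _ | falls {l = l} {r} {b} refl s″ n″ c h<b stay go = record
    { σ = σ
    ; below = λ m → splice-≤
    ; first = trans (splice-> (n<1+n h)) (splice-≤ h<b)
    ; active = λ m h<m → subst Active (sym (splice-> h<m))
        (splice-elim (λ m s → Active s) (λ _ _ _ ()) (λ m b<m → shift-active (S.active m b<m)) m)
    ; steps = λ m h<m → subst₂ (Step o P m) (sym (splice-> h<m)) (sym (splice-> (m<n⇒m<1+n h<m)))
        (splice-steps (1 + h)
          (λ m h<m m<b → stay⁻ (subst₂ _<_ (sym (p₁ (1 + m) 0)) (sym (trans (p₀ m) (cong (_+ count m (left ++ right)) (ind-< h<m))))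
                                 (s≤s (stay m m<b))))
          (subst (Step o P (rank b) (minus 0)) (cong shift (sym S.first))
            (fall⁻ (subst₂ _≤_ (sym (trans (p₀ (rank b)) (cong (_+ count (rank b) (left ++ right)) (ind-< h<b))))
                              (sym (p₁ (1 + rank b) 0)) go)))
          (λ m b<m → shift-step (S.active m b<m) (S.steps m b<m))
          m h<m)
    ; change = splice-elim (λ m s → Change s (P m) (counts (row′ ∷ T′) m))
        (λ m m≤h j → cong (_+ 0) (unchanged m m≤h j))
        (λ m h<m → splice-elim (λ m s → h < m → Change s (P m) (counts (row′ ∷ T′) m))
          (λ m m≤b h<m → changed m h<m m≤b)
          (λ m b<m h<m → shift-change (S.σ m) (fallen m h<m b<m) (S.change m)) m h<m)
    ; sorted = s″ ∷ S.sorted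
    ; non-empty = n″ ∷ S.non-empty
    }
    where
    T′ = slide l r T
    parts = Sorted-++⁻ l s′
    sorted-lr : Sorted (l ++ r)
    sorted-lr with proj₁ (proj₂ parts)
    ... | _ ∷ sr = Sorted-++⁺ (proj₁ parts) sr (All.map All.tail (proj₂ (proj₂ parts)))
    over : Over (l ++ b ∷ r) (at T 0)
    over = Below⇒Over (counts⇒Below s′ (Sorted-at ss 0) (λ m → il m 0))
    S : Slides (suc o) (rank b) (λ m j → P m (suc j)) T′
    S = slides (suc o) (rank b) (λ m j → P m (suc j)) l r T
      (λ m → trans (p₁ m 0) (trans (count-++ m l (b ∷ r)) (trans
        (lia 3 (λ a b c → [] ⊢ a ⊕ (b ⊕ c) ≐ b ⊕ (a ⊕ c)) (count m l) (ind (rank b) m) (count m r))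
        (cong (ind (rank b) m +_) (sym (count-++ m l r))))))
      (λ m j → p₁ m (suc j)) sorted-lr (over-prefix (b ∷ r) over) (over-at l over (Sorted-at ss 0)) ss ns
      (λ m j → il m (suc j))
    module S = Slides S
    σ = splice h (none h) (splice (rank b) (minus 0) (λ m → shift (S.σ m)))
    rest : ∀ m j → m ≤ rank b → counts T′ m j ≡ P m (suc j)
    rest m j m≤b = trans (sym (+-identityʳ _)) (trans
      (subst (λ s → Change s (λ j → P m (suc j)) (counts T′ m)) (S.below m m≤b) (S.change m) j) (+-identityʳ _))
    unchanged : ∀ m → m ≤ h → ∀ j → counts (row′ ∷ T′) m j ≡ P m j
    unchanged m m≤h zero = trans (c m) (trans (cong (_+ count m (left ++ right)) (trans (ind-≥ (≤-trans m≤h (<⇒≤ h<b))) (sym (ind-≥ m≤h)))) (sym (p₀ m)))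
    unchanged m m≤h (suc j) = rest m j (≤-trans m≤h (<⇒≤ h<b))
    changed : ∀ m → h < m → m ≤ rank b → Change (minus 0) (P m) (counts (row′ ∷ T′) m)
    changed m h<m m≤b zero = trans (cong (_+ 1) (trans (c m) (cong (_+ count m (left ++ right)) (ind-≥ m≤b))))
      (trans (+-comm _ 1) (sym (trans (+-identityʳ _) (trans (p₀ m) (cong (_+ count m (left ++ right)) (ind-< h<m))))))
    changed m h<m m≤b (suc j) = cong (_+ 0) (rest m j m≤b)
    fallen : ∀ m → h < m → rank b < m → count m row′ ≡ P m 0
    fallen m h<m b<m = trans (c m) (trans (cong (_+ count m (left ++ right)) (trans (ind-< b<m) (sym (ind-< h<m)))) (sym (p₀ m)))

-- Berele insertion as a run

module _ {k : ℕ} where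

  replaceFirst-spec : ∀ (i : Fin k) row → Sorted row → All (λ x → 2 * toℕ i ≤ rank x) row → barred i ∈ row →
    let row′ = replaceFirst (barred i) (unbarred i) row in
    Sorted row′ × All (λ x → 2 * toℕ i ≤ rank x) row′ ×
    (∀ m → ind (1 + 2 * toℕ i) m + count m row′ ≡ ind (2 * toℕ i) m + count m row)
  replaceFirst-spec i (x ∷ xs) (p ∷ ps) (q ∷ qs) b∈ with x ≟ₗ barred i
  ... | yes refl = (qs ∷ ps) , (≤-refl ∷ qs) ,
      λ m → lia 3 (λ a b c → [] ⊢ b ⊕ (a ⊕ c) ≐ a ⊕ (b ⊕ c)) (ind (2 * toℕ i) m) (ind (1 + 2 * toℕ i) m) (count m xs)
  replaceFirst-spec i (x ∷ xs) (p ∷ ps) (q ∷ qs) (here refl) | no x≢ = contradiction refl x≢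
  replaceFirst-spec i (x ∷ xs) (p ∷ ps) (q ∷ qs) (there b∈)  | no x≢ =
    let s , l , c = replaceFirst-spec i xs ps qs b∈
        x≤ = s≤s⁻¹ (≤∧≢⇒< (All.lookup p b∈) (λ e → x≢ (rank-injective e)))
    in All.map (≤-trans x≤) l ∷ s , q ∷ l ,
       λ m → lia 5 (λ a b x u v → b ⊕ u ≐ a ⊕ v ∷ [] ⊢ b ⊕ (x ⊕ u) ≐ a ⊕ (x ⊕ v))
        (ind (2 * toℕ i) m) (ind (1 + 2 * toℕ i) m) (ind (rank x) m)
        (count m (replaceFirst (barred i) (unbarred i) xs)) (count m xs) (c m)

  -- The first box of row i becomes empty, because row i starts with an i after the replacement.
  cancel-spec : ∀ (i : Fin k) row T → Sorted row → All (λ x → 2 * toℕ i ≤ rank x) row → barred i ∈ row →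
    ∃[ right ] cancel i row T ≡ slide [] right T × Sorted right ×
      (∀ m → ind (1 + 2 * toℕ i) m + count m right ≡ count m row)
  cancel-spec i (x ∷ xs) T (p ∷ ps) (q ∷ qs) b∈ with x ≟ₗ barred i
  cancel-spec i (x ∷ xs) T (p ∷ ps) (q ∷ qs) b∈ | yes refl with i Fin.≟ i
  ... | yes _ = xs , refl , ps , λ m → refl
  ... | no ≢i = contradiction refl ≢i
  cancel-spec i (x ∷ xs) T (p ∷ ps) (q ∷ qs) (here refl) | no x≢ = contradiction refl x≢
  cancel-spec i (x ∷ xs) T (p ∷ ps) (q ∷ qs) (there b∈)  | no x≢
    with rank-injective {a = x} {unbarred i} (≤-antisym (s≤s⁻¹ (≤∧≢⇒< (All.lookup p b∈) (λ e → x≢ (rank-injective e)))) q)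
  ... | refl with i Fin.≟ i
  ...   | yes _ = let s , _ , c = replaceFirst-spec i xs ps qs b∈ in
                  replaceFirst (barred i) (unbarred i) xs , refl , s , c
  ...   | no ≢i = contradiction refl ≢i

  record Inserts (o a : ℕ) (P : Pattern) (T′ : Filling k) : Set where
    field
      σ        : ℕ → State
      below    : ∀ m → m ≤ a → σ m ≡ none a
      active   : ∀ m → a < m → Active (σ m)
      steps    : ∀ m → Step o P m (σ m) (σ (1 + m))
      change   : ∀ m → Change (σ m) (P m) (counts T′ m)
      sorted   : All Sorted T′
      non-empty : All NonEmpty T′

  entered : ∀ {o a P s} → Step o P a (none a) s → Active s → Enter o P a 0 s
  entered (wait h)  _ = contradiction h (<-irrefl refl)
  entered (enter e) _ = e

  Valid-tail : ∀ {o} {row : Row k} {T} → Valid o (counts (row ∷ T)) → Valid (suc o) (counts T)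
  Valid-tail {o} v = record
    { mono  = λ m j → Valid.mono v m (suc j)
    ; inter = λ m j → Valid.inter v m (suc j)
    ; king  = λ m j h → Valid.king v m (suc j) (subst (λ n → m ≤ 2 * n) (sym (+-suc o j)) h)
    }

  no-barred : ∀ {o} {a : Letter k} {row} → rank a ≡ 2 * o → ¬ Cancels o a row → count (2 + rank a) row ≤ count (1 + rank a) row
  no-barred {o} {unbarred i} {row} e ¬c = count-∉ row (All.tabulate λ {x} x∈ e′ →
    ¬c (i , refl , *-cancelˡ-≡ _ _ 2 e , subst (_∈ row) (rank-injective {b = barred i} e′) x∈))
  no-barred {o} {barred i} e ¬c = contradiction (sym e) (even≢odd o (toℕ i))

  -- The only bumped letter too small for the next row would be the barred letter of index `o`,
  -- bumped by its unbarred companion, and this is exactly the exceptional case.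
  bumped-bound : ∀ {o} {a b : Letter k} {row} → 2 * o ≤ rank a → a <ₗ b → b ∈ row → ¬ Cancels o a row → 2 * suc o ≤ rank b
  bumped-bound {o} {a} {b} {row} o≤a a<b b∈ ¬c with 2 * suc o ≤? rank b
  ... | yes h = h
  ... | no ¬h = contradiction (cancels a a≡ b≡) ¬c
    where
    b≤ : rank b ≤ 1 + 2 * o
    b≤ = s≤s⁻¹ (subst (rank b <_) (*-suc 2 o) (≰⇒> ¬h))
    a≡ : rank a ≡ 2 * o
    a≡ = ≤-antisym (s≤s⁻¹ (≤-trans a<b b≤)) o≤a
    b≡ : rank b ≡ 1 + rank a
    b≡ = ≤-antisym (≤-trans b≤ (s≤s o≤a)) a<b
    cancels : ∀ a → rank a ≡ 2 * o → rank b ≡ 1 + rank a → Cancels o a row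
    cancels (unbarred i) e e′ = i , refl , *-cancelˡ-≡ _ _ 2 e , subst (_∈ row) (rank-injective {b = barred i} e′) b∈
    cancels (barred i)   e e′ = contradiction (sym e) (even≢odd o (toℕ i))

  private
    2*o+0 : ∀ o → 2 * (o + 0) ≡ 2 * o
    2*o+0 o = cong (2 *_) (+-identityʳ o)

  inserts-stop : ∀ o (a : Letter k) {P} row′ T → (∀ m → count m row′ ≡ ind (rank a) m + P m 0) →
    (∀ m j → counts T m j ≡ P m (1 + j)) → (∀ m → rank a < m → P (1 + m) 0 ≤ P m 0) →
    2 * o ≤ rank a → All Sorted (row′ ∷ T) → All NonEmpty (row′ ∷ T) → Inserts o (rank a) P (row′ ∷ T)
  inserts-stop o a {P} row′ T p₀ p₁ stay o≤a ss ns = record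
    { σ = splice (rank a) (none (rank a)) (λ _ → plus 0)
    ; below = λ m → splice-≤
    ; active = λ m a<m x e → contradiction (trans (sym (splice-> a<m)) e) (λ ())
    ; steps = λ m → splice-steps 0 (λ m _ → wait)
        (enter (to-plus (subst (_≤ rank a) (sym (2*o+0 o)) o≤a) (λ _ → stay (1 + rank a) (n<1+n _))))
        (λ m a<m → stay⁺ (stay m a<m)) m z≤n
    ; change = splice-elim (λ m s → Change s (P m) (counts (row′ ∷ T) m))
        (λ { m m≤a zero → cong (_+ 0) (trans (p₀ m) (cong (_+ P m 0) (ind-≥ m≤a))) ; m m≤a (suc j) → cong (_+ 0) (p₁ m j) })
        (λ { m a<m zero → trans (+-identityʳ _) (trans (p₀ m) (trans (cong (_+ P m 0) (ind-< a<m)) (+-comm 1 _)))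
           ; m a<m (suc j) → cong (_+ 0) (p₁ m j) })
    ; sorted = ss
    ; non-empty = ns
    }

  inserts : ∀ o a (T : Filling k) → All Sorted T → All NonEmpty T → Valid o (counts T) → 2 * o ≤ rank a →
            Inserts o (rank a) (counts T) (insertAt o a T)
  inserts o a [] _ _ v o≤a =
    inserts-stop o a [ a ] [] (λ m → refl) (λ m j → refl) (λ m _ → z≤n) o≤a (([] ∷ []) ∷ []) (nonEmpty ∷ [])
  inserts o a (row ∷ T) (s ∷ ss) (n ∷ ns) v o≤a with cancels? o a row
  inserts o .(unbarred i) (row ∷ T) (s ∷ ss) (n ∷ ns) v o≤a | yes (i , refl , refl , b∈)
    with cancel-spec i row T s (count≡0 row (Valid.king v (2 * toℕ i) 0 (≤-reflexive (sym (2*o+0 (toℕ i)))))) b∈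
  ... | right , e , s′ , c = subst (Inserts o′ a′ P) (sym e) record
    { σ = σ
    ; below = λ m → splice-≤
    ; active = λ m a<m → subst Active (sym (splice-> a<m))
        (splice-elim (λ m s → Active s) (λ _ _ _ ()) (λ m h<m → S.active m h<m) m)
    ; steps = λ m → splice-steps 0 (λ m _ → wait)
        (subst (Step o′ P a′ (none a′)) (sym (splice-≤ {1 + a′} {pend 0} {S.σ} ≤-refl))
          (enter (to-pend (sym (2*o+0 o′)) (count-∈ b∈))))
        (λ m a<m → splice-steps (1 + a′) (λ m a<m m<1+a → contradiction a<m (<⇒≱ m<1+a))
          (subst (Step o′ P (1 + a′) (pend 0)) (sym S.first) (cancel⁻ (cong suc (sym (2*o+0 o′))) (count-∈ b∈)))
          (λ m h<m → S.steps m h<m) m a<m)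
        m z≤n
    ; change = splice-elim (λ m s → Change s (P m) (counts T′ m))
        (λ m m≤a → unchanged m (m≤n⇒m≤1+n m≤a))
        (λ m a<m → splice-elim (λ m s → Change s (P m) (counts T′ m)) unchanged (λ m _ → S.change m) m)
    ; sorted = S.sorted
    ; non-empty = S.non-empty
    }
    where
    o′ = toℕ i
    a′ = 2 * o′
    P = counts (row ∷ T)
    T′ = slide [] right T
    S : Slides o′ (1 + a′) P T′
    S = slides o′ (1 + a′) P [] right T (λ m → sym (c m)) (λ m j → refl) s′ left-end
      -- By the King condition all entries of the next row exceed the lost barred letter.
      (All.map (≤-trans (≤-reflexive (sym (*-suc 2 o′)))) (count≡0 {m = 2 * suc o′} (at T 0)
        (Valid.king v (2 * suc o′) 1 (≤-reflexive (cong (2 *_) (+-comm 1 o′))))))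
      ss ns (Valid.inter (Valid-tail v))
    module S = Slides S
    -- Only a letter of rank `1 + a′` is lost from the row, so the counts agree up to level
    -- `1 + a′`; there `pend 0` announces the loss.
    σ = splice a′ (none a′) (splice (1 + a′) (pend 0) S.σ)
    unchanged : ∀ m → m ≤ 1 + a′ → Change (none a′) (P m) (counts T′ m)
    unchanged m h = subst (λ s → Change s (P m) (counts T′ m)) (S.below m h) (S.change m)
  inserts o a (row ∷ T) (s ∷ ss) (n ∷ ns) v o≤a | no ¬c with bump a row | bumped a row s | bump-nonEmpty a row
  ... | row′ , nothing | stops s′ c stay | n′ =
    inserts-stop o a row′ T c (λ m j → refl) stay o≤a (s′ ∷ ss) (n′ ∷ ns)
  ... | row′ , just b | bumps a<b b∈ s′ c stay | n′ = record
    { σ = σ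
    ; below = λ m → splice-≤
    ; active = λ m a<m → subst Active (sym (splice-> a<m))
        (splice-elim (λ m s → Active s) (λ _ _ _ ()) (λ m b<m → shift-active (S.active m b<m)) m)
    ; steps = λ m → splice-steps 0 (λ m _ → wait)
        (subst (Step o P (rank a) (none (rank a))) (sym (splice-≤ a<b))
          (enter (to-plus (subst (_≤ rank a) (sym (2*o+0 o)) o≤a) (λ e → no-barred {o} {a} (trans e (2*o+0 o)) ¬c))))
        (λ m a<m → splice-steps (1 + rank a) (λ m a<m m<b → stay⁺ (stay m a<m m<b))
          (bump⁺ (count-∈ b∈) (shift-enter (entered (subst (λ s → Step (suc o) (λ m j → P m (suc j)) (rank b) s (S.σ (1 + rank b)))
            (S.below (rank b) ≤-refl) (S.steps (rank b))) (S.active (1 + rank b) (n<1+n _)))))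
          (λ m b<m → shift-step (S.active m b<m) (S.steps m)) m a<m)
        m z≤n
    ; change = splice-elim (λ m s → Change s (P m) (counts (row′ ∷ T′) m))
        (λ m m≤a j → cong (_+ 0) (unchanged m m≤a j))
        (λ m a<m → splice-elim (λ m s → rank a < m → Change s (P m) (counts (row′ ∷ T′) m))
          (λ m m≤b a<m → changed m a<m m≤b)
          (λ m b<m a<m → shift-change (S.σ m) (+-cancelˡ-≡ 1 _ _ (subst₂ (λ u v → u + count m row′ ≡ v + count m row) (ind-< b<m) (ind-< a<m) (c m))) (S.change m))
          m a<m)
    ; sorted = s′ ∷ S.sorted
    ; non-empty = n′ ∷ S.non-empty
    }
    where
    P = counts (row ∷ T)
    T′ = insertAt (suc o) b T
    S : Inserts (suc o) (rank b) (counts T) T′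
    S = inserts (suc o) b T ss ns (Valid-tail v) (bumped-bound {o} {a} o≤a a<b b∈ ¬c)
    module S = Inserts S
    σ = splice (rank a) (none (rank a)) (splice (rank b) (plus 0) (λ m → shift (S.σ m)))
    rest : ∀ m j → m ≤ rank b → counts T′ m j ≡ P m (suc j)
    rest m j m≤b = trans (sym (+-identityʳ _)) (trans
      (subst (λ s → Change s (counts T m) (counts T′ m)) (S.below m m≤b) (S.change m) j) (+-identityʳ _))
    unchanged : ∀ m → m ≤ rank a → ∀ j → counts (row′ ∷ T′) m j ≡ P m j
    unchanged m m≤a zero = subst₂ (λ u v → u + count m row′ ≡ v + count m row) (ind-≥ (≤-trans m≤a (<⇒≤ a<b))) (ind-≥ m≤a) (c m)
    unchanged m m≤a (suc j) = rest m j (≤-trans m≤a (<⇒≤ a<b))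
    changed : ∀ m → rank a < m → m ≤ rank b → Change (plus 0) (P m) (counts (row′ ∷ T′) m)
    changed m a<m m≤b zero = trans (+-identityʳ _) (trans
      (subst₂ (λ u v → u + count m row′ ≡ v + count m row) (ind-≥ m≤b) (ind-< a<m) (c m)) (+-comm 1 _))
    changed m a<m m≤b (suc j) = cong (_+ 0) (rest m j m≤b)

Step-resp : ∀ {P P′ : Pattern} → (∀ m j → P m j ≡ P′ m j) → ∀ {o m s t} → Step o P m s t → Step o P′ m s t
Step-resp {P} {P′} e = go
  where
  enter-resp : ∀ {o m r s} → Enter o P m r s → Enter o P′ m r s
  enter-resp (to-plus h f) = to-plus h (λ p → subst₂ _≤_ (e _ _) (e _ _) (f p))
  enter-resp (to-pend p h) = to-pend p (subst₂ _<_ (e _ _) (e _ _) h)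
  go : ∀ {o m s t} → Step o P m s t → Step o P′ m s t
  go (wait h)      = wait h
  go (enter h)     = enter (enter-resp h)
  go (stay⁺ h)     = stay⁺ (subst₂ _≤_ (e _ _) (e _ _) h)
  go (bump⁺ h f)   = bump⁺ (subst₂ _<_ (e _ _) (e _ _) h) (enter-resp f)
  go (cancel⁻ p h) = cancel⁻ p (subst₂ _<_ (e _ _) (e _ _) h)
  go (stay⁻ h)     = stay⁻ (subst₂ _<_ (e _ _) (e _ _) h)
  go (fall⁻ h)     = fall⁻ (subst₂ _≤_ (e _ _) (e _ _) h)

Valid-resp : ∀ {P P′ : Pattern} → (∀ m j → P m j ≡ P′ m j) → ∀ {o} → Valid o P → Valid o P′
Valid-resp e v = record
  { mono  = λ m r → subst₂ _≤_ (e _ _) (e _ _) (Valid.mono v m r)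
  ; inter = λ m r → subst₂ _≤_ (e _ _) (e _ _) (Valid.inter v m r)
  ; king  = λ m r h → trans (sym (e m r)) (Valid.king v m r h)
  }

-- Moves

Moved : Move → (α β : ℕ → ℕ) → Set
Moved c = Change (state c)

infix 4 _≤ᴹ_
_≤ᴹ_ : Move → Move → Set
c ≤ᴹ d = state c ⊑ state d

Moved-unique : ∀ {α β : ℕ → ℕ} c d → Moved c α β → Moved d α β → c ≡ d
Moved-unique {α} {β} (del r) (del s) h g with r ≟ s
... | yes refl = refl
... | no r≢s = ⊥-elim (lia 2 (λ a b → a ≐ con 1 ⊕ b ∷ b ≐ a ∷ [] ⊢ absurd) (α s) (β s) (at-minus g) (off-minus h r≢s))
Moved-unique {α} {β} (add r) (add s) h g with r ≟ s
... | yes refl = refl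
... | no r≢s = ⊥-elim (lia 2 (λ a b → b ≐ con 1 ⊕ a ∷ b ≐ a ∷ [] ⊢ absurd) (α s) (β s) (at-plus g) (off-plus h r≢s))
Moved-unique {α} {β} (del r) (add s) h g =
  ⊥-elim (lia 3 (λ a b d → a ≐ con 1 ⊕ b ∷ b ⊕ con 0 ≐ a ⊕ d ∷ [] ⊢ absurd) (α r) (β r) (δ s r) (at-minus h) (g r))
Moved-unique {α} {β} (add r) (del s) h g =
  ⊥-elim (lia 3 (λ a b d → b ≐ con 1 ⊕ a ∷ b ⊕ d ≐ a ⊕ con 0 ∷ [] ⊢ absurd) (α r) (β r) (δ s r) (at-plus h) (g r))

⊏⇒⋢ : ∀ {s t} → s ⊏ t → ¬ t ⊑ s
⊏⇒⋢ (none-none h)   (none-none g)   = contradiction h (≤⇒≯ g)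
⊏⇒⋢ (plus-plus h)   (plus-plus g)   = contradiction h (≤⇒≯ g)
⊏⇒⋢ (minus-minus h) (minus-minus g) = contradiction h (≤⇒≯ g)

-- Building tableaux

module _ {A : Set} where

  mkRows : (ℕ → List A) → ℕ → List (List A)
  mkRows g zero    = []
  mkRows g (suc n) with g 0
  ... | []     = []
  ... | x ∷ xs = (x ∷ xs) ∷ mkRows (λ j → g (suc j)) n

  empty-from : ∀ (g : ℕ → List A) → (∀ j → g j ≡ [] → g (suc j) ≡ []) → g 0 ≡ [] → ∀ j → g j ≡ []
  empty-from g h e zero    = e
  empty-from g h e (suc j) = h j (empty-from g h e j)

  at-mkRows : ∀ (g : ℕ → List A) n → (∀ j → g j ≡ [] → g (suc j) ≡ []) → (∀ j → n ≤ j → g j ≡ []) →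
              ∀ j → at (mkRows g n) j ≡ g j
  at-mkRows g zero    h e j = sym (e j z≤n)
  at-mkRows g (suc n) h e j with g 0 in eq
  ... | [] = sym (empty-from g h eq j)
  at-mkRows g (suc n) h e zero    | x ∷ xs = sym eq
  at-mkRows g (suc n) h e (suc j) | x ∷ xs =
    at-mkRows (λ j → g (suc j)) n (λ j → h (suc j)) (λ j n≤j → e (suc j) (s≤s n≤j)) j

  mkRows-NonEmpty : ∀ (g : ℕ → List A) n → All NonEmpty (mkRows g n)
  mkRows-NonEmpty g zero    = []
  mkRows-NonEmpty g (suc n) with g 0
  ... | []     = []
  ... | x ∷ xs = nonEmpty ∷ mkRows-NonEmpty (λ j → g (suc j)) n

  mkRows-All : ∀ {B : List A → Set} (g : ℕ → List A) n → (∀ j → B (g j)) → All B (mkRows g n)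
  mkRows-All g zero    h = []
  mkRows-All g (suc n) h with g 0 | h 0
  ... | []     | _ = []
  ... | x ∷ xs | b = b ∷ mkRows-All (λ j → g (suc j)) n (λ j → h (suc j))

even-or-odd : ∀ n → (∃[ q ] n ≡ 2 * q) ⊎ (∃[ q ] n ≡ 1 + 2 * q)
even-or-odd zero    = inj₁ (0 , refl)
even-or-odd (suc n) with even-or-odd n
... | inj₁ (q , refl) = inj₂ (q , refl)
... | inj₂ (q , refl) = inj₁ (suc q , sym (*-suc 2 q))

letter : ∀ {k n} → n < 2 * k → Σ[ a ∈ Letter k ] rank a ≡ n
letter {k} {n} h with even-or-odd n
... | inj₁ (q , refl) = unbarred (Fin.fromℕ< q<k) , cong (2 *_) {x = toℕ (Fin.fromℕ< q<k)} (Fin.toℕ-fromℕ< q<k)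
  where q<k = *-cancelˡ-< 2 q k h
... | inj₂ (q , refl) = barred (Fin.fromℕ< q<k) , cong (λ n → 1 + 2 * n) {x = toℕ (Fin.fromℕ< q<k)} (Fin.toℕ-fromℕ< q<k)
  where q<k = *-cancelˡ-< 2 q k (<-trans (n<1+n _) h)

module _ {k : ℕ} where

  count-replicate : ∀ m q (x : Letter k) → count m (replicate q x) ≡ q * ind (rank x) m
  count-replicate m zero    x = refl
  count-replicate m (suc q) x = cong (ind (rank x) m +_) (count-replicate m q x)

  -- The increments of a nondecreasing count function are the multiplicities of the letters,
  -- appended in increasing order.
  row-exists : ∀ (f : ℕ → ℕ) → (∀ m → f m ≤ f (1 + m)) → f 0 ≡ 0 → ∀ n → n ≤ 2 * k →
    Σ[ row ∈ Row k ] Sorted row × All (λ x → rank x < n) row ×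
      (∀ m → m ≤ n → count m row ≡ f m) × (∀ m → n ≤ m → count m row ≡ f n)
  row-exists f mono f0 zero    h = [] , [] , [] , (λ { .zero z≤n → sym f0 }) , (λ m _ → sym f0)
  row-exists f mono f0 (suc n) h =
    let row , s , b , c , c′ = row-exists f mono f0 n (<⇒≤ h)
        a , e = letter {k} {n} h
        q = f (1 + n) ∸ f n
    in row ++ replicate q a ,
       Sorted-++⁺ s (sorted-replicate q a)
         (All.map (λ p → All.replicate⁺ q (<⇒≤ (≤-trans p (≤-reflexive (sym e))))) b) ,
       All.++⁺ (All.map m<n⇒m<1+n b) (All.replicate⁺ q (s≤s (≤-reflexive e))) ,
       (λ m m≤1+n → split row a e c c′ m m≤1+n) ,
       (λ m n<m → above row a e c′ m n<m)
    where
    sorted-replicate : ∀ q (a : Letter k) → Sorted (replicate q a)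
    sorted-replicate zero    a = []
    sorted-replicate (suc q) a = All.replicate⁺ q ≤-refl ∷ sorted-replicate q a
    above : ∀ row a → rank a ≡ n → (∀ m → n ≤ m → count m row ≡ f n) →
            ∀ m → n < m → count m (row ++ replicate (f (1 + n) ∸ f n) a) ≡ f (1 + n)
    above row a refl c′ m n<m = trans (count-++ m row _) (trans (cong₂ _+_ (c′ m (<⇒≤ n<m))
      (trans (count-replicate m (f (1 + n) ∸ f n) a) (trans (cong ((f (1 + n) ∸ f n) *_) (ind-< n<m)) (*-identityʳ _))))
      (m+[n∸m]≡n (mono n)))
    split : ∀ row a → rank a ≡ n → (∀ m → m ≤ n → count m row ≡ f m) → (∀ m → n ≤ m → count m row ≡ f n) →
            ∀ m → m ≤ 1 + n → count m (row ++ replicate (f (1 + n) ∸ f n) a) ≡ f m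
    split row a refl c c′ m m≤1+n with m ≤? n
    ... | yes m≤n = trans (count-++ m row _) (trans (cong₂ _+_ (c m m≤n)
      (trans (count-replicate m (f (1 + n) ∸ f n) a) (trans (cong ((f (1 + n) ∸ f n) *_) (ind-≥ m≤n)) (*-zeroʳ (f (1 + n) ∸ f n))))) (+-identityʳ _))
    ... | no m≰n with ≤-antisym m≤1+n (≰⇒> m≰n)
    ...   | refl = above row a refl c′ m ≤-refl

-- Insertion as a bijection

  record King (T : Filling k) : Set where
    field
      sorted    : All Sorted T
      non-empty : All NonEmpty T
      valid     : Valid 0 (counts T)

  -- Every rank is below `2 * k`, so these are the row lengths.
  sh : Filling k → ℕ → ℕ
  sh T = counts T (2 * k)

  King-injective : ∀ {T U} → King T → King U → (∀ m j → m ≤ 2 * k → counts T m j ≡ counts U m j) → T ≡ U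
  King-injective {T} {U} KT KU e = counts-injective (King.sorted KT) (King.non-empty KT) (King.sorted KU) (King.non-empty KU) all
    where
    all : ∀ m j → counts T m j ≡ counts U m j
    all m j with m ≤? 2 * k
    ... | yes h = e m j h
    ... | no ¬h = trans (count-above (≰⇒≥ ¬h) (at T j)) (trans (e (2 * k) j ≤-refl) (sym (count-above (≰⇒≥ ¬h) (at U j))))

  module Insertion {T : Filling k} (KT : King T) (v : Letter k) where
    private
      I : Inserts 0 (rank v) (counts T) (T ⟵ v)
      I = inserts 0 v T (King.sorted KT) (King.non-empty KT) (King.valid KT) z≤n
    open Inserts I public using (σ)

    start₀ : σ 0 ≡ none (rank v)
    start₀ = Inserts.below I 0 z≤n

    run : Run 0 (counts T) (counts (T ⟵ v)) σ
    run = record { steps = Inserts.steps I ; change = Inserts.change I }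

    King-⟵ : King (T ⟵ v)
    King-⟵ = record
      { sorted    = Inserts.sorted I
      ; non-empty = Inserts.non-empty I
      ; valid     = run-valid (King.valid KT) run start₀
      }

    -- By level `2 * k` every letter has entered, and a cancellation is pending only at an odd
    -- level.
    move : ∃[ c ] σ (2 * k) ≡ state c
    move with σ (2 * k) | run-inv (King.valid KT) run start₀ (2 * k) | Inserts.active I (2 * k) (rank< v)
    ... | none x  | _        | h = contradiction refl (h x)
    ... | plus r  | _        | _ = add r , refl
    ... | minus r | _        | _ = del r , refl
    ... | pend r  | pend e _ | _ = contradiction e (even≢odd k r)

    moved : Moved (proj₁ move) (sh T) (sh (T ⟵ v))
    moved = subst (λ s → Change s (sh T) (sh (T ⟵ v))) (proj₂ move) (Run.change run (2 * k))

    final : ∀ {c} → Moved c (sh T) (sh (T ⟵ v)) → σ (2 * k) ≡ state c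
    final {c} h = trans (proj₂ move) (cong state (Moved-unique (proj₁ move) c moved h))

  insertion-order : ∀ {T} → King T → ∀ {v v′ c c′} → Moved c (sh T) (sh (T ⟵ v)) →
    Moved c′ (sh (T ⟵ v)) (sh (T ⟵ v ⟵ v′)) → (v ≤ₗ v′ → c ≤ᴹ c′) × (c ≤ᴹ c′ → v ≤ₗ v′)
  insertion-order {T} KT {v} {v′} {c} {c′} h h′ =
    (λ v≤v′ → subst₂ _⊑_ (I.final h) (J.final h′) (runs-⊑ (King.valid KT) I.run J.run I.start₀ J.start₀ v≤v′ (2 * k))) , back′
    where
    module I = Insertion KT v
    module J = Insertion I.King-⟵ v′
    back′ : c ≤ᴹ c′ → v ≤ₗ v′
    back′ c≤c′ with rank v′ <? rank v
    ... | no ¬p = ≮⇒≥ ¬p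
    -- For strictly decreasing letters the strict order of states runs the other way, up to the
    -- moves.
    ... | yes p = contradiction c≤c′ (⊏⇒⋢ (subst₂ _⊏_ (J.final h′) (I.final h)
      (runs-⊐ (King.valid KT) I.run J.run I.start₀ J.start₀ p (2 * k))))

  -- The reversed rules refer to the new pattern only, so agreement of the states at one level
  -- descends to all lower ones.
  runs-agree : ∀ {P P′ Q σ σ′ x x′} → Valid 0 P → Valid 0 P′ → Run 0 P Q σ → Run 0 P′ Q σ′ →
    σ 0 ≡ none x → σ′ 0 ≡ none x′ → ∀ K → σ K ≡ σ′ K → ∀ m → m ≤ K → σ m ≡ σ′ m
  runs-agree {Q = Q} {σ} {σ′} v v′ r r′ e e′ K eq m m≤K = go (K ∸ m) m (m+[n∸m]≡n m≤K)
    where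
    go : ∀ d m → m + d ≡ K → σ m ≡ σ′ m
    go zero    m refl = subst (λ n → σ n ≡ σ′ n) (+-identityʳ m) eq
    go (suc d) m h = Back-functional (run-back v r e m)
      (subst (λ s → Back Q m s (σ′ m)) (sym (go d (suc m) (trans (sym (+-suc m d)) h))) (run-back v′ r′ e′ m))

  insertion-injective : ∀ {T T′} → King T → King T′ → ∀ {v v′} → T ⟵ v ≡ T′ ⟵ v′ → (∀ j → sh T j ≡ sh T′ j) →
                        T ≡ T′ × v ≡ v′
  insertion-injective {T} {T′} KT KT′ {v} {v′} e h =
    King-injective KT KT′ (λ m j m≤ → +-cancelʳ-≡ (inc (J.σ m) j) _ _ (trans
      (sym (subst (λ s → Change s (counts T m) (counts (T ⟵ v) m)) (agree m m≤) (Run.change I.run m) j))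
      (Run.change run′ m j))) ,
    rank-injective (none-injective (trans (sym I.start₀) (trans (agree 0 z≤n) J.start₀)))
    where
    module I = Insertion KT v
    module J = Insertion KT′ v′
    none-injective : ∀ {x y} → none x ≡ none y → x ≡ y
    none-injective refl = refl
    run′ : Run 0 (counts T′) (counts (T ⟵ v)) J.σ
    run′ = subst (λ U → Run 0 (counts T′) (counts U) J.σ) (sym e) J.run
    moved′ : Moved (proj₁ I.move) (sh T′) (sh (T′ ⟵ v′))
    moved′ = Change-resp {s = state (proj₁ I.move)} h (subst (λ U → Moved (proj₁ I.move) (sh T) (sh U)) e I.moved)
    agree : ∀ m → m ≤ 2 * k → I.σ m ≡ J.σ m
    agree = runs-agree (King.valid KT) (King.valid KT′) I.run run′ I.start₀ J.start₀ (2 * k)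
      (trans (proj₂ I.move) (sym (J.final {proj₁ I.move} moved′)))

  -- Reversal yields an old pattern, which is realised by a tableau `T`. That inserting `v` into `T`
  -- really follows the reversed run is due to the determinism of the forward rules.
  insertion-surjective : ∀ {U} → King U → ∀ c (α : ℕ → ℕ) → (∀ r → α (1 + r) ≤ α r) → (∀ r → k ≤ r → α r ≡ 0) →
    Moved c α (sh U) → ∃[ T ] ∃[ v ] King T × T ⟵ v ≡ U × (∀ j → sh T j ≡ α j)
  insertion-surjective {U} KU c α antitone bounded moved =
    T , v , KT , King-injective I.King-⟵ KU same ,
    (λ j → trans (counts-T (2 * k) j) (P-final (2 * k) j ≤-refl))
    where
    open Reverse k {counts U} (King.valid KU) (λ m j h → count-above h (at U j)) c antitone bounded moved
    row : ∀ j → _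
    row j = row-exists (λ m → P m j) (λ m → Valid.mono P-valid m j) (Valid.king P-valid 0 j z≤n) (2 * k) ≤-refl
    g : ℕ → Row k
    g j = proj₁ (row j)
    count-g : ∀ m j → count m (g j) ≡ P m j
    count-g m j with m ≤? 2 * k
    ... | yes h = proj₁ (proj₂ (proj₂ (proj₂ (row j)))) m h
    ... | no ¬h = trans (proj₂ (proj₂ (proj₂ (proj₂ (row j)))) m (≰⇒≥ ¬h))
                        (trans (P-final (2 * k) j ≤-refl) (sym (P-final m j (≰⇒≥ ¬h))))
    length-g : ∀ j → length (g j) ≡ α j
    length-g j = trans (sym (count-top (g j))) (trans (count-g (2 * k) j) (P-final (2 * k) j ≤-refl))
    length-0 : ∀ {xs : Row k} → length xs ≡ 0 → xs ≡ []
    length-0 {[]} e = refl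
    T = mkRows g k
    at-T : ∀ j → at T j ≡ g j
    at-T = at-mkRows g k
      (λ j e → length-0 (n≤0⇒n≡0 (subst₂ _≤_ (sym (length-g (suc j))) (trans (sym (length-g j)) (cong length e)) (antitone j))))
      (λ j h → length-0 (trans (length-g j) (bounded j h)))
    counts-T : ∀ m j → counts T m j ≡ P m j
    counts-T m j = trans (cong (count m) (at-T j)) (count-g m j)
    KT : King T
    KT = record
      { sorted    = mkRows-All g k (λ j → proj₁ (proj₂ (row j)))
      ; non-empty = mkRows-NonEmpty g k
      ; valid     = Valid-resp (λ m j → sym (counts-T m j)) P-valid
      }
    x = proj₁ initial
    v = proj₁ (letter {k} {x} (proj₂ (proj₂ initial)))
    rank-v : rank v ≡ x
    rank-v = proj₂ (letter {k} {x} (proj₂ (proj₂ initial)))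
    module I = Insertion KT v
    agree : ∀ m → m ≤ 2 * k → I.σ m ≡ σ m
    agree zero    h = trans I.start₀ (trans (cong none rank-v) (sym (proj₁ (proj₂ initial))))
    agree (suc m) h = Step-functional
      (subst (λ s → Step 0 P m s (I.σ (suc m))) (agree m (<⇒≤ h)) (Step-resp counts-T (Run.steps I.run m)))
      (steps h)
    same : ∀ m j → m ≤ 2 * k → counts (T ⟵ v) m j ≡ counts U m j
    same m j h = +-cancelʳ-≡ (dec (σ m) j) _ _ (trans
      (subst (λ s → Change s (counts T m) (counts (T ⟵ v) m)) (agree m h) (Run.change I.run m) j)
      (trans (cong (_+ inc (σ m) j) (counts-T m j)) (sym (change h j))))

-- Sorted lists of moves

≤ᴹ-trans : ∀ {c d e} → c ≤ᴹ d → d ≤ᴹ e → c ≤ᴹ e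
≤ᴹ-trans {del _} {del _} {del _} (minus-minus p) (minus-minus q) = minus-minus (≤-trans p q)
≤ᴹ-trans {del _} {del _} {add _} _ _ = minus-plus
≤ᴹ-trans {del _} {add _} {add _} _ _ = minus-plus
≤ᴹ-trans {add _} {add _} {add _} (plus-plus p) (plus-plus q) = plus-plus (≤-trans q p)

≤ᴹ-antisym : ∀ {c d} → c ≤ᴹ d → d ≤ᴹ c → c ≡ d
≤ᴹ-antisym {del _} {del _} (minus-minus p) (minus-minus q) = cong del (≤-antisym p q)
≤ᴹ-antisym {add _} {add _} (plus-plus p)   (plus-plus q)   = cong add (≤-antisym q p)

≤ᴹ-refl : ∀ {c} → c ≤ᴹ c
≤ᴹ-refl {del _} = minus-minus ≤-refl
≤ᴹ-refl {add _} = plus-plus ≤-refl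

Ascending : List Move → Set
Ascending = AllPairs _≤ᴹ_

dels adds : ℕ → List Move → ℕ
dels r []       = 0
dels r (c ∷ cs) = dec (state c) r + dels r cs
adds r []       = 0
adds r (c ∷ cs) = inc (state c) r + adds r cs

dels-none : ∀ {r cs} → (∀ {s} → del s ∈ cs → s ≢ r) → dels r cs ≡ 0
dels-none {cs = []}         h = refl
dels-none {cs = del s ∷ cs} h = cong₂ _+_ (δ-≢ (h (here refl))) (dels-none (λ p → h (there p)))
dels-none {cs = add s ∷ cs} h = dels-none (λ p → h (there p))

adds-none : ∀ {r cs} → (∀ {s} → add s ∈ cs → s ≢ r) → adds r cs ≡ 0
adds-none {cs = []}         h = refl
adds-none {cs = del s ∷ cs} h = adds-none (λ p → h (there p))
adds-none {cs = add s ∷ cs} h = cong₂ _+_ (δ-≢ (h (here refl))) (adds-none (λ p → h (there p)))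

dels-∈ : ∀ {r n cs} → dels r cs ≡ suc n → del r ∈ cs
dels-∈ {r} {cs = del s ∷ cs} e with s ≟ r
... | yes refl = here refl
... | no s≢r   = there (dels-∈ (trans (cong (_+ dels r cs) (sym (δ-≢ s≢r))) e))
dels-∈ {cs = add s ∷ cs} e = there (dels-∈ e)

adds-∈ : ∀ {r n cs} → adds r cs ≡ suc n → add r ∈ cs
adds-∈ {cs = del s ∷ cs} e = there (adds-∈ e)
adds-∈ {r} {cs = add s ∷ cs} e with s ≟ r
... | yes refl = here refl
... | no s≢r   = there (adds-∈ (trans (cong (_+ adds r cs) (sym (δ-≢ s≢r))) e))

add-first : ∀ {j cs} r → Ascending (add j ∷ cs) → dels r cs ≡ 0
add-first r (p ∷ _) = dels-none λ s∈ _ → contradiction (All.lookup p s∈) λ ()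

-- Both heads are the minimum of the same multiset of moves.
Ascending-unique : ∀ {cs ds} → Ascending cs → Ascending ds → (∀ r → dels r cs ≡ dels r ds) →
                   (∀ r → adds r cs ≡ adds r ds) → cs ≡ ds
Ascending-unique {[]} {[]} _ _ e f = refl
Ascending-unique {[]} {del r ∷ ds} _ _ e f = contradiction (trans (e r) (cong (_+ dels r ds) (δ-refl r))) λ ()
Ascending-unique {[]} {add r ∷ ds} _ _ e f = contradiction (trans (f r) (cong (_+ adds r ds) (δ-refl r))) λ ()
Ascending-unique {del r ∷ cs} {[]} _ _ e f = contradiction (trans (sym (e r)) (cong (_+ dels r cs) (δ-refl r))) λ ()
Ascending-unique {add r ∷ cs} {[]} _ _ e f = contradiction (trans (sym (f r)) (cong (_+ adds r cs) (δ-refl r))) λ ()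
Ascending-unique {c ∷ cs} {d ∷ ds} p q e f
  with ≤ᴹ-antisym (head≤ c p q (λ r → sym (e r)) (λ r → sym (f r)) (present {c ∷ cs} d {ds} e f)) (head≤ d q p e f (present {d ∷ ds} c {cs} (λ r → sym (e r)) (λ r → sym (f r))))
  where
  present : ∀ {cs} d {ds} → (∀ r → dels r cs ≡ dels r (d ∷ ds)) → (∀ r → adds r cs ≡ adds r (d ∷ ds)) → d ∈ cs
  present (del r) {ds} e f = dels-∈ (trans (e r) (cong (_+ dels r ds) (δ-refl r)))
  present (add r) {ds} e f = adds-∈ (trans (f r) (cong (_+ adds r ds) (δ-refl r)))
  head≤ : ∀ c {cs d ds} → Ascending (c ∷ cs) → Ascending (d ∷ ds) → (∀ r → dels r (d ∷ ds) ≡ dels r (c ∷ cs)) →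
          (∀ r → adds r (d ∷ ds) ≡ adds r (c ∷ cs)) → d ∈ c ∷ cs → c ≤ᴹ d
  head≤ c (p ∷ _) _ e f (here refl) = ≤ᴹ-refl
  head≤ c (p ∷ _) _ e f (there d∈)  = All.lookup p d∈
Ascending-unique {c ∷ cs} {.c ∷ ds} (_ ∷ p) (_ ∷ q) e f | refl =
  cong (c ∷_) (Ascending-unique p q (λ r → +-cancelˡ-≡ (dec (state c) r) _ _ (e r)) (λ r → +-cancelˡ-≡ (inc (state c) r) _ _ (f r)))

dels-++ : ∀ r cs ds → dels r (cs ++ ds) ≡ dels r cs + dels r ds
dels-++ r []       ds = refl
dels-++ r (c ∷ cs) ds = trans (cong (dec (state c) r +_) (dels-++ r cs ds)) (sym (+-assoc (dec (state c) r) _ _))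

adds-++ : ∀ r cs ds → adds r (cs ++ ds) ≡ adds r cs + adds r ds
adds-++ r []       ds = refl
adds-++ r (c ∷ cs) ds = trans (cong (inc (state c) r +_) (adds-++ r cs ds)) (sym (+-assoc (inc (state c) r) _ _))

dels-replicate : ∀ r n c → dels r (replicate n c) ≡ n * dec (state c) r
dels-replicate r zero    c = refl
dels-replicate r (suc n) c = cong (dec (state c) r +_) (dels-replicate r n c)

adds-replicate : ∀ r n c → adds r (replicate n c) ≡ n * inc (state c) r
adds-replicate r zero    c = refl
adds-replicate r (suc n) c = cong (inc (state c) r +_) (adds-replicate r n c)

Ascending-replicate : ∀ n {c} → Ascending (replicate n c)
Ascending-replicate zero    = []
Ascending-replicate (suc n) = All.replicate⁺ n ≤ᴹ-refl ∷ Ascending-replicate n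

data Deletion (n : ℕ) : Move → Set where
  del : ∀ {r} → r < n → Deletion n (del r)

data Addition (n : ℕ) : Move → Set where
  add : ∀ {r} → r < n → Addition n (add r)

δ-* : ∀ (f : ℕ → ℕ) n r → f n * δ n r ≡ f r * δ n r
δ-* f n r with n ≟ r
... | yes refl = refl
... | no n≢r rewrite δ-≢ n≢r = trans (*-zeroʳ (f n)) (sym (*-zeroʳ (f r)))

ind-suc : ∀ n r → ind r (suc n) ≡ ind r n + δ n r
ind-suc zero    zero    = refl
ind-suc zero    (suc r) = refl
ind-suc (suc n) zero    = refl
ind-suc (suc n) (suc r) = ind-suc n r

deletions : ∀ (f : ℕ → ℕ) n → Σ[ cs ∈ List Move ] Ascending cs × All (Deletion n) cs ×
            (∀ r → dels r cs ≡ f r * ind r n) × (∀ r → adds r cs ≡ 0)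
deletions f zero    = [] , [] , [] , (λ r → sym (*-zeroʳ (f r))) , λ r → refl
deletions f (suc n) =
  let cs , a , d , e , z = deletions f n in
  cs ++ replicate (f n) (del n) ,
  AllPairs.++⁺ a (Ascending-replicate (f n)) (All.map (λ { (del r<n) → All.replicate⁺ (f n) (minus-minus (<⇒≤ r<n)) }) d) ,
  All.++⁺ (All.map (λ { (del r<n) → del (m<n⇒m<1+n r<n) }) d) (All.replicate⁺ (f n) (del (n<1+n n))) ,
  (λ r → trans (dels-++ r cs _) (trans (cong₂ _+_ (e r) (trans (dels-replicate r (f n) (del n)) (δ-* f n r)))
    (trans (sym (*-distribˡ-+ (f r) (ind r n) (δ n r))) (cong (f r *_) (sym (ind-suc n r)))))) ,
  (λ r → trans (adds-++ r cs _) (cong₂ _+_ (z r) (trans (adds-replicate r (f n) (del n)) (*-zeroʳ (f n)))))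

additions : ∀ (f : ℕ → ℕ) n → Σ[ cs ∈ List Move ] Ascending cs × All (Addition n) cs ×
            (∀ r → adds r cs ≡ f r * ind r n) × (∀ r → dels r cs ≡ 0)
additions f zero    = [] , [] , [] , (λ r → sym (*-zeroʳ (f r))) , λ r → refl
additions f (suc n) =
  let cs , a , d , e , z = additions f n in
  -- Additions ascend from lower rows to higher ones, so those to row `n` come first.
  replicate (f n) (add n) ++ cs ,
  AllPairs.++⁺ (Ascending-replicate (f n)) a (All.replicate⁺ (f n) (All.map (λ { (add r<n) → plus-plus (<⇒≤ r<n) }) d)) ,
  All.++⁺ (All.replicate⁺ (f n) (add (n<1+n n))) (All.map (λ { (add r<n) → add (m<n⇒m<1+n r<n) }) d) ,
  (λ r → trans (adds-++ r (replicate (f n) (add n)) cs) (trans (+-comm (adds r (replicate (f n) (add n))) _)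
    (trans (cong₂ _+_ (e r) (trans (adds-replicate r (f n) (add n)) (δ-* f n r)))
    (trans (sym (*-distribˡ-+ (f r) (ind r n) (δ n r))) (cong (f r *_) (sym (ind-suc n r))))))) ,
  (λ r → trans (dels-++ r (replicate (f n) (add n)) cs) (cong₂ _+_ (trans (dels-replicate r (f n) (add n)) (*-zeroʳ (f n))) (z r)))

Ascending-exists : ∀ (f g : ℕ → ℕ) n → (∀ r → n ≤ r → f r ≡ 0) → (∀ r → n ≤ r → g r ≡ 0) →
                   Σ[ cs ∈ List Move ] Ascending cs × (∀ r → dels r cs ≡ f r) × (∀ r → adds r cs ≡ g r)
Ascending-exists f g n f0 g0 =
  let cs , a , d , e , z = deletions f n
      cs′ , a′ , d′ , e′ , z′ = additions g n
  in cs ++ cs′ ,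
     AllPairs.++⁺ a a′ (All.map (λ { (del _) → All.map (λ { (add _) → minus-plus }) d′ }) d) ,
     (λ r → trans (dels-++ r cs cs′) (trans (cong₂ _+_ (e r) (z′ r)) (trans (+-identityʳ _) (full f f0 r)))) ,
     (λ r → trans (adds-++ r cs cs′) (trans (cong₂ _+_ (z r) (e′ r)) (full g g0 r)))
  where
  full : ∀ (f : ℕ → ℕ) → (∀ r → n ≤ r → f r ≡ 0) → ∀ r → f r * ind r n ≡ f r
  full f f0 r with r <? n
  ... | yes r<n = trans (cong (f r *_) (ind-< r<n)) (*-identityʳ _)
  ... | no r≮n  = trans (cong (_* ind r n) (f0 r (≮⇒≥ r≮n))) (sym (f0 r (≮⇒≥ r≮n)))

-- Sequences of insertions

Antitone : (ℕ → ℕ) → Set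
Antitone α = ∀ r → α (1 + r) ≤ α r

module _ {k : ℕ} where

  data Path (T : Filling k) : List (Letter k) → List Move → Filling k → Set where
    []  : Path T [] [] T
    _∷_ : ∀ {v vs c cs U} → Moved c (sh T) (sh (T ⟵ v)) → Path (T ⟵ v) vs cs U → Path T (v ∷ vs) (c ∷ cs) U

  sh-antitone : ∀ {T : Filling k} → King T → Antitone (sh T)
  sh-antitone KT r = ≤-trans (Valid.mono (King.valid KT) (2 * k) (1 + r)) (Valid.inter (King.valid KT) (2 * k) r)

  path-King : ∀ {T vs cs U} → King T → Path T vs cs U → King U
  path-King KT []      = KT
  path-King KT (_∷_ {v = v} _ p) = path-King (Insertion.King-⟵ KT v) p

  path-exists : ∀ {T} → King T → ∀ vs → ∃[ cs ] ∃[ U ] Path T vs cs U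
  path-exists {T} KT []       = [] , T , []
  path-exists {T} KT (v ∷ vs) =
    let cs , U , p = path-exists (Insertion.King-⟵ KT v) vs in
    proj₁ (Insertion.move KT v) ∷ cs , U , Insertion.moved KT v ∷ p

  path-ascending : ∀ {T vs cs U} → King T → Path T vs cs U → Linked _≤ₗ_ vs → Linked _≤ᴹ_ cs
  path-ascending KT []           []       = []
  path-ascending KT (h ∷ [])     [-]      = [-]
  path-ascending KT (h ∷ g ∷ p) (l ∷ ls) =
    proj₁ (insertion-order KT h g) l ∷ path-ascending (Insertion.King-⟵ KT _) (g ∷ p) ls

  path-sorted : ∀ {T vs cs U} → King T → Path T vs cs U → Linked _≤ᴹ_ cs → Linked _≤ₗ_ vs
  path-sorted KT []           []       = []
  path-sorted KT (h ∷ [])     [-]      = [-]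
  path-sorted KT (h ∷ g ∷ p) (l ∷ ls) =
    proj₂ (insertion-order KT h g) l ∷ path-sorted (Insertion.King-⟵ KT _) (g ∷ p) ls

  path-shape : ∀ {T vs cs U} → Path T vs cs U → ∀ r → sh U r + dels r cs ≡ sh T r + adds r cs
  path-shape []                             r = refl
  path-shape (_∷_ {v = v} {c = c} {cs} {U} h p) r =
    lia 7 (λ t t′ u i d a e → t′ ⊕ d ≐ t ⊕ i ∷ u ⊕ e ≐ t′ ⊕ a ∷ [] ⊢ u ⊕ (d ⊕ e) ≐ t ⊕ (i ⊕ a))
      _ _ (sh U r) (inc (state c) r) (dec (state c) r) (adds r cs) (dels r cs) (h r) (path-shape p r)

  path-functional : ∀ {T vs cs U cs′ U′} → Path T vs cs U → Path T vs cs′ U′ → cs ≡ cs′ × U ≡ U′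
  path-functional []      []        = refl , refl
  path-functional (_∷_ {c = c} h p) (_∷_ {c = c′} h′ p′) with Moved-unique c c′ h h′ | path-functional p p′
  ... | refl | refl , refl = refl , refl

  path-injective : ∀ {T T′ vs vs′ cs U} → King T → King T′ → Path T vs cs U → Path T′ vs′ cs U →
                   (∀ j → sh T j ≡ sh T′ j) → T ≡ T′ × vs ≡ vs′
  path-injective KT KT′ []      []        e = refl , refl
  path-injective {T} {T′} KT KT′ (_∷_ {v = v} {c = c} h p) (_∷_ {v = v′} h′ p′) e
    with path-injective (Insertion.King-⟵ KT v) (Insertion.King-⟵ KT′ v′) p p′
           (λ j → +-cancelʳ-≡ (dec (state c) j) _ _ (trans (h j) (trans (cong (_+ inc (state c) j) (e j)) (sym (h′ j)))))
  ... | eq , refl with insertion-injective KT KT′ eq e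
  ...   | refl , refl = refl , refl

  -- Each shape from which a move starts must be a partition with at most `k` rows. The last one is
  -- left free, as it will be the shape of a given King tableau.
  Shapes : (ℕ → ℕ) → List Move → (ℕ → ℕ) → Set
  Shapes α []       β = ∀ j → β j ≡ α j
  Shapes α (c ∷ cs) β = Antitone α × (∀ r → k ≤ r → α r ≡ 0) × Σ[ α′ ∈ (ℕ → ℕ) ] Moved c α α′ × Shapes α′ cs β

  path-surjective : ∀ {U} → King U → ∀ cs {α} → Shapes α cs (sh U) →
                    ∃[ T ] ∃[ vs ] King T × Path T vs cs U × (∀ j → sh T j ≡ α j)
  path-surjective {U} KU []       s = U , [] , KU , [] , s
  path-surjective {U} KU (c ∷ cs) {α} (a , b , α′ , m , s) with path-surjective KU cs s
  ... | T′ , vs , KT′ , p , e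
    with insertion-surjective KT′ c α a b (λ j → trans (cong (_+ dec (state c) j) (e j)) (m j))
  ...   | T , v , KT , refl , e′ = T , v ∷ vs , KT ,
    (λ j → trans (cong (_+ dec (state c) j) (e j)) (trans (m j) (cong (_+ inc (state c) j) (sym (e′ j))))) ∷ p , e′

  -- `mid` is the shape between deletions and additions. A shape `γ` on the way lies between `mid`
  -- and `α`, or between `mid` and `β`, so the strip condition makes it a partition: in the first
  -- case `γ (1 + r) ≤ α (1 + r) ≤ mid r ≤ γ r`, and likewise with `β`.
  strips⇒shapes : ∀ {cs} → Ascending cs → ∀ {α mid β : ℕ → ℕ} → (∀ r → mid r + dels r cs ≡ α r) → (∀ r → mid r + adds r cs ≡ β r) →
    Antitone α → (∀ r → k ≤ r → α r ≡ 0) → (∀ r → k ≤ r → β r ≡ 0) →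
    (∀ r → α (1 + r) ≤ mid r) → (∀ r → β (1 + r) ≤ mid r) → Shapes α cs β
  strips⇒shapes [] e f a b b′ h h′ j = trans (sym (f j)) (e j)
  strips⇒shapes {del i ∷ cs} (_ ∷ p) {α} {mid} {β} e f a b b′ h h′ =
    a , b , α′ ,
    (λ r → lia 4 (λ m d x α → m ⊕ (d ⊕ x) ≐ α ∷ [] ⊢ m ⊕ x ⊕ d ≐ α ⊕ con 0) (mid r) (δ i r) (dels r cs) (α r) (e r)) ,
    strips⇒shapes p (λ r → refl) f
      (λ r → ≤-trans (α′≤ (1 + r)) (≤-trans (h r) (m≤m+n _ _)))
      (λ r k≤r → n≤0⇒n≡0 (≤-trans (α′≤ r) (≤-reflexive (b r k≤r)))) b′
      (λ r → ≤-trans (α′≤ (1 + r)) (h r)) h′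
    where
    α′ : ℕ → ℕ
    α′ r = mid r + dels r cs
    α′≤ : ∀ r → α′ r ≤ α r
    α′≤ r = lia 4 (λ m d x α → m ⊕ (d ⊕ x) ≐ α ∷ [] ⊢ m ⊕ x ≦ α) (mid r) (δ i r) (dels r cs) (α r) (e r)
  strips⇒shapes {add i ∷ cs} q@(_ ∷ p) {α} {mid} {β} e f a b b′ h h′ =
    a , b , α′ ,
    (λ r → trans (+-identityʳ _) (cong (_+ δ i r) (mid≡α r))) ,
    -- No deletions remain after an addition, so the shape just reached takes the place of `mid`.
    strips⇒shapes p {mid = α′} (λ r → trans (cong (α′ r +_) (add-first r q)) (+-identityʳ _))
      (λ r → trans (+-assoc (mid r) (δ i r) (adds r cs)) (f r))
      (λ r → ≤-trans (α′≤β (1 + r)) (≤-trans (h′ r) (m≤m+n _ _)))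
      (λ r k≤r → n≤0⇒n≡0 (≤-trans (α′≤β r) (≤-reflexive (b′ r k≤r)))) b′
      (λ r → ≤-trans (α′≤β (1 + r)) (≤-trans (h′ r) (m≤m+n _ _))) (λ r → ≤-trans (h′ r) (m≤m+n _ _))
    where
    α′ : ℕ → ℕ
    α′ r = mid r + δ i r
    α′≤β : ∀ r → α′ r ≤ β r
    α′≤β r = lia 4 (λ m d x β → m ⊕ (d ⊕ x) ≐ β ∷ [] ⊢ m ⊕ d ≦ β) (mid r) (δ i r) (adds r cs) (β r) (f r)
    mid≡α : ∀ r → mid r ≡ α r
    mid≡α r = trans (sym (trans (cong (mid r +_) (add-first r q)) (+-identityʳ _))) (e r)

  -- Ascending deletions move down the rows, so once row `1 + r` loses a box, row `r` loses none any
  -- more. Ascending additions move up, so once row `r` gains a box, row `1 + r` gains none any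
  -- more. In both cases the partition inequality at that moment gives the strip condition.
  path⇒strips : ∀ {T vs cs U} → King T → Path T vs cs U → Ascending cs → ∀ {mid : ℕ → ℕ} → (∀ r → mid r + dels r cs ≡ sh T r) →
    (∀ r → sh T (1 + r) ≤ mid r) × (∀ r → sh U (1 + r) ≤ mid r)
  path⇒strips {T} KT [] _ {mid} e =
    (λ r → ≤-trans (sh-antitone KT r) (≤-reflexive (trans (sym (e r)) (+-identityʳ _)))) ,
    (λ r → ≤-trans (sh-antitone KT r) (≤-reflexive (trans (sym (e r)) (+-identityʳ _))))
  path⇒strips {T} KT (_∷_ {v = v} {c = del i} {cs} h p) (a ∷ as) {mid} e
    with path⇒strips (Insertion.King-⟵ KT v) p as {mid}
      (λ r → lia 5 (λ m d x t t′ → m ⊕ (d ⊕ x) ≐ t ∷ t′ ⊕ d ≐ t ⊕ con 0 ∷ [] ⊢ m ⊕ x ≐ t′)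
        (mid r) (δ i r) (dels r cs) (sh T r) (sh (T ⟵ v) r) (e r) (h r))
  ... | before , after = now , after
    where
    now : ∀ r → sh T (1 + r) ≤ mid r
    now r with i ≟ 1 + r
    ... | no i≢ = ≤-trans (≤-reflexive (sym (off-minus h i≢))) (before r)
    ... | yes refl = ≤-trans (sh-antitone KT r) (≤-reflexive (trans (sym (e r)) (trans (cong (mid r +_)
        (cong₂ _+_ (δ-≢ (1+n≢n {r})) (dels-none λ {s} s∈ s≡r → later s∈ s≡r))) (+-identityʳ _))))
      where
      later : ∀ {s} → del s ∈ cs → s ≢ r
      later s∈ refl with All.lookup a s∈
      ... | minus-minus q = contradiction q (<⇒≱ (n<1+n r))
  path⇒strips {T} KT (_∷_ {v = v} {c = add i} {cs} {U} h p) q@(a ∷ as) {mid} e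
    with path⇒strips (Insertion.King-⟵ KT v) p as {sh (T ⟵ v)} (λ r → trans (cong (sh (T ⟵ v) r +_) (add-first r q)) (+-identityʳ _))
  ... | _ , after = (λ r → ≤-trans (sh-antitone KT r) (≤-reflexive (sym (mid≡ r)))) , now
    where
    mid≡ : ∀ r → mid r ≡ sh T r
    mid≡ r = trans (sym (trans (cong (mid r +_) (add-first r q)) (+-identityʳ _))) (e r)
    now : ∀ r → sh U (1 + r) ≤ mid r
    now r with i ≟ r
    ... | no i≢ = ≤-trans (after r) (≤-reflexive (trans (off-plus h i≢) (sym (mid≡ r))))
    ... | yes refl = begin
      sh U (1 + r)                                ≡⟨ +-identityʳ _ ⟨
      sh U (1 + r) + 0                            ≡⟨ cong (sh U (1 + r) +_) (add-first (1 + r) q) ⟨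
      sh U (1 + r) + dels (1 + r) cs              ≡⟨ path-shape p (1 + r) ⟩
      sh (T ⟵ v) (1 + r) + adds (1 + r) cs        ≡⟨ cong (sh (T ⟵ v) (1 + r) +_) (adds-none λ {s} s∈ → later s∈) ⟩
      sh (T ⟵ v) (1 + r) + 0                      ≡⟨ +-identityʳ _ ⟩
      sh (T ⟵ v) (1 + r)                          ≡⟨ off-plus h (λ e → 1+n≢n (sym e)) ⟩
      sh T (1 + r)                                ≤⟨ sh-antitone KT r ⟩
      sh T r                                      ≡⟨ mid≡ r ⟨
      mid r                                       ∎
      where
      open ≤-Reasoning
      later : ∀ {s} → add s ∈ cs → s ≢ 1 + r
      later s∈ refl with All.lookup a s∈
      ... | plus-plus q = contradiction q (<⇒≱ (n<1+n r))

-- Partitions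

rowLength-map : ∀ {A : Set} (X : List (List A)) j → rowLength (map length X) j ≡ length (at X j)
rowLength-map []        j       = refl
rowLength-map (row ∷ X) zero    = refl
rowLength-map (row ∷ X) (suc j) = rowLength-map X j

antitone⇒Linked : ∀ μ → Antitone (rowLength μ) → Linked _≥_ μ
antitone⇒Linked []          a = []
antitone⇒Linked (m ∷ [])    a = [-]
antitone⇒Linked (m ∷ n ∷ μ) a = a 0 ∷ antitone⇒Linked (n ∷ μ) (λ r → a (suc r))

partition-antitone : ∀ {μ} → IsPartition μ → Antitone (rowLength μ)
partition-antitone (l , _) = go l
  where
  go : ∀ {μ} → Linked _≥_ μ → Antitone (rowLength μ)
  go []      r       = z≤n
  go [-]     r       = z≤n
  go (h ∷ l) zero    = h
  go (h ∷ l) (suc r) = go l r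

positive-ext : ∀ {μ ν} → All (0 <_) μ → All (0 <_) ν → (∀ r → rowLength μ r ≡ rowLength ν r) → μ ≡ ν
positive-ext []       []       e = refl
positive-ext []       (q ∷ qs) e = contradiction (e 0) (<⇒≢ q)
positive-ext (p ∷ ps) []       e = contradiction (sym (e 0)) (<⇒≢ p)
positive-ext (p ∷ ps) (q ∷ qs) e = cong₂ _∷_ (e 0) (positive-ext ps qs (λ r → e (suc r)))

rowLength-beyond : ∀ μ {r} → length μ ≤ r → rowLength μ r ≡ 0
rowLength-beyond []      h       = refl
rowLength-beyond (m ∷ μ) (s≤s h) = rowLength-beyond μ h

rowLength-inside : ∀ {μ r} → All (0 <_) μ → r < length μ → 0 < rowLength μ r
rowLength-inside {r = zero}  (p ∷ ps) h       = p
rowLength-inside {r = suc r} (p ∷ ps) (s≤s h) = rowLength-inside ps h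

-- If `rowLength ν (1 + r)` exceeded `rowLength μ r`, the column of index `rowLength μ r` would
-- contain two boxes of the strip, in rows `r` and `1 + r`.
strip⇒ : ∀ {μ ν} → IsPartition μ → IsPartition ν → HorizontalStrip ν μ →
         (∀ r → rowLength μ r ≤ rowLength ν r) × (∀ r → rowLength ν (1 + r) ≤ rowLength μ r)
strip⇒ {μ} {ν} pμ pν (sub , one) =
  (λ r → ≮⇒≥ λ h → <-irrefl refl (sub r _ h)) ,
  (λ r → ≮⇒≥ λ h → contradiction
    (one _ r (suc r) (≤-trans h (partition-antitone pν r)) (<-irrefl refl) h (≤⇒≯ (partition-antitone pμ r))) (λ e → 1+n≢n (sym e)))

⇒strip : ∀ {μ ν} → IsPartition ν → (∀ r → rowLength μ r ≤ rowLength ν r) →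
         (∀ r → rowLength ν (1 + r) ≤ rowLength μ r) → HorizontalStrip ν μ
⇒strip {μ} {ν} pν h g = (λ r c q → ≤-trans q (h r)) , unique
  where
  decreasing : ∀ r d → rowLength ν (d + r) ≤ rowLength ν r
  decreasing r zero    = ≤-refl
  decreasing r (suc d) = ≤-trans (partition-antitone pν (d + r)) (decreasing r d)
  lower : ∀ {c r r′} → r < r′ → c < rowLength ν r′ → c < rowLength μ r
  lower {c} {r} {r′} r<r′ p = ≤-trans p (≤-trans (subst (λ n → rowLength ν n ≤ rowLength ν (suc r)) (m∸n+n≡m r<r′)
    (decreasing (suc r) (r′ ∸ suc r))) (g r))
  unique : ∀ c r r′ → ν ∋[ r , c ] → ¬ μ ∋[ r , c ] → ν ∋[ r′ , c ] → ¬ μ ∋[ r′ , c ] → r ≡ r′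
  unique c r r′ p q p′ q′ = ≤-antisym (≮⇒≥ (λ r′<r → q′ (lower r′<r p))) (≮⇒≥ (λ r<r′ → q (lower r<r′ p′)))

shape-positive : ∀ {A : Set} {X : List (List A)} → All NonEmpty X → All (0 <_) (map length X)
shape-positive []              = []
shape-positive (nonEmpty ∷ ns) = s≤s z≤n ∷ shape-positive ns

partition-exists : ∀ {f : ℕ → ℕ} n → Antitone f → (∀ r → n ≤ r → f r ≡ 0) →
                   Σ[ μ ∈ Shape ] IsPartition μ × (∀ r → rowLength μ r ≡ f r)
partition-exists {f} n a z = μ , (antitone⇒Linked μ (λ r → subst₂ _≤_ (sym (rows (1 + r))) (sym (rows r)) (a r)) ,
                                  shape-positive (mkRows-NonEmpty g n)) , rows
  where
  g : ℕ → List ℕ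
  -- The parts are written in unary, so that `mkRows` cuts off the zero parts.
  g r = List.replicate (f r) 0
  length-g : ∀ r → length (g r) ≡ f r
  length-g r = go (f r)
    where
    go : ∀ m → length (List.replicate m 0) ≡ m
    go zero    = refl
    go (suc m) = cong suc (go m)
  empty : ∀ {xs : List ℕ} → length xs ≡ 0 → xs ≡ []
  empty {[]} e = refl
  μ : Shape
  μ = map length (mkRows g n)
  rows : ∀ r → rowLength μ r ≡ f r
  rows r = trans (rowLength-map (mkRows g n) r) (trans (cong length (at-mkRows g n
    (λ j e → empty (n≤0⇒n≡0 (subst₂ _≤_ (sym (length-g (suc j))) (trans (sym (length-g j)) (cong length e)) (a j))))
    (λ j h → empty (trans (length-g j) (z j h))) r)) (length-g r))

module _ {k : ℕ} where

  shape-sh : ∀ (T : Filling k) r → rowLength (shapeOf T) r ≡ sh T r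
  shape-sh T r = trans (rowLength-map T r) (sym (count-top (at T r)))

  shape-partition : ∀ {T : Filling k} → King T → IsPartition (shapeOf T)
  shape-partition {T} KT =
    antitone⇒Linked (shapeOf T) (λ r → subst₂ _≤_ (sym (shape-sh T (1 + r))) (sym (shape-sh T r)) (sh-antitone KT r)) ,
    shape-positive (King.non-empty KT)

  bounded-sh : ∀ {T : Filling k} → King T → ∀ r → k ≤ r → sh T r ≡ 0
  bounded-sh KT r k≤r = Valid.king (King.valid KT) (2 * k) r (*-monoʳ-≤ 2 k≤r)

-- King tableaux

  lookup-at : ∀ (T : Filling k) r → lookup T r ≡ at T (toℕ r)
  lookup-at (row ∷ T) Fin.zero    = refl
  lookup-at (row ∷ T) (Fin.suc r) = lookup-at T r

  King⇒KingTableau : ∀ {T : Filling k} {μ} → King T → shapeOf T ≡ μ → KingTableau k μ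
  King⇒KingTableau {T} KT e = record
    { filling = T
    ; shape   = e
    ; rows    = All.map AllPairs⇒Linked (King.sorted KT)
    ; columns = columns T (King.sorted KT) (Valid.inter (King.valid KT))
    ; bounded = λ r → subst (All (λ x → 2 * toℕ r ≤ rank x)) (sym (lookup-at T r))
                  (count≡0 (at T (toℕ r)) (Valid.king (King.valid KT) (2 * toℕ r) (toℕ r) ≤-refl))
    }
    where
    columns : ∀ T → All Sorted T → Interlacing T → Linked Below T
    columns []              _            h = []
    columns (row ∷ [])      _            h = [-]
    columns (row ∷ row′ ∷ T) (s ∷ s′ ∷ ss) h =
      counts⇒Below s s′ (λ m → h m 0) ∷ columns (row′ ∷ T) (s′ ∷ ss) (λ m j → h m (suc j))

  KingTableau⇒King : ∀ {μ} → IsPartition μ → (K : KingTableau k μ) → King (KingTableau.filling K)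
  KingTableau⇒King {μ} (_ , positive) K = record
    { sorted    = All.map (Linked⇒AllPairs ≤-trans) rows
    ; non-empty = non-empty filling (subst (All (0 <_)) (sym shape) positive)
    ; valid     = record { mono = λ m r → count-mono (n≤1+n m) (at filling r) ; inter = inter filling columns ; king = king }
    }
    where
    open KingTableau K
    non-empty : ∀ (T : Filling k) → All (0 <_) (shapeOf T) → All NonEmpty T
    non-empty []            _        = []
    non-empty ((x ∷ xs) ∷ T) (p ∷ ps) = nonEmpty ∷ non-empty T ps
    inter : ∀ T → Linked Below T → Interlacing T
    inter []               _       m j       = z≤n
    inter (row ∷ [])       _       m j       = z≤n
    inter (row ∷ row′ ∷ T) (b ∷ l) m zero    = Below⇒counts b m
    inter (row ∷ row′ ∷ T) (b ∷ l) m (suc j) = inter (row′ ∷ T) l m j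
    at-beyond : ∀ (T : Filling k) {j} → length T ≤ j → at T j ≡ []
    at-beyond []        h       = refl
    at-beyond (row ∷ T) (s≤s h) = at-beyond T h
    king : ∀ m r → m ≤ 2 * r → counts filling m r ≡ 0
    king m r h with r <? length filling
    ... | no r≮ = cong (count m) (at-beyond filling (≮⇒≥ r≮))
    ... | yes r< = count-none (All.map (≤-trans (subst (λ n → m ≤ 2 * n) (sym (Fin.toℕ-fromℕ< r<)) h))
      (subst (All _) (trans (lookup-at filling (Fin.fromℕ< r<)) (cong (at filling) (Fin.toℕ-fromℕ< r<))) (bounded (Fin.fromℕ< r<))))

-- Recording changes

-- `record-change` for row lengths given as functions, so that shapes may be exchanged for pointwise
-- equal ones.
change-at : ℕ → (α β : ℕ → ℕ) → MultisetTableau → MultisetTableau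
change-at u α β M r c i = if (u ≡ᵇ i) ∧ ((c <ᵇ α r) xor (c <ᵇ β r)) then suc (M r c i) else M r c i

change-at-resp : ∀ u α β M N → M ≋ N → change-at u α β M ≋ change-at u α β N
change-at-resp u α β M N e r c i rewrite e r c i = refl

change-at-shape : ∀ u α α′ β β′ M → (∀ r → α r ≡ α′ r) → (∀ r → β r ≡ β′ r) →
                  change-at u α β M ≋ change-at u α′ β′ M
change-at-shape u α α′ β β′ M e f r c i rewrite e r | f r = refl

change-at-refl : ∀ u α M → change-at u α α M ≋ M
change-at-refl u α M r c i with u ≡ᵇ i | c <ᵇ α r
... | false | _     = refl
... | true  | false = refl
... | true  | true  = refl

<ᵇ-mono : ∀ c {m n} → m ≤ n → (c <ᵇ m) ≡ true → (c <ᵇ n) ≡ true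
<ᵇ-mono c {m} {n} h e with c <ᵇ n in eq
... | true  = refl
... | false = contradiction (<⇒<ᵇ (≤-trans (<ᵇ⇒< c m (subst Bool.T (sym e) tt)) h)) (subst Bool.T eq)

-- Along a monotone sequence of shapes a box changes at most once, so two records with the same
-- number merge into one.
change-at-trans : ∀ u α β γ M → (∀ r → (α r ≤ β r × β r ≤ γ r) ⊎ (γ r ≤ β r × β r ≤ α r)) →
                  change-at u β γ (change-at u α β M) ≋ change-at u α γ M
change-at-trans u α β γ M h r c i with u ≡ᵇ i
... | false = refl
... | true with c <ᵇ α r in a | c <ᵇ β r in b | c <ᵇ γ r in d | h r
...   | false | false | false | _ = refl
...   | false | false | true  | _ = refl
...   | false | true  | true  | _ = refl
...   | true  | false | false | _ = refl
...   | true  | true  | false | _ = refl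
...   | true  | true  | true  | _ = refl
...   | false | true  | false | inj₁ (_ , q) = contradiction (trans (sym (<ᵇ-mono c q b)) d) λ ()
...   | false | true  | false | inj₂ (_ , q) = contradiction (trans (sym (<ᵇ-mono c q b)) a) λ ()
...   | true  | false | true  | inj₁ (q , _) = contradiction (trans (sym (<ᵇ-mono c q a)) b) λ ()
...   | true  | false | true  | inj₂ (q , _) = contradiction (trans (sym (<ᵇ-mono c q d)) b) λ ()

module _ {k : ℕ} where

  insertAll-++ : ∀ P Q (w w′ : List (Fin k × Letter k)) →
    insertAll P Q (w ++ w′) ≡ insertAll (proj₁ (insertAll P Q w)) (proj₂ (insertAll P Q w)) w′
  insertAll-++ P Q []            w′ = refl
  insertAll-++ P Q ((u , v) ∷ w) w′ = insertAll-++ (P ⟵ v) _ w w′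

  insertAll-path : ∀ {T vs cs U} (u : Fin k) Q → Path T vs cs U → proj₁ (insertAll T Q (map (u ,_) vs)) ≡ U
  insertAll-path u Q []      = refl
  insertAll-path u Q (h ∷ p) = insertAll-path u _ p

  -- Insertions with the same `u` first shrink the shape to `mid` and then enlarge it. Each phase is
  -- monotone, so its single records merge, leaving the two records of `encode`.
  path-record : ∀ {T vs cs U} (u : Fin k) M → Path T vs cs U → Ascending cs → ∀ (mid : ℕ → ℕ) → (∀ r → mid r + dels r cs ≡ sh T r) →
    proj₂ (insertAll T M (map (u ,_) vs)) ≋ change-at (toℕ u) mid (sh U) (change-at (toℕ u) (sh T) mid M)
  path-record {T} u M [] _ mid e r c n = begin
    M r c n                                               ≡⟨ change-at-refl i (sh T) M r c n ⟨
    change-at i (sh T) (sh T) M r c n                     ≡⟨ change-at-shape i (sh T) (sh T) mid (sh T) M (λ _ → refl) mid≡ r c n ⟨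
    change-at i (sh T) mid M r c n                        ≡⟨ change-at-refl i (sh T) (change-at i (sh T) mid M) r c n ⟨
    change-at i (sh T) (sh T) (change-at i (sh T) mid M) r c n
      ≡⟨ change-at-shape i mid (sh T) (sh T) (sh T) (change-at i (sh T) mid M) mid≡ (λ _ → refl) r c n ⟨
    change-at i mid (sh T) (change-at i (sh T) mid M) r c n ∎
    where
    open ≡-Reasoning
    i = toℕ u
    mid≡ : ∀ r → mid r ≡ sh T r
    mid≡ r = trans (sym (+-identityʳ _)) (e r)
  path-record {T} {U = U} u M (_∷_ {v = v} {vs} {c = del j} {cs} h p) (a ∷ as) mid e r c n = begin
    proj₂ (insertAll T′ M₁ (map (u ,_) vs)) r c n         ≡⟨ path-record u M₁ p as mid e′ r c n ⟩
    change-at i mid (sh U) (change-at i (sh T′) mid M₁) r c n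
      ≡⟨ change-at-resp i mid (sh U) (change-at i (sh T′) mid M₁) (change-at i (sh T) mid M) merged r c n ⟩
    change-at i mid (sh U) (change-at i (sh T) mid M) r c n ∎
    where
    open ≡-Reasoning
    i = toℕ u
    T′ = T ⟵ v
    M₁ M₂ : MultisetTableau
    M₁ = record-change i (shapeOf T) (shapeOf T′) M
    M₂ = change-at i (sh T) (sh T′) M
    e′ : ∀ r → mid r + dels r cs ≡ sh T′ r
    e′ r = lia 5 (λ m d x t t′ → m ⊕ (d ⊕ x) ≐ t ∷ t′ ⊕ d ≐ t ⊕ con 0 ∷ [] ⊢ m ⊕ x ≐ t′)
      (mid r) (δ j r) (dels r cs) (sh T r) (sh T′ r) (e r) (h r)
    merged : change-at i (sh T′) mid M₁ ≋ change-at i (sh T) mid M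
    merged r c n = begin
      change-at i (sh T′) mid M₁ r c n
        ≡⟨ change-at-resp i (sh T′) mid M₁ M₂
             (change-at-shape i (rowLength (shapeOf T)) (sh T) (rowLength (shapeOf T′)) (sh T′) M (shape-sh T) (shape-sh T′)) r c n ⟩
      change-at i (sh T′) mid M₂ r c n
        ≡⟨ change-at-trans i (sh T) (sh T′) mid M (λ r → inj₂
             ( ≤-trans (m≤m+n (mid r) _) (≤-reflexive (e′ r))
             , ≤-trans (m≤m+n (sh T′ r) (δ j r)) (≤-reflexive (trans (h r) (+-identityʳ _))))) r c n ⟩
      change-at i (sh T) mid M r c n ∎
  path-record {T} {U = U} u M (_∷_ {v = v} {vs} {c = add j} {cs} h p) q@(a ∷ as) mid e r c n = begin
    proj₂ (insertAll T′ M₁ (map (u ,_) vs)) r c n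
      ≡⟨ path-record u M₁ p as (sh T′) (λ r → trans (cong (sh T′ r +_) (add-first r q)) (+-identityʳ _)) r c n ⟩
    change-at i (sh T′) (sh U) (change-at i (sh T′) (sh T′) M₁) r c n
      ≡⟨ change-at-resp i (sh T′) (sh U) (change-at i (sh T′) (sh T′) M₁) M₁ (change-at-refl i (sh T′) M₁) r c n ⟩
    change-at i (sh T′) (sh U) M₁ r c n
      ≡⟨ change-at-resp i (sh T′) (sh U) M₁ M₂
           (change-at-shape i (rowLength (shapeOf T)) (sh T) (rowLength (shapeOf T′)) (sh T′) M (shape-sh T) (shape-sh T′)) r c n ⟩
    change-at i (sh T′) (sh U) M₂ r c n
      ≡⟨ change-at-trans i (sh T) (sh T′) (sh U) M (λ r → inj₁
           ( ≤-trans (m≤m+n (sh T r) (δ j r)) (≤-reflexive (trans (sym (h r)) (+-identityʳ _)))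
           , ≤-trans (m≤m+n (sh T′ r) (adds r cs)) (≤-reflexive (trans (sym (path-shape p r))
               (trans (cong (sh U r +_) (add-first r q)) (+-identityʳ _)))))) r c n ⟩
    change-at i (sh T) (sh U) M r c n
      ≡⟨ change-at-resp i (sh T) (sh U) (change-at i (sh T) mid M) M still r c n ⟨
    change-at i (sh T) (sh U) (change-at i (sh T) mid M) r c n
      ≡⟨ change-at-shape i mid (sh T) (sh U) (sh U) (change-at i (sh T) mid M) mid≡ (λ _ → refl) r c n ⟨
    change-at i mid (sh U) (change-at i (sh T) mid M) r c n ∎
    where
    open ≡-Reasoning
    i = toℕ u
    T′ = T ⟵ v
    M₁ M₂ : MultisetTableau
    M₁ = record-change i (shapeOf T) (shapeOf T′) M
    M₂ = change-at i (sh T) (sh T′) M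
    mid≡ : ∀ r → mid r ≡ sh T r
    mid≡ r = trans (sym (trans (cong (mid r +_) (add-first r q)) (+-identityʳ _))) (e r)
    still : change-at i (sh T) mid M ≋ M
    still r c n = trans (change-at-shape i (sh T) (sh T) mid (sh T) M (λ _ → refl) mid≡ r c n) (change-at-refl i (sh T) M r c n)

-- Arrays and oscillating tableaux

  Columns : Set
  Columns = List (Fin k × Letter k)

  Below-step : ℕ → Columns → Set
  Below-step i = All (λ p → toℕ (proj₁ p) < i)

  -- T and S are the P- and Q-tableaux of w.
  data Trace : (i : ℕ) → Columns → Filling k → ∀ {μ} → SSOT i μ → Set where
    start : Trace 0 [] [] start
    next  : ∀ {i w T μ U ν μ′ vs cs} {S : SSOT i μ} {p h p′ h′} → Trace i w T S → (u : Fin k) → toℕ u ≡ i →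
            Path T vs cs U → Ascending cs → (∀ r → rowLength μ′ r + dels r cs ≡ sh T r) →
            (∀ r → rowLength ν r ≡ sh U r) → Trace (suc i) (w ++ map (u ,_) vs) U (step S μ′ p h ν p′ h′)

  King-[] : King {k} []
  King-[] = record { sorted = [] ; non-empty = [] ; valid = record
    { mono = λ _ _ → z≤n ; inter = λ _ _ → z≤n ; king = λ _ _ _ → refl } }

  trace-King : ∀ {i w T μ} {S : SSOT i μ} → Trace i w T S → King T
  trace-King start                  = King-[]
  trace-King (next t u e p a m n) = path-King (trace-King t) p

  trace-shape : ∀ {i w T μ} {S : SSOT i μ} → Trace i w T S → ∀ r → rowLength μ r ≡ sh T r
  trace-shape start                  r = refl
  trace-shape (next t u e p a m n) r = n r

  trace-below : ∀ {i w T μ} {S : SSOT i μ} → Trace i w T S → Below-step i w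
  trace-below start = []
  trace-below (next t u refl p a m n) =
    All.++⁺ (All.map m<n⇒m<1+n (trace-below t)) (All.map⁺ (All.universal (λ _ → n<1+n _) _))

  split-unique : ∀ {u u′ : Fin k} → u ≡ u′ → ∀ w w′ {vs vs′} → Below-step (toℕ u) w → Below-step (toℕ u) w′ →
                 w ++ map (u ,_) vs ≡ w′ ++ map (u′ ,_) vs′ → w ≡ w′ × vs ≡ vs′
  split-unique refl [] [] {[]}     {[]}       _ _ e = refl , refl
  split-unique refl [] [] {[]}     {v′ ∷ vs′} _ _ ()
  split-unique refl [] [] {v ∷ vs} {[]}       _ _ ()
  split-unique refl [] [] {v ∷ vs} {v′ ∷ vs′} _ _ e with ∷-injective e
  ... | refl , e′ = refl , cong (v ∷_) (proj₂ (split-unique refl [] [] [] [] e′))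
  split-unique refl [] (x ∷ w′) {[]}     _ _       ()
  split-unique refl [] (x ∷ w′) {v ∷ vs} _ (h ∷ _) e with ∷-injective e
  ... | refl , _ = contradiction h (<-irrefl refl)
  split-unique refl (x ∷ w) [] {_} {[]}     _       _ ()
  split-unique refl (x ∷ w) [] {_} {v ∷ vs} (h ∷ _) _ e with ∷-injective e
  ... | refl , _ = contradiction h (<-irrefl refl)
  split-unique refl (x ∷ w) (x′ ∷ w′) (_ ∷ h) (_ ∷ h′) e with ∷-injective e
  ... | refl , e′ with split-unique refl w w′ h h′ e′
  ...   | refl , e″ = refl , e″

  trace-functional : ∀ {i w w′ T T′ μ μ′} {S : SSOT i μ} {S′ : SSOT i μ′} → Trace i w T S → Trace i w′ T′ S′ →
                     w ≡ w′ → T ≡ T′ × sequence S ≡ sequence S′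
  trace-functional start start refl = refl , refl
  trace-functional {S = step _ μ′ pμ′ _ ν pν _} {S′ = step _ μ″ pμ″ _ ν′ pν′ _}
    (next {w = w} {cs = cs} t u refl p a m n) (next {w = w′} t′ u′ e′ p′ a′ m′ n′) eq
    with split-unique (sym (Fin.toℕ-injective e′)) w w′ (trace-below t) (trace-below t′) eq
  ... | refl , refl with trace-functional t t′ refl
  ...   | refl , eqS with path-functional p p′
  ...     | refl , refl = refl , cong₂ _∷_ (positive-ext (proj₂ pν) (proj₂ pν′) (λ r → trans (n r) (sym (n′ r))))
    (cong₂ _∷_ (positive-ext (proj₂ pμ′) (proj₂ pμ″) (λ r → +-cancelʳ-≡ (dels r cs) _ _ (trans (m r) (sym (m′ r))))) eqS)

  sequence-shape : ∀ {i μ μ′} (S : SSOT i μ) (S′ : SSOT i μ′) → sequence S ≡ sequence S′ → μ ≡ μ′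
  sequence-shape start             start             e = refl
  sequence-shape (step _ _ _ _ _ _ _) (step _ _ _ _ _ _ _) e = proj₁ (∷-injective e)

  trace-injective : ∀ {i w w′ T T′ μ μ′} {S : SSOT i μ} {S′ : SSOT i μ′} → Trace i w T S → Trace i w′ T′ S′ →
                    T ≡ T′ → sequence S ≡ sequence S′ → w ≡ w′
  trace-injective start start refl e = refl
  trace-injective {S = step S₀ μ′ pμ′ _ ν pν _} {S′ = step S₁ μ″ pμ″ _ ν′ pν′ _}
    (next {T = T₀} {U = U} {cs = cs} t u refl p a m n) (next {T = T₁} {cs = cs′} t′ u′ e′ p′ a′ m′ n′) refl eq
    with ∷-injective eq
  ... | refl , eq′ with ∷-injective eq′
  ...   | refl , eqS with sequence-shape S₀ S₁ eqS | Fin.toℕ-injective e′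
  ...     | refl | refl with Ascending-unique a a′ same-dels same-adds
    where
    same-sh : ∀ r → sh T₀ r ≡ sh T₁ r
    same-sh r = trans (sym (trace-shape t r)) (trace-shape t′ r)
    same-dels : ∀ r → dels r cs ≡ dels r cs′
    same-dels r = +-cancelˡ-≡ (rowLength μ′ r) _ _ (trans (m r) (trans (same-sh r) (sym (m′ r))))
    same-adds : ∀ r → adds r cs ≡ adds r cs′
    same-adds r = +-cancelˡ-≡ (sh T₀ r) _ _ (trans (sym (path-shape p r)) (trans (cong (sh U r +_) (same-dels r))
      (trans (path-shape p′ r) (cong (_+ adds r cs′) (sym (same-sh r))))))
  ...       | refl with path-injective (trace-King t) (trace-King t′) p p′ (λ r → trans (sym (trace-shape t r)) (trace-shape t′ r))
  ...         | refl , refl = cong (_++ map (u ,_) _) (trace-injective t t′ refl eqS)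

  SSOT-partition : ∀ {i μ} → SSOT i μ → IsPartition μ
  SSOT-partition start                = [] , []
  SSOT-partition (step _ _ _ _ _ p _) = p

  -- Deleting boxes creates no row, and adding a horizontal strip creates at most one.
  SSOT-bounded : ∀ {i μ} → SSOT i μ → ∀ r → i ≤ r → rowLength μ r ≡ 0
  SSOT-bounded start r h = refl
  SSOT-bounded (step S μ′ p h ν p′ h′) (suc r) (s≤s i≤r) = n≤0⇒n≡0 (≤-trans (proj₂ (strip⇒ p p′ h′) r)
    (≤-trans (proj₁ (strip⇒ p (SSOT-partition S) h) r) (≤-reflexive (SSOT-bounded S r i≤r))))

  -- The two strips of the last step give the multiplicities of its moves, and the ascending order
  -- is the only one a sorted array allows. Undoing these moves from the tableau leads back to the
  -- end of the previous step.
  trace-surjective : ∀ {i μ} → i ≤ k → (S : SSOT i μ) → ∀ {T} → King T → (∀ r → sh T r ≡ rowLength μ r) →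
                     ∃[ w ] AllPairs _≼_ w × Trace i w T S
  trace-surjective i≤k start {[]} KT e = [] , [] , start
  trace-surjective i≤k start {[] ∷ T} KT e with King.non-empty KT
  ... | () ∷ _
  trace-surjective i≤k start {(x ∷ xs) ∷ T} KT e = contradiction (trans (sym (count-top (x ∷ xs))) (e 0)) λ ()
  trace-surjective {suc i} i<k (step {μ = μ} S μ′ p h ν p′ h′) {U} KU e
    with Ascending-exists (λ r → rowLength μ r ∸ rowLength μ′ r) (λ r → rowLength ν r ∸ rowLength μ′ r) k
           (λ r k≤r → trans (cong (_∸ rowLength μ′ r) (SSOT-bounded S r (≤-trans (<⇒≤ i<k) k≤r))) (0∸n≡0 (rowLength μ′ r)))
           (λ r k≤r → trans (cong (_∸ rowLength μ′ r) (SSOT-bounded (step S μ′ p h ν p′ h′) r (≤-trans i<k k≤r))) (0∸n≡0 (rowLength μ′ r)))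
  ... | cs , a , d , f
    with path-surjective KU cs (strips⇒shapes a {mid = rowLength μ′} {β = sh U}
           (λ r → trans (cong (rowLength μ′ r +_) (d r)) (m+[n∸m]≡n (proj₁ (strip⇒ p (SSOT-partition S) h) r)))
           (λ r → trans (cong (rowLength μ′ r +_) (f r)) (trans (m+[n∸m]≡n (proj₁ (strip⇒ p p′ h′) r)) (sym (e r))))
           (partition-antitone (SSOT-partition S)) (λ r k≤r → SSOT-bounded S r (≤-trans (<⇒≤ i<k) k≤r))
           (bounded-sh KU) (proj₂ (strip⇒ p (SSOT-partition S) h))
           (λ r → ≤-trans (≤-reflexive (e (1 + r))) (proj₂ (strip⇒ p p′ h′) r)))
  ...   | T , vs , KT , path , eT with trace-surjective (<⇒≤ i<k) S KT eT
  ...     | w , sorted , t = w ++ map (u ,_) vs ,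
    AllPairs.++⁺ sorted
      (AllPairs.map⁺ (AllPairs.map (λ v≤v′ → ≤-refl , λ _ → v≤v′)
        (Linked⇒AllPairs ≤-trans (path-sorted KT path (AllPairs⇒Linked a)))))
      (All.map (λ {x} x<i → All.map⁺ (All.universal (λ v → below x<i , λ e′ → contradiction (cong toℕ e′) (<⇒≢ (above x<i))) vs))
        (trace-below t)) ,
    next t u toℕ-u path a
      (λ r → trans (cong (rowLength μ′ r +_) (d r))
        (trans (m+[n∸m]≡n (proj₁ (strip⇒ p (SSOT-partition S) h) r)) (sym (eT r))))
      (λ r → sym (e r))
    where
    u = Fin.fromℕ< i<k
    toℕ-u : toℕ u ≡ i
    toℕ-u = Fin.toℕ-fromℕ< i<k
    above : ∀ {n} → n < i → n < toℕ u
    above h = subst (_ <_) (sym toℕ-u) h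
    below : ∀ {n} → n < i → n ≤ toℕ u
    below h = <⇒≤ (above h)

  split-last : ∀ (u : Fin k) w → AllPairs _≼_ w → Below-step (suc (toℕ u)) w →
    ∃[ w₁ ] ∃[ vs ] w ≡ w₁ ++ map (u ,_) vs × Below-step (toℕ u) w₁ × AllPairs _≼_ w₁ × AllPairs _≤ₗ_ vs
  split-last u [] _ _ = [] , [] , refl , [] , [] , []
  split-last u ((u′ , v) ∷ w) (s ∷ ss) (b ∷ bs) with split-last u w ss bs | toℕ u′ <? toℕ u
  ... | w₁ , vs , refl , b₁ , s₁ , sv | yes h = (u′ , v) ∷ w₁ , vs , refl , h ∷ b₁ , All.++⁻ˡ w₁ s ∷ s₁ , sv
  ... | w₁ , vs , refl , b₁ , s₁ , sv | no ¬h with Fin.toℕ-injective (≤-antisym (s≤s⁻¹ b) (≮⇒≥ ¬h))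
  split-last u ((u , v) ∷ .(w₁ ++ map (u ,_) vs)) (s ∷ ss) (b ∷ bs) | w₁ , vs , refl , b₁ , s₁ , sv | no ¬h | refl
    with w₁ | b₁ | s
  ... | []     | _     | s = [] , v ∷ vs , refl , [] , [] , All.map (λ q → proj₂ q refl) (All.map⁻ s) ∷ sv
  ... | y ∷ _ | y<u ∷ _ | (u≤y , _) ∷ _ = contradiction y<u (≤⇒≯ u≤y)

  path-dels : ∀ {T vs cs U} → King T → Path {k} T vs cs U → Ascending cs → ∀ r → dels r cs ≤ sh T r
  path-dels KT [] _ r = z≤n
  path-dels {T} KT (_∷_ {v = v} {c = del j} {cs} h p) (_ ∷ a) r =
    lia 4 (λ t t′ d x → t′ ⊕ d ≐ t ⊕ con 0 ∷ x ≦ t′ ∷ [] ⊢ d ⊕ x ≦ t) (sh T r) (sh (T ⟵ v) r) (δ j r) (dels r cs)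
      (h r) (path-dels (Insertion.King-⟵ KT v) p a r)
  path-dels KT (_∷_ {c = add j} h p) a r = ≤-trans (≤-reflexive (add-first r a)) z≤n

  Traced : ℕ → Set
  Traced i = ∀ w → AllPairs _≼_ w → Below-step i w →
    ∃[ T ] Σ[ S ∈ SSOT i (shapeOf T) ] Trace i w T S × proj₁ (insertAll [] ∅ₘ w) ≡ T × encode S ≋ proj₂ (insertAll [] ∅ₘ w)

  traced-suc : ∀ (u : Fin k) → Traced (toℕ u) → Traced (suc (toℕ u))
  traced-suc u ih w sorted below with split-last u w sorted below
  ... | w₁ , vs , refl , b₁ , s₁ , sv with ih w₁ s₁ b₁
  ...   | T , S , t , eT , eS with path-exists (trace-King t) vs
  ...     | cs , U , path with Linked⇒AllPairs (λ {c} {d} {e} → ≤ᴹ-trans {c} {d} {e}) (path-ascending (trace-King t) path (AllPairs⇒Linked sv))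
  -- All deletions precede the additions, so the shape between them is that of `T` diminished by the
  -- deletions.
  ...       | a with path⇒strips (trace-King t) path a {λ r → sh T r ∸ dels r cs}
                       (λ r → m∸n+n≡m (path-dels (trace-King t) path a r))
  ...         | strip₁ , strip₂ with partition-exists k (λ r → ≤-trans (m∸n≤m (sh T (1 + r)) (dels (1 + r) cs)) (strip₁ r))
    (λ r k≤r → n≤0⇒n≡0 (≤-trans (m∸n≤m (sh T r) (dels r cs)) (≤-reflexive (bounded-sh (trace-King t) r k≤r))))
  ...           | μ′ , pμ′ , rows = U ,
    step S μ′ pμ′
      (⇒strip {μ′} (SSOT-partition S)
        (λ r → ≤-trans (≤-reflexive (rows r)) (≤-trans (m∸n≤m (sh T r) (dels r cs)) (≤-reflexive (sym (shape-sh T r)))))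
        (λ r → ≤-trans (≤-reflexive (shape-sh T (1 + r))) (≤-trans (strip₁ r) (≤-reflexive (sym (rows r))))))
      (shapeOf U) (shape-partition (path-King (trace-King t) path))
      (⇒strip {μ′} (shape-partition (path-King (trace-King t) path))
        (λ r → lia 6 (λ m t u d a n → m ⊕ d ≐ t ∷ u ⊕ d ≐ t ⊕ a ∷ n ≐ u ∷ [] ⊢ m ≦ n)
          (rowLength μ′ r) (sh T r) (sh U r) (dels r cs) (adds r cs) (rowLength (shapeOf U) r)
          (mid r) (path-shape path r) (shape-sh U r))
        (λ r → ≤-trans (≤-reflexive (shape-sh U (1 + r))) (≤-trans (strip₂ r) (≤-reflexive (sym (rows r)))))) ,
    next t u refl path a mid (shape-sh U) ,
    trans (cong proj₁ (insertAll-++ [] ∅ₘ w₁ (map (u ,_) vs)))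
      (trans (cong (λ P → proj₁ (insertAll P Q₁ (map (u ,_) vs))) eT) (insertAll-path u Q₁ path)) ,
    recorded
    where
    Q₁ : MultisetTableau
    Q₁ = proj₂ (insertAll [] ∅ₘ w₁)
    mid : ∀ r → rowLength μ′ r + dels r cs ≡ sh T r
    mid r = trans (cong (_+ dels r cs) (rows r)) (m∸n+n≡m (path-dels (trace-King t) path a r))

    recorded : change-at (toℕ u) (rowLength μ′) (rowLength (shapeOf U)) (change-at (toℕ u) (rowLength (shapeOf T)) (rowLength μ′) (encode S))
               ≋ proj₂ (insertAll [] ∅ₘ (w₁ ++ map (u ,_) vs))
    recorded rewrite insertAll-++ [] ∅ₘ w₁ (map (u ,_) vs) | eT = λ r c n → begin
      change-at i (rowLength μ′) (rowLength (shapeOf U)) (change-at i (rowLength (shapeOf T)) (rowLength μ′) (encode S)) r c n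
        ≡⟨ change-at-shape i (rowLength μ′) (rowLength μ′) (rowLength (shapeOf U)) (sh U)
             (change-at i (rowLength (shapeOf T)) (rowLength μ′) (encode S)) (λ _ → refl) (shape-sh U) r c n ⟩
      change-at i (rowLength μ′) (sh U) (change-at i (rowLength (shapeOf T)) (rowLength μ′) (encode S)) r c n
        ≡⟨ change-at-resp i (rowLength μ′) (sh U) (change-at i (rowLength (shapeOf T)) (rowLength μ′) (encode S))
             (change-at i (sh T) (rowLength μ′) (encode S))
             (change-at-shape i (rowLength (shapeOf T)) (sh T) (rowLength μ′) (rowLength μ′) (encode S) (shape-sh T) (λ _ → refl)) r c n ⟩
      change-at i (rowLength μ′) (sh U) (change-at i (sh T) (rowLength μ′) (encode S)) r c n
        ≡⟨ change-at-resp i (rowLength μ′) (sh U) (change-at i (sh T) (rowLength μ′) (encode S)) (change-at i (sh T) (rowLength μ′) Q₁)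
             (change-at-resp i (sh T) (rowLength μ′) (encode S) Q₁ eS) r c n ⟩
      change-at i (rowLength μ′) (sh U) (change-at i (sh T) (rowLength μ′) Q₁) r c n
        ≡⟨ path-record u Q₁ path a (rowLength μ′) mid r c n ⟨
      proj₂ (insertAll T Q₁ (map (u ,_) vs)) r c n ∎
      where
      open ≡-Reasoning
      i = toℕ u

  traced : ∀ i → i ≤ k → Traced i
  traced zero    h []       _ _        = [] , start , start , refl , λ _ _ _ → refl
  traced zero    h (x ∷ w)  _ (() ∷ _)
  traced (suc i) h = subst Traced (cong suc e) (traced-suc (Fin.fromℕ< h) (subst Traced (sym e) (traced i (<⇒≤ h))))
    where
    e : toℕ (Fin.fromℕ< h) ≡ i
    e = Fin.toℕ-fromℕ< h

  -- Assembling the bijection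

  ≼-trans : ∀ {x y z : Fin k × Letter k} → x ≼ y → y ≼ z → x ≼ z
  ≼-trans {x} {y} {z} (p , f) (q , g) = ≤-trans p q , λ e →
    let e′ = Fin.toℕ-injective (≤-antisym p (subst (λ u → toℕ (proj₁ y) ≤ toℕ u) (sym e) q)) in
    ≤-trans (f e′) (g (trans (sym e′) e))

  _≼?_ : ∀ (x y : Fin k × Letter k) → Dec (x ≼ y)
  (u , v) ≼? (u′ , v′) = (toℕ u ≤? toℕ u′) ×-dec ((u Fin.≟ u′) →-dec (rank v ≤? rank v′))

  trace-of : ∀ w → Linked _≼_ w →
    ∃[ T ] Σ[ S ∈ SSOT k (shapeOf T) ] Trace k w T S × proj₁ (insertAll [] ∅ₘ w) ≡ T × encode S ≋ proj₂ (insertAll [] ∅ₘ w)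
  trace-of w sorted = traced k ≤-refl w
    (Linked⇒AllPairs (λ {x} {y} {z} → ≼-trans {x} {y} {z}) sorted) (All.universal (λ p → Fin.toℕ<n (proj₁ p)) w)

  pair : ∀ w → Linked _≼_ w → TableauPair k
  pair w sorted with trace-of w sorted
  ... | T , S , t , _ = record
    { shape     = shapeOf T
    ; partition = shape-partition KT
    ; rows≤k    = ≮⇒≥ λ k< → <-irrefl (sym (trans (shape-sh T k) (bounded-sh KT k ≤-refl)))
                    (rowLength-inside (shape-positive (King.non-empty KT)) k<)
    ; king      = King⇒KingTableau KT refl
    ; ssot      = S
    }
    where KT = trace-King t

  pair-trace : ∀ w sorted → let open TableauPair (pair w sorted) in
    Trace k w filling ssot × filling ≡ proj₁ (insertAll [] ∅ₘ w) × encode ssot ≋ proj₂ (insertAll [] ∅ₘ w)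
  pair-trace w sorted with trace-of w sorted
  ... | T , S , t , e , f = t , sym e , f

  -- The proof of sortedness is recomputed, so that the image only depends on the columns.
  Φ : (w : Columns) → .(Linked _≼_ w) → TableauPair k
  Φ w sorted = pair w (recompute (Linked.linked? _≼?_ w) sorted)

  Φ-trace : ∀ w .(sorted : Linked _≼_ w) → let open TableauPair (Φ w sorted) in
    Trace k w filling ssot × filling ≡ proj₁ (insertAll [] ∅ₘ w) × encode ssot ≋ proj₂ (insertAll [] ∅ₘ w)
  Φ-trace w sorted = pair-trace w (recompute (Linked.linked? _≼?_ w) sorted)

  content : TableauPair k → Shape × Filling k × List Shape
  content p = let open TableauPair p in shape , filling , sequence ssot

  Φ-cong : ∀ {w w′} → w ≡ w′ → .(s : Linked _≼_ w) .(s′ : Linked _≼_ w′) → content (Φ w s) ≡ content (Φ w′ s′)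
  Φ-cong refl s s′ = refl

  Φ-surjective : ∀ p → Σ[ w ∈ Columns ] Σ[ s ∈ Linked _≼_ w ] content (Φ w s) ≡ content p
  Φ-surjective p
    with trace-surjective ≤-refl (TableauPair.ssot p) (KingTableau⇒King (TableauPair.partition p) (TableauPair.king p))
           (λ r → trans (sym (shape-sh (TableauPair.filling p) r))
             (cong (λ μ → rowLength μ r) (KingTableau.shape (TableauPair.king p))))
  ... | w , s , t with AllPairs⇒Linked s
  ...   | s′ with trace-functional (proj₁ (Φ-trace w s′)) t refl
  ...     | eT , eS = w , s′ , cong₂ _,_
    (trans (sym (KingTableau.shape (TableauPair.king (Φ w s′))))
      (trans (cong shapeOf eT) (KingTableau.shape (TableauPair.king p))))
    (cong₂ _,_ eT eS)

theorem4p17 : (k : ℕ) .{{_ : NonZero k}} →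
    Σ[ Φ ∈ Bijection (Arrays k) (TableauPairs k) ]
    ((w : TwoLineArray k) →
    TableauPair.filling (Bijection.to Φ w) ≡ P-C w ×
    encode (TableauPair.ssot (Bijection.to Φ w)) ≋ Q-C w)
theorem4p17 k = record
  { to        = to
  ; cong      = λ {w} {w′} e → Φ-cong e (TwoLineArray.sorted w) (TwoLineArray.sorted w′)
  ; bijective = (λ {w} {w′} e → trace-injective (proj₁ (trace w)) (proj₁ (trace w′))
                   (cong (λ c → proj₁ (proj₂ c)) e) (cong (λ c → proj₂ (proj₂ c)) e))
              , λ p → let w , s , e = Φ-surjective p in
                  record { columns = w ; sorted = s } , λ {w′} e′ → trans (Φ-cong e′ (TwoLineArray.sorted w′) s) e
  } , λ w → proj₂ (trace w)
  where
  to : TwoLineArray k → TableauPair k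
  to w = Φ (TwoLineArray.columns w) (TwoLineArray.sorted w)
  trace : ∀ w → _
  trace w = Φ-trace (TwoLineArray.columns w) (TwoLineArray.sorted w)
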